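{- Let $\mathbf{n}=(n_1,\dots,n_l)$ with $0\le n_1\le n_2\le\cdots\le n_l\le N$. (i) Let $\lambda$ be the hook shape $(a,1^b)$ with $a\ge1$ and $b=l-1\ge0$. Then in $\mathcal{U}/I_{\mathrm{KR}}^{\mathrm{st}}$, $J_\lambda^{\mathbf{n}}=\sum_{T\in\mathrm{SYT}(\lambda')^{\mathbf{n}}}\mathrm{creading}(T)$. (ii) If $a\ge2$, $\lambda=(a,2)$ and $l=2$, then in $\mathcal{U}/I_{\mathrm{KR}}^{\mathrm{st}}$, $J_\lambda^{\mathbf{n}}=\sum_{T\in\mathrm{SYT}(\lambda')^{\mathbf{n}},\,T_{1,2}>T_{2,1}}\mathrm{creading}(T)+\sum_{T\in\mathrm{SYT}(\lambda')^{\mathbf{n}},\,T_{1,2}<T_{2,1}}\mathrm{reading}(T)$. In particular, $\mathfrak{J}_\lambda(\mathbf{u})$ is a positive sum of monomials in $\mathcal{U}/I_{\mathrm{KR}}^{\mathrm{st}}$ if $\lambda$ is a hook shape or of the form $(a,2)'$.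
   Context: $\mathcal{U}=\mathbb{Z}\langle u_1,\dots,u_N\rangle$, the letter $a$ denotes $u_a$, monomials are words. $I_{\mathrm{KR}}^{\mathrm{st}}$ is the two-sided ideal generated by $b(ac-ca)-(ac-ca)b$ ($a<b<c$) and all words with a repeated letter. For $0\le m\le N$ and $d>0$, $e_d([m])=\sum_{m\ge i_1>\cdots>i_d\ge1}u_{i_1}\cdots u_{i_d}$, $e_0([m])=1$, $e_d([m])=0$ for $d<0$ (so $e_d([0])=0$ for $d\ne0$). For a weak composition $\alpha=(\alpha_1,\dots,\alpha_l)$, $J_\alpha^{\mathbf{n}}=\sum_{\pi\in S_l}\mathrm{sgn}(\pi)e_{\alpha_1+\pi(1)-1}([n_1])\cdots e_{\alpha_l+\pi(l)-l}([n_l])$. For a partition $\lambda$, $\mathfrak{J}_\lambda(\mathbf{u})=J_{\lambda'}^{N,\dots,N}$ with $\lambda'$ the conjugate partition. Tableaux use English convention; $T_{r,c}$ is the entry in row $r$, column $c$. $\mathrm{SYT}(\mu)^{\mathbf{n}}$ is the set of semistandard Young tableaux of shape $\mu$ (rows weakly increasing, columns strictly increasing) with no repeated entry and with all entries in column $c$ lying in $[n_c]$. $\mathrm{reading}(T)$ concatenates the rows, each read left to right, starting with the bottom row; $\mathrm{creading}(T)$ concatenates the columns, each read bottom to top, starting with the leftmost column. A positive sum of monomials in $\mathcal{U}/I$ means congruent modulo $I$ to a nonnegative integer combination of words. -}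

module Defs where

open import Data.Nat as ℕ using (ℕ; zero; suc; _≤_; _<_; _⊔_; _≤?_)
open import Data.Integer as ℤ using (ℤ; +_; -[1+_]) renaming (_+_ to _+ℤ_; _*_ to _*ℤ_; _-_ to _-ℤ_)
open import Data.List using (List; []; _∷_; _++_; map; concat; concatMap; reverse; length; upTo; mapMaybe; filter; replicate; foldr)
open import Data.List.Properties using (≡-dec)
open import Data.List.Relation.Unary.All using (All)
open import Data.List.Relation.Unary.Unique.Propositional using (Unique)
open import Data.List.Membership.Propositional using (_∈_)
open import Data.Maybe using (Maybe; just; nothing; _>>=_)
open import Data.Product using (Σ; _×_; _,_; ∃₂)
open import Data.Bool using (if_then_else_)
open import Relation.Nullary using (does)
open import Relation.Binary.PropositionalEquality using (_≡_)
open import Function.Bundles using (_⇔_)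

-- Words and the free ℤ-algebra 𝒰 = ℤ⟨u_1,…,u_N⟩
-- A letter is a natural number a (standing for u_a); a word is a list of letters.
-- An element of 𝒰 is represented by a formal ℤ-linear combination of words.

Word : Set
Word = List ℕ

Poly : Set
Poly = List (ℤ × Word)

zeroP : Poly
zeroP = []

oneP : Poly
oneP = (+ 1 , []) ∷ []

_·_ : Poly → Poly → Poly
p · q = concatMap (λ { (c , w) → map (λ { (d , v) → (c *ℤ d , w ++ v) }) q }) p

scale : ℤ → Poly → Poly
scale k p = map (λ { (c , w) → (k *ℤ c , w) }) p

sumWords : List Word → Poly
sumWords ws = map (λ w → (+ 1 , w)) ws

coeff : Poly → Word → ℤ
coeff p w = foldr (λ { (c , v) acc → (if does (≡-dec ℕ._≟_ v w) then c else + 0) +ℤ acc }) (+ 0) p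

InRange : ℕ → ℕ → Set
InRange N x = 1 ≤ x × x ≤ N

data HasRepeat : Word → Set where
  here  : ∀ {x xs} → x ∈ xs → HasRepeat (x ∷ xs)
  there : ∀ {x xs} → HasRepeat xs → HasRepeat (x ∷ xs)

data Gen (N : ℕ) : Set where
  kr  : (a b c : ℕ) → 1 ≤ a → a < b → b < c → c ≤ N → Gen N
  rep : (w : Word) → All (InRange N) w → HasRepeat w → Gen N

-- b(ac − ca) − (ac − ca)b = bac − bca − acb + cab
genPoly : ∀ {N} → Gen N → Poly
genPoly (kr a b c _ _ _ _) =
  (+ 1 , b ∷ a ∷ c ∷ []) ∷ (ℤ.- (+ 1) , b ∷ c ∷ a ∷ []) ∷
  (ℤ.- (+ 1) , a ∷ c ∷ b ∷ []) ∷ (+ 1 , c ∷ a ∷ b ∷ []) ∷ []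
genPoly (rep w _ _) = (+ 1 , w) ∷ []

record IdealTerm (N : ℕ) : Set where
  constructor iterm
  field
    coef  : ℤ
    left  : Word
    left∈ : All (InRange N) left
    gen   : Gen N
    right : Word
    right∈ : All (InRange N) right

termPoly : ∀ {N} → IdealTerm N → Poly
termPoly t = scale (IdealTerm.coef t)
  (((+ 1 , IdealTerm.left t) ∷ []) · (genPoly (IdealTerm.gen t) · ((+ 1 , IdealTerm.right t) ∷ [])))

idealSum : ∀ {N} → List (IdealTerm N) → Poly
idealSum ts = concatMap termPoly ts

-- p ≡ q in 𝒰 / I_KR^st : p − q is (as an element of the free ℤ-module on words)
-- a finite ℤ-combination of elements u g v with g a generator.
Cong : ℕ → Poly → Poly → Set
Cong N p q = Σ (List (IdealTerm N)) λ ts →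
  ∀ w → coeff p w -ℤ coeff q w ≡ coeff (idealSum ts) w

PositiveSum : ℕ → Poly → Set
PositiveSum N p = Σ (List Word) λ ws → Cong N p (sumWords ws)

-- Elementary symmetric e_d([m]) = Σ_{m ≥ i_1 > ⋯ > i_d ≥ 1} u_{i_1}⋯u_{i_d}
-- (sum over strictly decreasing words; split on whether i_1 = m)

e : ℕ → ℕ → Poly
e zero    m       = oneP
e (suc d) zero    = zeroP
e (suc d) (suc m) = e (suc d) m ++ map (λ { (c , w) → (c , suc m ∷ w) }) (e d m)

eZ : ℤ → ℕ → Poly
eZ (+ d)    m = e d m
eZ -[1+ _ ] m = zeroP

insertAll : ℕ → List ℕ → List (List ℕ)
insertAll x []       = (x ∷ []) ∷ []
insertAll x (y ∷ ys) = (x ∷ y ∷ ys) ∷ map (y ∷_) (insertAll x ys)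

perms : ℕ → List (List ℕ)
perms zero    = [] ∷ []
perms (suc k) = concatMap (insertAll k) (perms k)

inversions : List ℕ → ℕ
inversions []       = 0
inversions (x ∷ xs) = length (filter (λ y → suc y ≤? x) xs) ℕ.+ inversions xs

sgn : List ℕ → ℤ
sgn p = (ℤ.- (+ 1)) ℤ.^ inversions p

-- J_α^𝐧 = Σ_{π∈S_l} sgn(π) e_{α_1+π(1)-1}([n_1]) ⋯ e_{α_l+π(l)-l}([n_l])
-- (0-based: the i-th factor is e_{α_i + p_i − i}([n_i]) with p = π − 1)

Jterm : ℕ → List ℕ → List ℕ → List ℕ → Poly
Jterm i (a ∷ as) (p ∷ ps) (m ∷ ms) = eZ ((+ a +ℤ + p) -ℤ + i) m · Jterm (suc i) as ps ms
Jterm i _ _ _ = oneP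

J : List ℕ → List ℕ → Poly
J α n = concatMap (λ p → scale (sgn p) (Jterm 0 α p n)) (perms (length α))

conj : List ℕ → List ℕ
conj []       = []
conj (a ∷ λ′) = map (λ j → length (filter (λ x → suc j ≤? x) (a ∷ λ′))) (upTo a)

frakJ : ℕ → List ℕ → Poly
frakJ N λ′ = J (conj λ′) (replicate (length (conj λ′)) N)

hook : ℕ → ℕ → List ℕ
hook a b = a ∷ replicate b 1

-- Tableaux (English convention): a list of rows, top row first

Tableau : Set
Tableau = List (List ℕ)

_!?_ : {A : Set} → List A → ℕ → Maybe A
[]       !? _     = nothing
(x ∷ xs) !? zero  = just x
(x ∷ xs) !? suc i = xs !? i

at : Tableau → ℕ → ℕ → Maybe ℕ
at T r c = (T !? r) >>= λ row → row !? c

record SYT (μ : List ℕ) (n : List ℕ) (T : Tableau) : Set where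
  field
    shape    : map length T ≡ μ
    rowsWeak : ∀ r c x y → at T r c ≡ just x → at T r (suc c) ≡ just y → x ≤ y
    colsStr  : ∀ r c x y → at T r c ≡ just x → at T (suc r) c ≡ just y → x < y
    noRepeat : Unique (concat T)
    colBound : ∀ r c x → at T r c ≡ just x →
               Σ ℕ λ m → (n !? c ≡ just m) × (1 ≤ x × x ≤ m)

reading : Tableau → Word
reading T = concat (reverse T)

width : Tableau → ℕ
width T = foldr (λ row k → length row ⊔ k) 0 T

column : ℕ → Tableau → List ℕ
column c T = mapMaybe (λ row → row !? c) T

creading : Tableau → Word
creading T = concat (map (λ c → reverse (column c T)) (upTo (width T)))

-- T_{1,2} > T_{2,1}  (1-based, as in the paper)
T12>T21 : Tableau → Set
T12>T21 T = ∃₂ λ x y → at T 0 1 ≡ just x × at T 1 0 ≡ just y × y < x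

T12<T21 : Tableau → Set
T12<T21 T = ∃₂ λ x y → at T 0 1 ≡ just x × at T 1 0 ≡ just y × x < y

Enumerates : {A : Set} → (A → Set) → List A → Set
Enumerates P ts = Unique ts × (∀ T → (T ∈ ts) ⇔ P T)

{-# OPTIONS --safe #-}
module Submission where

-- Words with a repeated letter lie in the ideal, so only coefficients at words with distinct letters matter.
--
-- (i) Among the permutations in J for a hook only those with π(i) ≥ i − 1 contribute. Let J_k be the upper left
-- minor of order k; expanding along the last column gives J_{k+1} = J_k e_d − J_k', where J_k' is J_k with its
-- last column moved so that the entry in row k gains d.
-- On words, a decreasing run of length d placed after a ribbon continues it with an ascent or with a descent;
-- the descents are J_k', so by induction J is the sum of the words that decrease a times and then increase.
--
-- (ii) J = e_a([n₁]) e_2([n₂]) − e_{a+1}([n₁]) e_1([n₂]). Adding u (yxz − yzx − xzy + zxy) for every decreasing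
-- word u over [n₁] of length a − 1 and all letters x < y < z ≤ n₂ with y below the last letter of u turns J into
-- the required sum; this is an identity between the relative orders of the last four letters.

open import Defs
open import Data.Empty using (⊥; ⊥-elim)
open import Data.Integer as ℤ using (ℤ; +_; -_; _+_; _*_; _-_)
import Data.Integer.Properties as ℤₚ
open import Data.Integer.Tactic.RingSolver using (solve-∀)
open import Data.List using (List; []; _∷_; [_]; _++_; _ʳ++_; map; length; concat; concatMap; reverse; take; drop;
  filter; deduplicate; replicate; upTo; applyUpTo; cartesianProduct)
open import Data.List.Membership.Propositional using (_∈_)
open import Data.List.Membership.Propositional.Properties
  using (∈-filter⁺; ∈-filter⁻; ∈-deduplicate⁺; ∈-cartesianProduct⁺; ∈-upTo⁺)
import Data.List.Properties as Listₚ
open import Data.List.Relation.Binary.Permutation.Propositional using (_↭_; ↭-sym; ↭-trans; ↭⇒↭ₛ)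
open import Data.List.Relation.Binary.Permutation.Propositional.Properties
  using (++-comm; ↭-reverse; All-resp-↭; ++⁺ʳ)
import Data.List.Relation.Binary.Permutation.Setoid.Properties as Permₛ
open import Data.List.Relation.Unary.All as All using (All; []; _∷_)
import Data.List.Relation.Unary.All.Properties as Allₚ
open import Data.List.Relation.Unary.AllPairs using ([]; _∷_)
open import Data.List.Relation.Unary.Any using (here; there)
open import Data.List.Relation.Unary.Linked using (Linked; []; [-]; _∷_)
open import Data.List.Relation.Unary.Unique.DecPropositional.Properties using (deduplicate-!)
open import Data.List.Relation.Unary.Unique.Propositional using (Unique)
import Data.List.Relation.Unary.Unique.Propositional.Properties as Uniqueₚ
open import Data.Maybe using (just; nothing; fromMaybe)
open import Data.Nat as ℕ using (ℕ; zero; suc; _∸_; _≤_; _<_; z≤n; s≤s; _≤?_; _<?_)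
import Data.Nat.Properties as ℕₚ
open import Data.List.Membership.DecPropositional ℕ._≟_ using (_∈?_)
open import Data.Product using (Σ; _×_; _,_; proj₁; proj₂)
open import Data.Sum using (_⊎_; inj₁; inj₂)
open import Data.Unit using (⊤; tt)
open import Function using (_∘_)
open import Function.Bundles using (Equivalence)
open import Relation.Binary.Definitions using (tri<; tri≈; tri>)
open import Relation.Binary.PropositionalEquality
  using (_≡_; _≢_; refl; sym; trans; cong; cong₂; subst; setoid; module ≡-Reasoning)
open import Relation.Nullary using (Dec; yes; no; ¬_; contradiction; _×-dec_; _⊎-dec_)

open ≡-Reasoning

-- The bound on the middle letter in (ii) is what makes the result positive. Let x₄ be the last
-- letter of u and x₃ x₂ x₁ the three letters behind it. On words with x₃ < x₄ the corrections for
-- all triples would cancel J completely. In y x z, y z x and z x y the middle letter y is at most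
-- x₃, hence below x₄, so the bound touches just x z y: with it, exactly the words whose final
-- letter y exceeds x₄ survive, and these are the column readings. On words with x₃ > x₄ the
-- determinant vanishes, and among the corrections the bound leaves z x y with y < x₄ < z, with a
-- plus sign: the row readings. Every claim is tested one word at a time, so each becomes an
-- identity between sums and products of indicators. Words are read from the right end because J is
-- peeled factor by factor from there, and the degree of a factor fixes how many letters it takes.

-- Indicators and finite sums of integers

𝟙 : {P : Set} → Dec P → ℤ
𝟙 (yes _) = + 1
𝟙 (no _)  = + 0

𝟙-yes : {P : Set} (d : Dec P) → P → 𝟙 d ≡ + 1
𝟙-yes (yes _) _ = refl
𝟙-yes (no ¬p) p = contradiction p ¬p

𝟙-no : {P : Set} (d : Dec P) → ¬ P → 𝟙 d ≡ + 0
𝟙-no (yes p) ¬p = contradiction p ¬p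
𝟙-no (no _)  _  = refl

𝟙-cong : {P Q : Set} (d : Dec P) (d′ : Dec Q) → (P → Q) → (Q → P) → 𝟙 d ≡ 𝟙 d′
𝟙-cong (yes p) d′ f g = sym (𝟙-yes d′ (f p))
𝟙-cong (no ¬p) d′ f g = sym (𝟙-no d′ (¬p ∘ g))

𝟙-× : {P Q : Set} (d : Dec P) (d′ : Dec Q) → 𝟙 (d ×-dec d′) ≡ 𝟙 d * 𝟙 d′
𝟙-× (yes _) (yes _) = refl
𝟙-× (yes _) (no _)  = refl
𝟙-× (no _)  (yes _) = refl
𝟙-× (no _)  (no _)  = refl

𝟙-⊎ : {P Q : Set} (d : Dec P) (d′ : Dec Q) → (P → ¬ Q) → 𝟙 (d ⊎-dec d′) ≡ 𝟙 d + 𝟙 d′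
𝟙-⊎ (yes p) (yes q) disjoint = contradiction q (disjoint p)
𝟙-⊎ (yes _) (no _)  disjoint = refl
𝟙-⊎ (no _)  (yes _) disjoint = refl
𝟙-⊎ (no _)  (no _)  disjoint = refl

∑ : {A : Set} → List A → (A → ℤ) → ℤ
∑ []       f = + 0
∑ (x ∷ xs) f = f x + ∑ xs f

∑-cong∈ : {A : Set} (xs : List A) {f g : A → ℤ} → (∀ x → x ∈ xs → f x ≡ g x) → ∑ xs f ≡ ∑ xs g
∑-cong∈ []       eq = refl
∑-cong∈ (x ∷ xs) eq = cong₂ _+_ (eq x (here refl)) (∑-cong∈ xs (λ y → eq y ∘ there))

∑-cong : {A : Set} (xs : List A) {f g : A → ℤ} → (∀ x → f x ≡ g x) → ∑ xs f ≡ ∑ xs g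
∑-cong xs eq = ∑-cong∈ xs (λ x _ → eq x)

∑-++ : {A : Set} (xs ys : List A) (f : A → ℤ) → ∑ (xs ++ ys) f ≡ ∑ xs f + ∑ ys f
∑-++ []       ys f = sym (ℤₚ.+-identityˡ _)
∑-++ (x ∷ xs) ys f = trans (cong (_+_ (f x)) (∑-++ xs ys f)) (sym (ℤₚ.+-assoc (f x) (∑ xs f) (∑ ys f)))

∑-map : {A B : Set} (g : A → B) (xs : List A) (f : B → ℤ) → ∑ (map g xs) f ≡ ∑ xs (f ∘ g)
∑-map g []       f = refl
∑-map g (x ∷ xs) f = cong (_+_ (f (g x))) (∑-map g xs f)

∑-concatMap : {A B : Set} (g : A → List B) (xs : List A) (f : B → ℤ) →
              ∑ (concatMap g xs) f ≡ ∑ xs (λ x → ∑ (g x) f)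
∑-concatMap g []       f = refl
∑-concatMap g (x ∷ xs) f = trans (∑-++ (g x) _ f) (cong (_+_ (∑ (g x) f)) (∑-concatMap g xs f))

∑-*ˡ : {A : Set} (k : ℤ) (xs : List A) (f : A → ℤ) → ∑ xs (λ x → k * f x) ≡ k * ∑ xs f
∑-*ˡ k []       f = sym (ℤₚ.*-zeroʳ k)
∑-*ˡ k (x ∷ xs) f = trans (cong (_+_ (k * f x)) (∑-*ˡ k xs f)) (sym (ℤₚ.*-distribˡ-+ k (f x) (∑ xs f)))

∑-+ : {A : Set} (xs : List A) (f g : A → ℤ) → ∑ xs (λ x → f x + g x) ≡ ∑ xs f + ∑ xs g
∑-+ []       f g = refl
∑-+ (x ∷ xs) f g = trans (cong (_+_ (f x + g x)) (∑-+ xs f g)) (interchange (f x) (g x) _ _)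
  where
  interchange : ∀ a b c d → a + b + (c + d) ≡ a + c + (b + d)
  interchange = solve-∀

∑-zero : {A : Set} (xs : List A) {f : A → ℤ} → (∀ x → x ∈ xs → f x ≡ + 0) → ∑ xs f ≡ + 0
∑-zero []       eq = refl
∑-zero (x ∷ xs) eq = cong₂ _+_ (eq x (here refl)) (∑-zero xs (λ y → eq y ∘ there))

∑-unique : {A : Set} {xs : List A} {f : A → ℤ} {x₀ : A} → Unique xs → x₀ ∈ xs →
           (∀ x → x ∈ xs → x ≢ x₀ → f x ≡ + 0) → ∑ xs f ≡ f x₀
∑-unique {xs = x ∷ xs} {f} (x∉ ∷ _) (here refl) vanish =
  trans (cong (_+_ (f x)) (∑-zero xs λ y y∈ → vanish y (there y∈) λ y≡x → All.lookup x∉ y∈ (sym y≡x)))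
        (ℤₚ.+-identityʳ _)
∑-unique {xs = _ ∷ xs} (x∉ ∷ u) (there x₀∈) vanish =
  trans (cong₂ _+_ (vanish _ (here refl) (All.lookup x∉ x₀∈))
                   (∑-unique u x₀∈ λ y y∈ → vanish y (there y∈)))
        (ℤₚ.+-identityˡ _)

-- Coefficients and the product of representatives

_≟ᵂ_ : (v w : Word) → Dec (v ≡ w)
_≟ᵂ_ = Listₚ.≡-dec ℕ._≟_

δ : Word → Word → ℤ
δ v w = 𝟙 (v ≟ᵂ w)

δ-refl : ∀ w → δ w w ≡ + 1
δ-refl w = 𝟙-yes (w ≟ᵂ w) refl

coeff-∑ : ∀ p w → coeff p w ≡ ∑ p (λ t → proj₁ t * δ (proj₂ t) w)
coeff-∑ [] w = refl
coeff-∑ ((c , v) ∷ p) w with v ≟ᵂ w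
... | yes _ = cong₂ _+_ (sym (ℤₚ.*-identityʳ c)) (coeff-∑ p w)
... | no _  = cong₂ _+_ (sym (ℤₚ.*-zeroʳ c)) (coeff-∑ p w)

coeff-++ : ∀ p q w → coeff (p ++ q) w ≡ coeff p w + coeff q w
coeff-++ p q w = trans (coeff-∑ (p ++ q) w)
  (trans (∑-++ p q _) (cong₂ _+_ (sym (coeff-∑ p w)) (sym (coeff-∑ q w))))

coeff-concatMap : {A : Set} (g : A → Poly) (xs : List A) (w : Word) →
                  coeff (concatMap g xs) w ≡ ∑ xs (λ x → coeff (g x) w)
coeff-concatMap g xs w = trans (coeff-∑ (concatMap g xs) w)
  (trans (∑-concatMap g xs _) (∑-cong xs λ x → sym (coeff-∑ (g x) w)))

coeff-scale : ∀ k p w → coeff (scale k p) w ≡ k * coeff p w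
coeff-scale k p w = trans (coeff-∑ (scale k p) w) (trans (∑-map _ p _)
  (trans (∑-cong p (λ t → ℤₚ.*-assoc k (proj₁ t) _))
  (trans (∑-*ˡ k p _) (cong (k *_) (sym (coeff-∑ p w))))))

coeff-sumWords : ∀ ws w → coeff (sumWords ws) w ≡ ∑ ws (λ v → δ v w)
coeff-sumWords ws w = trans (coeff-∑ (sumWords ws) w)
  (trans (∑-map _ ws _) (∑-cong ws λ v → ℤₚ.*-identityˡ _))

-- Gives a finite supply of candidate words when a positive sum has to be produced without an
-- enumeration of tableaux.
coeff≢0⇒∈ : ∀ p w → coeff p w ≢ + 0 → w ∈ map proj₂ p
coeff≢0⇒∈ [] w ≢0 = contradiction refl ≢0
coeff≢0⇒∈ ((c , v) ∷ p) w ≢0 with v ≟ᵂ w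
... | yes refl = here refl
... | no _     = there (coeff≢0⇒∈ p w (≢0 ∘ trans (ℤₚ.+-identityˡ _)))

mono : ℤ → Word → ℤ × Word → ℤ × Word
mono c w (d , v) = c * d , w ++ v

-- The pattern-matching lambda in `_·_` has no name; it agrees pointwise with `mono`, which can be
-- named in later rewriting.
·-∷ : ∀ c w p q → ((c , w) ∷ p) · q ≡ map (mono c w) q ++ p · q
·-∷ c w p q = cong (_++ p · q) (Listₚ.map-cong (λ _ → refl) q)

·-++ : ∀ p p′ q → (p ++ p′) · q ≡ p · q ++ p′ · q
·-++ p p′ q = Listₚ.concatMap-++ _ p p′

·-zeroʳ : ∀ p → p · zeroP ≡ zeroP
·-zeroʳ []      = refl
·-zeroʳ (_ ∷ p) = ·-zeroʳ p

·-identityʳ : ∀ p → p · oneP ≡ p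
·-identityʳ []            = refl
·-identityʳ ((c , w) ∷ p) =
  cong₂ _∷_ (cong₂ _,_ (ℤₚ.*-identityʳ c) (Listₚ.++-identityʳ w)) (·-identityʳ p)

·-identityˡ : ∀ p → oneP · p ≡ p
·-identityˡ p = trans (Listₚ.++-identityʳ _)
  (trans (Listₚ.map-cong (λ t → cong (_, proj₂ t) (ℤₚ.*-identityˡ (proj₁ t))) p) (Listₚ.map-id p))

mono-· : ∀ c w p q → map (mono c w) p · q ≡ map (mono c w) (p · q)
mono-· c w []            q = refl
mono-· c w ((d , v) ∷ p) q = begin
  (mono c w (d , v) ∷ map (mono c w) p) · q
    ≡⟨ ·-∷ (c * d) (w ++ v) (map (mono c w) p) q ⟩
  map (mono (c * d) (w ++ v)) q ++ map (mono c w) p · q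
    ≡⟨ cong₂ _++_ (trans (Listₚ.map-cong mono-mono q) (Listₚ.map-∘ q)) (mono-· c w p q) ⟩
  map (mono c w) (map (mono d v) q) ++ map (mono c w) (p · q)
    ≡⟨ Listₚ.map-++ (mono c w) (map (mono d v) q) (p · q) ⟨
  map (mono c w) (map (mono d v) q ++ p · q)
    ≡⟨ cong (map (mono c w)) (·-∷ d v p q) ⟨
  map (mono c w) (((d , v) ∷ p) · q) ∎
  where
  mono-mono : ∀ t → mono (c * d) (w ++ v) t ≡ mono c w (mono d v t)
  mono-mono (b , u) = cong₂ _,_ (ℤₚ.*-assoc c d b) (Listₚ.++-assoc w v u)

-- Holds for the lists of terms themselves and not just for their coefficients, so products can be
-- rebracketed in any context.
·-assoc : ∀ p q r → (p · q) · r ≡ p · (q · r)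
·-assoc []            q r = refl
·-assoc ((c , w) ∷ p) q r = begin
  (((c , w) ∷ p) · q) · r               ≡⟨ cong (_· r) (·-∷ c w p q) ⟩
  (map (mono c w) q ++ p · q) · r       ≡⟨ ·-++ (map (mono c w) q) (p · q) r ⟩
  map (mono c w) q · r ++ (p · q) · r   ≡⟨ cong₂ _++_ (mono-· c w q r) (·-assoc p q r) ⟩
  map (mono c w) (q · r) ++ p · (q · r) ≡⟨ ·-∷ c w p (q · r) ⟨
  ((c , w) ∷ p) · (q · r)               ∎

-- Products with a homogeneous right factor

Homogeneous : ℕ → Poly → Set
Homogeneous d = All (λ t → length (proj₂ t) ≡ d)

-- Words are compared from the right: reversing them turns a homogeneous right factor into a prefix.
coeffʳ : Poly → Word → ℤ
coeffʳ p v = coeff p (reverse v)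

private
  take-++ : (u v : Word) → take (length u) (u ++ v) ≡ u
  take-++ []      v = refl
  take-++ (x ∷ u) v = cong (x ∷_) (take-++ u v)

  drop-++ : (u v : Word) → drop (length u) (u ++ v) ≡ v
  drop-++ []      v = refl
  drop-++ (x ∷ u) v = drop-++ u v

-- The length of `u` leaves one possible cut. In the reversed word this cut is made by `take d` and
-- `drop d`, whatever the length of `w`.
δ-++ : ∀ d w u v → length u ≡ d →
       δ (w ++ u) (reverse v) ≡ δ w (reverse (drop d v)) * δ u (reverse (take d v))
δ-++ d w u v refl = trans
  (𝟙-cong _ ((w ≟ᵂ reverse (drop d v)) ×-dec (u ≟ᵂ reverse (take d v))) split join)
  (𝟙-× (w ≟ᵂ reverse (drop d v)) (u ≟ᵂ reverse (take d v)))
  where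
  join : w ≡ reverse (drop d v) × u ≡ reverse (take d v) → w ++ u ≡ reverse v
  join (refl′ , refl″) = begin
    w ++ u                                       ≡⟨ cong₂ _++_ refl′ refl″ ⟩
    reverse (drop d v) ++ reverse (take d v)     ≡⟨ Listₚ.reverse-++ (take d v) (drop d v) ⟨
    reverse (take d v ++ drop d v)               ≡⟨ cong reverse (Listₚ.take++drop≡id d v) ⟩
    reverse v                                    ∎

  split : w ++ u ≡ reverse v → w ≡ reverse (drop d v) × u ≡ reverse (take d v)
  split eq =
    trans (sym (Listₚ.reverse-involutive w)) (cong reverse (sym drop≡)) ,
    trans (sym (Listₚ.reverse-involutive u)) (cong reverse (sym take≡))
    where
    v≡ : v ≡ reverse u ++ reverse w
    v≡ = trans (sym (Listₚ.reverse-involutive v)) (trans (cong reverse (sym eq)) (Listₚ.reverse-++ w u))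
    d≡ : d ≡ length (reverse u)
    d≡ = sym (Listₚ.length-reverse u)
    drop≡ : drop d v ≡ reverse w
    drop≡ = trans (cong₂ drop d≡ v≡) (drop-++ (reverse u) _)
    take≡ : take d v ≡ reverse u
    take≡ = trans (cong₂ take d≡ v≡) (take-++ (reverse u) _)

-- A coefficient of a product is in general a sum over all cuts of the word; homogeneity of `q`
-- leaves a single cut. If `v` has fewer than `d` letters, both sides are 0.
coeffʳ-· : ∀ d p q v → Homogeneous d q →
           coeffʳ (p · q) v ≡ coeffʳ p (drop d v) * coeffʳ q (take d v)
coeffʳ-· d []            q v hom = refl
coeffʳ-· d ((c , w) ∷ p) q v hom = begin
  coeffʳ (((c , w) ∷ p) · q) v
    ≡⟨ cong (λ r → coeff r (reverse v)) (·-∷ c w p q) ⟩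
  coeff (map (mono c w) q ++ p · q) (reverse v)
    ≡⟨ coeff-++ (map (mono c w) q) (p · q) (reverse v) ⟩
  coeff (map (mono c w) q) (reverse v) + coeffʳ (p · q) v
    ≡⟨ cong₂ _+_ (left q hom) (coeffʳ-· d p q v hom) ⟩
  c * δ w v₁ * Q + coeff p v₁ * Q
    ≡⟨ ℤₚ.*-distribʳ-+ Q (c * δ w v₁) (coeff p v₁) ⟨
  (c * δ w v₁ + coeff p v₁) * Q
    ≡⟨ cong (λ z → (c * δ w v₁ + z) * Q) (coeff-∑ p v₁) ⟩
  (c * δ w v₁ + ∑ p (λ t → proj₁ t * δ (proj₂ t) v₁)) * Q
    ≡⟨ cong (_* Q) (coeff-∑ ((c , w) ∷ p) v₁) ⟨
  coeff ((c , w) ∷ p) v₁ * Q ∎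
  where
  v₁ = reverse (drop d v)
  v₂ = reverse (take d v)
  Q  = coeff q v₂
  rearrange : ∀ a b x y → a * b * (x * y) ≡ a * x * (b * y)
  rearrange = solve-∀
  left : ∀ q → Homogeneous d q → coeff (map (mono c w) q) (reverse v) ≡ c * δ w v₁ * coeff q v₂
  left q hom = begin
    coeff (map (mono c w) q) (reverse v)
      ≡⟨ coeff-∑ (map (mono c w) q) (reverse v) ⟩
    ∑ (map (mono c w) q) (λ t → proj₁ t * δ (proj₂ t) (reverse v))
      ≡⟨ ∑-map (mono c w) q _ ⟩
    ∑ q (λ t → c * proj₁ t * δ (w ++ proj₂ t) (reverse v))
      ≡⟨ ∑-cong∈ q (λ t t∈ → trans (cong (c * proj₁ t *_) (δ-++ d w (proj₂ t) v (All.lookup hom t∈)))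
                                  (rearrange c (proj₁ t) _ _)) ⟩
    ∑ q (λ t → c * δ w v₁ * (proj₁ t * δ (proj₂ t) v₂))
      ≡⟨ ∑-*ˡ (c * δ w v₁) q _ ⟩
    c * δ w v₁ * ∑ q (λ t → proj₁ t * δ (proj₂ t) v₂)
      ≡⟨ cong (c * δ w v₁ *_) (coeff-∑ q v₂) ⟨
    c * δ w v₁ * coeff q v₂ ∎

-- Congruence reduced to words with distinct letters

-- A `rep` generator must be a word over 1, ... , N, so terms with a repeat can be moved into the
-- ideal as long as all words stay in this alphabet.
Supported : ℕ → Poly → Set
Supported N = All (λ t → All (InRange N) (proj₂ t))

scale-supported : ∀ {N} k {p} → Supported N p → Supported N (scale k p)
scale-supported k = Allₚ.map⁺

·-supported : ∀ {N p q} → Supported N p → Supported N q → Supported N (p · q)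
·-supported ps qs = Allₚ.concat⁺ (Allₚ.map⁺ (All.map (λ pw → Allₚ.map⁺ (All.map (Allₚ.++⁺ pw) qs)) ps))

concatMap-supported : ∀ {N} {A : Set} {f : A → Poly} (xs : List A) → (∀ x → Supported N (f x)) →
                      Supported N (concatMap f xs)
concatMap-supported xs sup = Allₚ.concat⁺ (Allₚ.map⁺ (All.universal sup xs))

genPoly-supported : ∀ {N} (g : Gen N) → Supported N (genPoly g)
genPoly-supported (kr a b c 1≤a a<b b<c c≤N) =
  (B ∷ A ∷ C ∷ []) ∷ (B ∷ C ∷ A ∷ []) ∷ (A ∷ C ∷ B ∷ []) ∷ (C ∷ A ∷ B ∷ []) ∷ []
  where
  b≤N = ℕₚ.≤-trans (ℕₚ.<⇒≤ b<c) c≤N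
  1≤b = ℕₚ.≤-trans 1≤a (ℕₚ.<⇒≤ a<b)
  A = 1≤a , ℕₚ.≤-trans (ℕₚ.<⇒≤ a<b) b≤N
  B = 1≤b , b≤N
  C = ℕₚ.≤-trans 1≤b (ℕₚ.<⇒≤ b<c) , c≤N
genPoly-supported (rep w w∈ _) = w∈ ∷ []

idealSum-supported : ∀ {N} (ts : List (IdealTerm N)) → Supported N (idealSum ts)
idealSum-supported ts = concatMap-supported ts λ { (iterm k l l∈ g r r∈) →
  scale-supported k {((+ 1 , _) ∷ []) · (genPoly g · ((+ 1 , _) ∷ []))}
    (·-supported {p = (+ 1 , _) ∷ []} (l∈ ∷ []) (·-supported (genPoly-supported g) (r∈ ∷ []))) }

repeat⊎unique : ∀ w → HasRepeat w ⊎ Unique w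
repeat⊎unique []      = inj₂ []
repeat⊎unique (x ∷ w) with x ∈? w | repeat⊎unique w
... | yes x∈ | _      = inj₁ (here x∈)
... | no _   | inj₁ r = inj₁ (there r)
... | no x∉  | inj₂ u = inj₂ (Allₚ.¬Any⇒All¬ w x∉ ∷ u)

repeat⇒¬unique : ∀ {w} → HasRepeat w → ¬ Unique w
repeat⇒¬unique (here x∈) (x∉ ∷ _) = All.lookup x∉ x∈ refl
repeat⇒¬unique (there r) (_ ∷ u)  = repeat⇒¬unique r u

-- A word with a repeat is itself a generator, so each such term becomes an ideal term with empty
-- words on both sides; equal words need not be collected.
repeatTerms : ∀ {N} p → Supported N p → List (IdealTerm N)
repeatTerms [] [] = []
repeatTerms ((c , w) ∷ p) (w∈ ∷ sup) with repeat⊎unique w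
... | inj₁ r = iterm c [] [] (rep w w∈ r) [] [] ∷ repeatTerms p sup
... | inj₂ _ = repeatTerms p sup

coeff-iterm : ∀ {N} c l l∈ (g : Gen N) r r∈ w →
  coeff (termPoly (iterm c l l∈ g r r∈)) w ≡ c * coeff (((+ 1 , l) ∷ []) · (genPoly g · ((+ 1 , r) ∷ []))) w
coeff-iterm c l l∈ g r r∈ w = coeff-scale c (((+ 1 , l) ∷ []) · (genPoly g · ((+ 1 , r) ∷ []))) w

coeff-single : ∀ c v w → coeff ((c , v) ∷ []) w ≡ c * δ v w
coeff-single c v w = trans (coeff-∑ ((c , v) ∷ []) w) (ℤₚ.+-identityʳ _)

coeff-∷ : ∀ c v p w → coeff ((c , v) ∷ p) w ≡ c * δ v w + coeff p w
coeff-∷ c v p w = trans (coeff-++ ((c , v) ∷ []) p w) (cong (_+ coeff p w) (coeff-single c v w))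

coeff-repTerm : ∀ {N} c w (w∈ : All (InRange N) w) r v →
  coeff (termPoly (iterm c [] [] (rep w w∈ r) [] [])) v ≡ c * δ w v
coeff-repTerm c w w∈ r v = trans (coeff-iterm c [] [] (rep w w∈ r) [] [] v)
  (cong (c *_) (trans
    (cong (λ p → coeff p v) (trans (·-identityˡ _) (·-identityʳ ((+ 1 , w) ∷ []))))
    (trans (coeff-single (+ 1) w v) (ℤₚ.*-identityˡ _))))

coeff-repeatTerms-unique : ∀ {N} p (sup : Supported N p) w → Unique w →
                           coeff (idealSum (repeatTerms p sup)) w ≡ + 0
coeff-repeatTerms-unique [] [] w u = refl
coeff-repeatTerms-unique ((c , v) ∷ p) (v∈ ∷ sup) w u with repeat⊎unique v
... | inj₂ _ = coeff-repeatTerms-unique p sup w u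
... | inj₁ r = begin
  coeff (termPoly t ++ idealSum (repeatTerms p sup)) w
    ≡⟨ coeff-++ (termPoly t) (idealSum (repeatTerms p sup)) w ⟩
  coeff (termPoly t) w + coeff (idealSum (repeatTerms p sup)) w
    ≡⟨ cong₂ _+_ (coeff-repTerm c v v∈ r w) (coeff-repeatTerms-unique p sup w u) ⟩
  c * δ v w + + 0
    ≡⟨ cong (λ z → c * z + + 0) (𝟙-no (v ≟ᵂ w) λ { refl → repeat⇒¬unique r u }) ⟩
  c * + 0 + + 0
    ≡⟨ cong (_+ + 0) (ℤₚ.*-zeroʳ c) ⟩
  + 0 ∎
  where t = iterm c [] [] (rep v v∈ r) [] []

coeff-repeatTerms-repeat : ∀ {N} p (sup : Supported N p) w → HasRepeat w →
                           coeff (idealSum (repeatTerms p sup)) w ≡ coeff p w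
coeff-repeatTerms-repeat [] [] w h = refl
coeff-repeatTerms-repeat ((c , v) ∷ p) (v∈ ∷ sup) w h with repeat⊎unique v
... | inj₁ r = trans (coeff-++ (termPoly (iterm c [] [] (rep v v∈ r) [] [])) (idealSum (repeatTerms p sup)) w) (trans
  (cong₂ _+_ (coeff-repTerm c v v∈ r w) (coeff-repeatTerms-repeat p sup w h))
  (sym (coeff-∷ c v p w)))
... | inj₂ u = begin
  coeff (idealSum (repeatTerms p sup)) w ≡⟨ coeff-repeatTerms-repeat p sup w h ⟩
  coeff p w                              ≡⟨ ℤₚ.+-identityˡ _ ⟨
  + 0 + coeff p w                        ≡⟨ cong (_+ coeff p w) (ℤₚ.*-zeroʳ c) ⟨
  c * + 0 + coeff p w                    ≡⟨ cong (λ z → c * z + coeff p w)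
                                              (𝟙-no (v ≟ᵂ w) λ { refl → repeat⇒¬unique h u }) ⟨
  c * δ v w + coeff p w                  ≡⟨ coeff-∷ c v p w ⟨
  coeff ((c , v) ∷ p) w                  ∎

-- The remainder `p − q − idealSum ts` vanishes at all words with distinct letters. The ideal terms
-- of its repeated words therefore reproduce it everywhere, and appending them to `ts` proves the
-- congruence.
cong-on-unique : ∀ {N p q} → Supported N p → Supported N q → (ts : List (IdealTerm N)) →
  (∀ w → Unique w → coeff p w - coeff (idealSum ts) w ≡ coeff q w) → Cong N p q
cong-on-unique {N} {p} {q} sp sq ts eq = ts ++ repeatTerms r sr , λ w → begin
  coeff p w - coeff q w
    ≡⟨ split (coeff p w) (coeff q w) (I w) ⟩
  I w + (coeff p w + - + 1 * coeff q w + - + 1 * I w)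
    ≡⟨ cong (_+_ (I w)) (coeff-r w) ⟨
  I w + coeff r w
    ≡⟨ cong (_+_ (I w)) (fixed w) ⟨
  I w + coeff (idealSum (repeatTerms r sr)) w
    ≡⟨ coeff-++ (idealSum ts) (idealSum (repeatTerms r sr)) w ⟨
  coeff (idealSum ts ++ idealSum (repeatTerms r sr)) w
    ≡⟨ cong (λ z → coeff z w) (Listₚ.concatMap-++ termPoly ts (repeatTerms r sr)) ⟨
  coeff (idealSum (ts ++ repeatTerms r sr)) w ∎
  where
  r = p ++ scale (- + 1) q ++ scale (- + 1) (idealSum ts)
  sr : Supported N r
  sr = Allₚ.++⁺ sp (Allₚ.++⁺ (scale-supported (- + 1) sq)
                              (scale-supported (- + 1) (idealSum-supported ts)))
  I : Word → ℤ
  I = coeff (idealSum ts)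
  coeff-r : ∀ w → coeff r w ≡ coeff p w + - + 1 * coeff q w + - + 1 * I w
  coeff-r w = trans (coeff-++ p _ w) (trans
    (cong (_+_ (coeff p w)) (trans (coeff-++ (scale (- + 1) q) _ w)
      (cong₂ _+_ (coeff-scale (- + 1) q w) (coeff-scale (- + 1) (idealSum ts) w))))
    (sym (ℤₚ.+-assoc (coeff p w) _ _)))
  split : ∀ a b c → a - b ≡ c + (a + - + 1 * b + - + 1 * c)
  split = solve-∀
  cancel : ∀ a c → a + - + 1 * (a - c) + - + 1 * c ≡ + 0
  cancel = solve-∀
  fixed : ∀ w → coeff (idealSum (repeatTerms r sr)) w ≡ coeff r w
  fixed w with repeat⊎unique w
  ... | inj₁ h = coeff-repeatTerms-repeat r sr w h
  ... | inj₂ u = trans (coeff-repeatTerms-unique r sr w u) (sym (begin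
    coeff r w
      ≡⟨ coeff-r w ⟩
    coeff p w + - + 1 * coeff q w + - + 1 * I w
      ≡⟨ cong (λ z → coeff p w + - + 1 * z + - + 1 * I w) (eq w u) ⟨
    coeff p w + - + 1 * (coeff p w - I w) + - + 1 * I w
      ≡⟨ cancel (coeff p w) (I w) ⟩
    + 0 ∎))

-- The words are drawn from the support of `p − idealSum ts`: a word with distinct letters
-- satisfying `P` has coefficient 1 there, hence occurs. Words with repeats may pass the filter as
-- well; they vanish in the quotient.
positive-on-unique : ∀ {N p} {P : Word → Set} → Supported N p → (ts : List (IdealTerm N)) →
  (P? : ∀ w → Dec (P w)) → (∀ w → Unique w → coeff p w - coeff (idealSum ts) w ≡ 𝟙 (P? w)) →
  PositiveSum N p
positive-on-unique {N} {p} sp ts P? eq = ws , cong-on-unique sp sup ts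
    λ w u → trans (eq w u) (trans (sym (indicator w u)) (sym (coeff-sumWords ws w)))
  where
  r = p ++ scale (- + 1) (idealSum ts)
  sr = Allₚ.++⁺ sp (scale-supported (- + 1) (idealSum-supported ts))
  cs = deduplicate _≟ᵂ_ (map proj₂ r)
  ws = filter P? cs
  coeff-r : ∀ w → coeff r w ≡ coeff p w - coeff (idealSum ts) w
  coeff-r w = trans (coeff-++ p _ w) (cong (_+_ (coeff p w))
    (trans (coeff-scale (- + 1) (idealSum ts) w) (ℤₚ.-1*i≡-i _)))
  sup : Supported N (sumWords ws)
  sup = Allₚ.map⁺ (Allₚ.filter⁺ P? (Allₚ.deduplicate⁺ _≟ᵂ_ (Allₚ.map⁺ sr)))
  ws! : Unique ws
  ws! = Uniqueₚ.filter⁺ P? (deduplicate-! _≟ᵂ_ (map proj₂ r))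
  indicator : ∀ w → Unique w → ∑ ws (λ v → δ v w) ≡ 𝟙 (P? w)
  indicator w u with P? w in Pw
  ... | no ¬Pw = ∑-zero ws λ v v∈ → 𝟙-no (v ≟ᵂ w) λ { refl → ¬Pw (proj₂ (∈-filter⁻ P? {xs = cs} v∈)) }
  ... | yes pw = trans (∑-unique ws! (∈-filter⁺ P? w∈ pw) λ v _ v≢w → 𝟙-no (v ≟ᵂ w) v≢w) (δ-refl w)
    where
    coeff≡1 : coeff r w ≡ + 1
    coeff≡1 = trans (coeff-r w) (trans (eq w u) (cong 𝟙 Pw))
    w∈ : w ∈ cs
    w∈ = ∈-deduplicate⁺ _≟ᵂ_ (coeff≢0⇒∈ r w λ ≡0 → contradiction (trans (sym ≡0) coeff≡1) λ ())

-- Coefficients of elementary symmetric functions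

inRange? : ∀ N x → Dec (InRange N x)
inRange? N x = (1 ≤? x) ×-dec (x ≤? N)

-- One bound carries both the alphabet and the strict decrease. Since `1 ≤ x`, the subtraction in
-- `x ∸ 1` is never truncated.
Decr : ℕ → ℕ → Word → Set
Decr m zero    []      = ⊤
Decr m zero    (_ ∷ _) = ⊥
Decr m (suc d) []      = ⊥
Decr m (suc d) (x ∷ w) = InRange m x × Decr (x ∸ 1) d w

Decr? : ∀ m d w → Dec (Decr m d w)
Decr? m zero    []      = yes tt
Decr? m zero    (_ ∷ _) = no λ ()
Decr? m (suc d) []      = no λ ()
Decr? m (suc d) (x ∷ w) = inRange? m x ×-dec Decr? (x ∸ 1) d w

-- `Decr` seen from the right end of the word. Just the last letter of the list, its largest, is
-- compared with `m`; the others are bounded through their neighbours.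
Inc : ℕ → ℕ → Word → Set
Inc m zero          []          = ⊤
Inc m zero          (_ ∷ _)     = ⊥
Inc m (suc zero)    []          = ⊥
Inc m (suc zero)    (y ∷ [])    = InRange m y
Inc m (suc zero)    (_ ∷ _ ∷ _) = ⊥
Inc m (suc (suc d)) []          = ⊥
Inc m (suc (suc d)) (_ ∷ [])    = ⊥
Inc m (suc (suc d)) (y ∷ x ∷ v) = (1 ≤ y × y < x) × Inc m (suc d) (x ∷ v)

below? : ∀ y x → Dec (1 ≤ y × y < x)
below? y x = (1 ≤? y) ×-dec (y <? x)

Inc? : ∀ m d v → Dec (Inc m d v)
Inc? m zero          []          = yes tt
Inc? m zero          (_ ∷ _)     = no λ ()
Inc? m (suc zero)    []          = no λ ()
Inc? m (suc zero)    (y ∷ [])    = inRange? m y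
Inc? m (suc zero)    (_ ∷ _ ∷ _) = no λ ()
Inc? m (suc (suc d)) []          = no λ ()
Inc? m (suc (suc d)) (_ ∷ [])    = no λ ()
Inc? m (suc (suc d)) (y ∷ x ∷ v) = below? y x ×-dec Inc? m (suc d) (x ∷ v)

Inc-head : ∀ {m} d {x v} → Inc m (suc d) (x ∷ v) → InRange m x
Inc-head zero    {v = []}    x∈ = x∈
Inc-head (suc d) {v = _ ∷ _} ((1≤x , x<y) , inc) =
  1≤x , ℕₚ.≤-trans (ℕₚ.<⇒≤ x<y) (proj₂ (Inc-head d inc))

prepend : ℕ → ℤ × Word → ℤ × Word
prepend k (c , w) = c , k ∷ w

e-suc : ∀ d m → e (suc d) (suc m) ≡ e (suc d) m ++ map (prepend (suc m)) (e d m)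
e-suc d m = cong (e (suc d) m ++_) (Listₚ.map-cong (λ _ → refl) (e d m))

coeff-prepend-[] : ∀ k p → coeff (map (prepend k) p) [] ≡ + 0
coeff-prepend-[] k []            = refl
coeff-prepend-[] k ((c , v) ∷ p) = trans (ℤₚ.+-identityˡ _) (coeff-prepend-[] k p)

coeff-prepend-≡ : ∀ k p w → coeff (map (prepend k) p) (k ∷ w) ≡ coeff p w
coeff-prepend-≡ k [] w = refl
coeff-prepend-≡ k ((c , v) ∷ p) w = begin
  coeff ((c , k ∷ v) ∷ map (prepend k) p) (k ∷ w)
    ≡⟨ coeff-∷ c (k ∷ v) (map (prepend k) p) (k ∷ w) ⟩
  c * δ (k ∷ v) (k ∷ w) + coeff (map (prepend k) p) (k ∷ w)
    ≡⟨ cong₂ (λ s t → c * s + t)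
         (𝟙-cong ((k ∷ v) ≟ᵂ (k ∷ w)) (v ≟ᵂ w) Listₚ.∷-injectiveʳ (cong (k ∷_))) (coeff-prepend-≡ k p w) ⟩
  c * δ v w + coeff p w
    ≡⟨ coeff-∷ c v p w ⟨
  coeff ((c , v) ∷ p) w ∎

coeff-prepend-≢ : ∀ k p x w → k ≢ x → coeff (map (prepend k) p) (x ∷ w) ≡ + 0
coeff-prepend-≢ k [] x w k≢x = refl
coeff-prepend-≢ k ((c , v) ∷ p) x w k≢x = begin
  coeff ((c , k ∷ v) ∷ map (prepend k) p) (x ∷ w)
    ≡⟨ coeff-∷ c (k ∷ v) (map (prepend k) p) (x ∷ w) ⟩
  c * δ (k ∷ v) (x ∷ w) + coeff (map (prepend k) p) (x ∷ w)
    ≡⟨ cong₂ (λ s t → c * s + t)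
         (𝟙-no ((k ∷ v) ≟ᵂ (x ∷ w)) (k≢x ∘ Listₚ.∷-injectiveˡ)) (coeff-prepend-≢ k p x w k≢x) ⟩
  c * + 0 + + 0
    ≡⟨ cong (_+ + 0) (ℤₚ.*-zeroʳ c) ⟩
  + 0 ∎

-- Follows the recursion of `e`: a word beginning with `suc m` can come from the second summand
-- alone, any other word from the first alone.
coeff-e : ∀ d m w → coeff (e d m) w ≡ 𝟙 (Decr? m d w)
coeff-e zero    m       []      = refl
coeff-e zero    m       (_ ∷ _) = refl
coeff-e (suc d) zero    []      = refl
coeff-e (suc d) zero    (x ∷ w) =
  sym (𝟙-no (Decr? 0 (suc d) (x ∷ w)) λ { ((1≤x , x≤0) , _) → ℕₚ.<⇒≱ 1≤x x≤0 })
coeff-e (suc d) (suc m) []      = trans (cong (λ p → coeff p []) (e-suc d m))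
  (trans (coeff-++ (e (suc d) m) _ [])
  (cong₂ _+_ (coeff-e (suc d) m []) (coeff-prepend-[] (suc m) (e d m))))
coeff-e (suc d) (suc m) (x ∷ w) = trans (cong (λ p → coeff p (x ∷ w)) (e-suc d m))
  (trans (coeff-++ (e (suc d) m) _ (x ∷ w)) (cases (suc m ℕ.≟ x)))
  where
  cases : Dec (suc m ≡ x) → coeff (e (suc d) m) (x ∷ w) + coeff (map (prepend (suc m)) (e d m)) (x ∷ w)
                          ≡ 𝟙 (Decr? (suc m) (suc d) (x ∷ w))
  cases (yes refl) = trans
    (cong₂ _+_ (trans (coeff-e (suc d) m (x ∷ w))
                      (𝟙-no (Decr? m (suc d) (x ∷ w)) λ { ((_ , m<m) , _) → ℕₚ.<-irrefl refl m<m }))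
               (trans (coeff-prepend-≡ (suc m) (e d m) w) (coeff-e d m w)))
    (trans (ℤₚ.+-identityˡ _)
      (𝟙-cong (Decr? m d w) (Decr? (suc m) (suc d) (x ∷ w)) (λ dec → (s≤s z≤n , ℕₚ.≤-refl) , dec) proj₂))
  cases (no m≢x) = trans
    (cong₂ _+_ (coeff-e (suc d) m (x ∷ w)) (coeff-prepend-≢ (suc m) (e d m) x w m≢x))
    (trans (ℤₚ.+-identityʳ _)
      (𝟙-cong (Decr? m (suc d) (x ∷ w)) (Decr? (suc m) (suc d) (x ∷ w))
        (λ { ((1≤x , x≤m) , dec) → (1≤x , ℕₚ.m≤n⇒m≤1+n x≤m) , dec })
        (λ { ((1≤x , x≤1+m) , dec) → (1≤x , ℕ.s≤s⁻¹ (ℕₚ.≤∧≢⇒< x≤1+m (m≢x ∘ sym))) , dec })))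

Decr-snoc⁻ : ∀ m d w y x → Decr m (suc d) (w ++ y ∷ x ∷ []) → Decr m d (w ++ y ∷ []) × InRange (y ∸ 1) x
Decr-snoc⁻ m (suc zero)    []          y x (y∈ , x∈ , _) = (y∈ , tt) , x∈
Decr-snoc⁻ m zero          (_ ∷ [])    y x (_ , ())
Decr-snoc⁻ m zero          (_ ∷ _ ∷ _) y x (_ , ())
Decr-snoc⁻ m (suc d)       (z ∷ w)     y x (z∈ , dec) with Decr-snoc⁻ (z ∸ 1) d w y x dec
... | dec′ , x∈ = (z∈ , dec′) , x∈

Decr-snoc⁺ : ∀ m d w y x → Decr m d (w ++ y ∷ []) → InRange (y ∸ 1) x → Decr m (suc d) (w ++ y ∷ x ∷ [])
Decr-snoc⁺ m (suc zero) []      y x (y∈ , _)    x∈ = y∈ , x∈ , tt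
Decr-snoc⁺ m (suc d)    (z ∷ w) y x (z∈ , dec)  x∈ = z∈ , Decr-snoc⁺ (z ∸ 1) d w y x dec x∈

reverse-∷∷ : (y x : ℕ) (v : Word) → reverse (x ∷ y ∷ v) ≡ reverse v ++ y ∷ x ∷ []
reverse-∷∷ y x v = Listₚ.reverse-++ (x ∷ y ∷ []) v

-- `Decr` is peeled at the left end of the word and `Inc` at the right; `Decr-snoc⁻` transfers the
-- peeling from one end to the other.
Decr⇒Inc : ∀ m d v → Decr m d (reverse v) → Inc m d v
Decr⇒Inc m zero          []          _        = tt
Decr⇒Inc m zero          (x ∷ [])    ()
Decr⇒Inc m zero          (x ∷ y ∷ v) dec with reverse v | subst (Decr m zero) (reverse-∷∷ y x v) dec
... | []    | ()
... | _ ∷ _ | ()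
Decr⇒Inc m (suc zero)    (x ∷ [])    (x∈ , _) = x∈
Decr⇒Inc m (suc (suc d)) (x ∷ [])    (_ , ())
Decr⇒Inc m (suc d)       (x ∷ y ∷ v) dec
  with d | Decr-snoc⁻ m d (reverse v) y x (subst (Decr m (suc d)) (reverse-∷∷ y x v) dec)
... | zero   | dec′ , _ = ⊥-elim (nonempty (reverse v) dec′)
  where
  nonempty : ∀ w → ¬ Decr m zero (w ++ y ∷ [])
  nonempty []      ()
  nonempty (_ ∷ _) ()
-- From `1 ≤ x ≤ y ∸ 1` it follows that `y` is positive, so that `y ∸ 1` really lies below `y`.
... | suc d′ | dec′ , 1≤x , x≤y-1 = (1≤x , ℕₚ.≤-<-trans x≤y-1 (y-1<y y (ℕₚ.≤-trans 1≤x x≤y-1))) ,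
  Decr⇒Inc m (suc d′) (y ∷ v) (subst (Decr m (suc d′)) (sym (Listₚ.unfold-reverse y v)) dec′)
  where
  y-1<y : ∀ y → 1 ≤ y ∸ 1 → y ∸ 1 < y
  y-1<y (suc y) _ = ℕₚ.≤-refl

Inc⇒Decr : ∀ m d v → Inc m d v → Decr m d (reverse v)
Inc⇒Decr m zero          []          _  = tt
Inc⇒Decr m (suc zero)    (x ∷ [])    x∈ = x∈ , tt
Inc⇒Decr m (suc (suc d)) (x ∷ y ∷ v) ((1≤x , x<y) , inc) =
  subst (Decr m (suc (suc d))) (sym (reverse-∷∷ y x v))
    (Decr-snoc⁺ m (suc d) (reverse v) y x
      (subst (Decr m (suc d)) (Listₚ.unfold-reverse y v) (Inc⇒Decr m (suc d) (y ∷ v) inc))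
      (1≤x , ℕₚ.∸-monoˡ-≤ 1 x<y))

coeffʳ-e : ∀ d m v → coeffʳ (e d m) v ≡ 𝟙 (Inc? m d v)
coeffʳ-e d m v = trans (coeff-e d m (reverse v))
  (𝟙-cong (Decr? m d (reverse v)) (Inc? m d v) (Decr⇒Inc m d v) (Inc⇒Decr m d v))

e-homogeneous : ∀ d m → Homogeneous d (e d m)
e-homogeneous zero    m       = refl ∷ []
e-homogeneous (suc d) zero    = []
e-homogeneous (suc d) (suc m) = Allₚ.++⁺ (e-homogeneous (suc d) m)
  (Allₚ.map⁺ (All.map (cong suc) (e-homogeneous d m)))

e-supported : ∀ {N} d m → m ≤ N → Supported N (e d m)
e-supported zero    m       m≤N = [] ∷ []
e-supported (suc d) zero    m≤N = []
e-supported (suc d) (suc m) m≤N = Allₚ.++⁺ (e-supported (suc d) m (ℕₚ.<⇒≤ m≤N))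
  (Allₚ.map⁺ (All.map ((s≤s z≤n , m≤N) ∷_) (e-supported d m (ℕₚ.<⇒≤ m≤N))))

-- The terms of the determinant J

eZ-∸ : ∀ j d m → eZ (+ (j ℕ.+ d) - + j) m ≡ e d m
eZ-∸ j d m = cong (λ z → eZ z m) (begin
  + (j ℕ.+ d) - + j     ≡⟨ ℤₚ.m-n≡m⊖n (j ℕ.+ d) j ⟩
  (j ℕ.+ d) ℤ.⊖ j       ≡⟨ ℤₚ.⊖-≥ (ℕₚ.m≤m+n j d) ⟩
  + (j ℕ.+ d ∸ j)       ≡⟨ cong +_ (ℕₚ.m+n∸m≡n j d) ⟩
  + d                   ∎)

eZ-negative : ∀ i j m → i < j → eZ (+ i - + j) m ≡ zeroP
eZ-negative i j m i<j with j ∸ i | ℕₚ.m<n⇒0<n∸m i<j | trans (ℤₚ.m-n≡m⊖n i j) (ℤₚ.⊖-< i<j)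
... | suc _ | _ | eq = cong (λ z → eZ z m) eq

eZ-supported : ∀ {N} z m → m ≤ N → Supported N (eZ z m)
eZ-supported (+ d)      m m≤N = e-supported d m m≤N
eZ-supported ℤ.-[1+ _ ] m m≤N = []

Jterm-supported : ∀ {N} i α p {n} → All (_≤ N) n → Supported N (Jterm i α p n)
Jterm-supported i []      p       n≤                = [] ∷ []
Jterm-supported i (_ ∷ _) []      n≤                = [] ∷ []
Jterm-supported i (_ ∷ _) (_ ∷ _) []                = [] ∷ []
Jterm-supported i (a ∷ α) (x ∷ p) (_∷_ {m} m≤N n≤) =
  ·-supported (eZ-supported ((+ a + + x) - + i) m m≤N) (Jterm-supported (suc i) α p n≤)

J-supported : ∀ {N} α {n} → All (_≤ N) n → Supported N (J α n)
J-supported α {n} n≤ = concatMap-supported (perms (length α))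
  λ p → scale-supported (sgn p) {Jterm 0 α p n} (Jterm-supported 0 α p n≤)

altSum : ℕ → (List ℕ → ℤ) → ℤ
altSum k Φ = ∑ (perms k) (λ p → sgn p * Φ p)

coeff-J : ∀ α n w → coeff (J α n) w ≡ altSum (length α) (λ p → coeff (Jterm 0 α p n) w)
coeff-J α n w = trans (coeff-concatMap _ (perms (length α)) w)
  (∑-cong (perms (length α)) λ p → coeff-scale (sgn p) (Jterm 0 α p n) w)

-- `Jterm` is built from the left, whereas the expansion removes the last row, whose factor stands
-- at the right end of every product.
Jterm-snoc : ∀ i α p x n {a m} → α !? length p ≡ just a → n !? length p ≡ just m →
  Jterm i α (p ++ x ∷ []) n ≡ Jterm i α p n · eZ ((+ a + + x) - + (i ℕ.+ length p)) m
Jterm-snoc i (a ∷ [])    [] x (m ∷ n) refl refl = trans (·-identityʳ _)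
  (sym (trans (·-identityˡ _) (cong (λ j → eZ ((+ a + + x) - + j) m) (ℕₚ.+-identityʳ i))))
Jterm-snoc i (a ∷ _ ∷ _) [] x (m ∷ n) refl refl = trans (·-identityʳ _)
  (sym (trans (·-identityˡ _) (cong (λ j → eZ ((+ a + + x) - + j) m) (ℕₚ.+-identityʳ i))))
Jterm-snoc i (a′ ∷ α) (y ∷ p) x (m′ ∷ n) {a} {m} α≡ n≡ = begin
  E · Jterm (suc i) α (p ++ x ∷ []) n
    ≡⟨ cong (E ·_) (Jterm-snoc (suc i) α p x n α≡ n≡) ⟩
  E · (Jterm (suc i) α p n · eZ ((+ a + + x) - + (suc i ℕ.+ length p)) m)
    ≡⟨ cong (λ j → E · (Jterm (suc i) α p n · eZ ((+ a + + x) - + j) m)) (ℕₚ.+-suc i (length p)) ⟨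
  E · (Jterm (suc i) α p n · eZ ((+ a + + x) - + (i ℕ.+ suc (length p))) m)
    ≡⟨ ·-assoc E (Jterm (suc i) α p n) _ ⟨
  (E · Jterm (suc i) α p n) · eZ ((+ a + + x) - + (i ℕ.+ suc (length p))) m ∎
  where E = eZ ((+ a′ + + y) - + i) m′

-- Alternating sums over permutations, expanded along the last column

ε : ℕ → ℤ
ε k = (- + 1) ℤ.^ k

-- The sign counts the entries behind `x`, as if `x` exceeded all of them. It depends on the
-- position alone, so `x` may be any column index.
insSum : ℕ → (List ℕ → ℤ) → List ℕ → ℤ
insSum x Φ []      = Φ (x ∷ [])
insSum x Φ (y ∷ p) = ε (suc (length p)) * Φ (x ∷ y ∷ p) + insSum x (Φ ∘ (y ∷_)) p

smaller : ℕ → List ℕ → ℕ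
smaller x p = length (filter (λ y → suc y ≤? x) p)

-- Inserting the largest entry disturbs no inversion count of the entries in front of it, so the
-- sign changes by the position of `k` alone.
smaller-insertAll : ∀ {y k} → y ≤ k → ∀ p → All (λ q → smaller y q ≡ smaller y p) (insertAll k p)
smaller-insertAll {y} {k} y≤k = go
  where
  skip : ∀ p → smaller y (k ∷ p) ≡ smaller y p
  skip p = cong length (Listₚ.filter-reject (λ z → suc z ≤? y) (ℕₚ.≤⇒≯ y≤k))
  go : ∀ p → All (λ q → smaller y q ≡ smaller y p) (insertAll k p)
  go []      = skip [] ∷ []
  go (z ∷ p) = skip (z ∷ p) ∷ Allₚ.map⁺ (All.map (λ {q} → step q) (go p))
    where
    step : ∀ q → smaller y q ≡ smaller y p → smaller y (z ∷ q) ≡ smaller y (z ∷ p)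
    step q eq with suc z ≤? y
    ... | yes z<y = trans (cong length (Listₚ.filter-accept (λ z → suc z ≤? y) {xs = q} z<y))
      (trans (cong suc eq) (sym (cong length (Listₚ.filter-accept (λ z → suc z ≤? y) {xs = p} z<y))))
    ... | no z≮y  = trans (cong length (Listₚ.filter-reject (λ z → suc z ≤? y) {xs = q} z≮y))
      (trans eq (sym (cong length (Listₚ.filter-reject (λ z → suc z ≤? y) {xs = p} z≮y))))

sgn-∷ : ∀ x p → sgn (x ∷ p) ≡ ε (smaller x p) * sgn p
sgn-∷ x p = ℤₚ.^-distribˡ-+-* (- + 1) (smaller x p) (inversions p)

-- The new largest entry forms one inversion with each entry behind it and leaves the other
-- inversions alone, so `sgn p` factors out.
∑-insertAll : ∀ {k p} Φ → All (_< k) p → ∑ (insertAll k p) (λ q → sgn q * Φ q) ≡ sgn p * insSum k Φ p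
∑-insertAll Φ [] = ℤₚ.+-identityʳ _
∑-insertAll {k} {y ∷ p} Φ (y<k ∷ p<k) = begin
  sgn (k ∷ y ∷ p) * Φ (k ∷ y ∷ p) + ∑ (map (y ∷_) (insertAll k p)) (λ q → sgn q * Φ q)
    ≡⟨ cong₂ (λ s t → s * Φ (k ∷ y ∷ p) + t) front (∑-map (y ∷_) (insertAll k p) _) ⟩
  ε (suc (length p)) * sgn (y ∷ p) * Φ (k ∷ y ∷ p)
    + ∑ (insertAll k p) (λ q → sgn (y ∷ q) * Φ (y ∷ q))
    ≡⟨ cong (_+_ (ε (suc (length p)) * sgn (y ∷ p) * Φ (k ∷ y ∷ p))) (∑-cong∈ (insertAll k p) behind) ⟩
  ε (suc (length p)) * sgn (y ∷ p) * Φ (k ∷ y ∷ p)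
    + ∑ (insertAll k p) (λ q → ε (smaller y p) * (sgn q * Φ (y ∷ q)))
    ≡⟨ cong (_+_ (ε (suc (length p)) * sgn (y ∷ p) * Φ (k ∷ y ∷ p)))
         (trans (∑-*ˡ (ε (smaller y p)) (insertAll k p) _)
                (cong (ε (smaller y p) *_) (∑-insertAll (Φ ∘ (y ∷_)) p<k))) ⟩
  ε (suc (length p)) * sgn (y ∷ p) * Φ (k ∷ y ∷ p)
    + ε (smaller y p) * (sgn p * insSum k (Φ ∘ (y ∷_)) p)
    ≡⟨ cong (_+_ (ε (suc (length p)) * sgn (y ∷ p) * Φ (k ∷ y ∷ p)))
         (trans (sym (ℤₚ.*-assoc (ε (smaller y p)) (sgn p) _))
                (cong (_* insSum k (Φ ∘ (y ∷_)) p) (sym (sgn-∷ y p)))) ⟩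
  ε (suc (length p)) * sgn (y ∷ p) * Φ (k ∷ y ∷ p) + sgn (y ∷ p) * insSum k (Φ ∘ (y ∷_)) p
    ≡⟨ factor (ε (suc (length p))) (sgn (y ∷ p)) (Φ (k ∷ y ∷ p)) _ ⟩
  sgn (y ∷ p) * insSum k Φ (y ∷ p) ∎
  where
  factor : ∀ a b c d → a * b * c + b * d ≡ b * (a * c + d)
  factor = solve-∀
  front : sgn (k ∷ y ∷ p) ≡ ε (suc (length p)) * sgn (y ∷ p)
  front = trans (sgn-∷ k (y ∷ p)) (cong (λ j → ε j * sgn (y ∷ p))
    (cong length (Listₚ.filter-all (λ z → suc z ≤? k) (y<k ∷ p<k))))
  behind : ∀ q → q ∈ insertAll k p → sgn (y ∷ q) * Φ (y ∷ q) ≡ ε (smaller y p) * (sgn q * Φ (y ∷ q))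
  behind q q∈ = trans (cong (_* Φ (y ∷ q)) (trans (sgn-∷ y q)
    (cong (λ j → ε j * sgn q) (All.lookup (smaller-insertAll (ℕₚ.<⇒≤ y<k) p) q∈))))
    (ℤₚ.*-assoc (ε (smaller y p)) (sgn q) _)

insertAll-All : ∀ {P : ℕ → Set} {x p} → P x → All P p → All (All P) (insertAll x p)
insertAll-All px []        = (px ∷ []) ∷ []
insertAll-All px (py ∷ pp) = (px ∷ py ∷ pp) ∷ Allₚ.map⁺ (All.map (py ∷_) (insertAll-All px pp))

insertAll-length : ∀ x p → All (λ q → length q ≡ suc (length p)) (insertAll x p)
insertAll-length x []      = refl ∷ []
insertAll-length x (y ∷ p) = refl ∷ Allₚ.map⁺ (All.map (cong suc) (insertAll-length x p))

IsPermOf : ℕ → List ℕ → Set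
IsPermOf k p = length p ≡ k × All (_< k) p

perms-bounded : ∀ k → All (IsPermOf k) (perms k)
perms-bounded zero    = (refl , []) ∷ []
perms-bounded (suc k) = Allₚ.concat⁺ (Allₚ.map⁺ (All.map
  (λ { {p} (refl , p<k) → All.zip (insertAll-length k p ,
         insertAll-All ℕₚ.≤-refl (All.map ℕₚ.m≤n⇒m≤1+n p<k)) })
  (perms-bounded k)))

-- The alternating sum over the arrangements of 0 , … , k − 1 , x, with x counted as the largest entry.
insAltSum : ℕ → ℕ → (List ℕ → ℤ) → ℤ
insAltSum k x Φ = ∑ (perms k) (λ p → sgn p * insSum x Φ p)

altSum-cong : ∀ k {Φ Ψ} → (∀ p → IsPermOf k p → Φ p ≡ Ψ p) → altSum k Φ ≡ altSum k Ψ
altSum-cong k eq = ∑-cong∈ (perms k) λ p p∈ → cong (sgn p *_) (eq p (All.lookup (perms-bounded k) p∈))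

-- Laplace expansion along the last column: `perms` places the largest column index `k` in every row
-- in turn.
altSum-suc : ∀ k Φ → altSum (suc k) Φ ≡ insAltSum k k Φ
altSum-suc k Φ = trans (∑-concatMap (insertAll k) (perms k) _)
  (∑-cong∈ (perms k) λ p p∈ → ∑-insertAll Φ (proj₂ (All.lookup (perms-bounded k) p∈)))

insSum-cong : ∀ x p {Φ Ψ} → (∀ q → length q ≡ suc (length p) → Φ q ≡ Ψ q) → insSum x Φ p ≡ insSum x Ψ p
insSum-cong x []      eq = eq _ refl
insSum-cong x (y ∷ p) eq = cong₂ (λ s t → ε (suc (length p)) * s + t) (eq _ refl)
  (insSum-cong x p λ q |q| → eq (y ∷ q) (cong suc |q|))

insSum-zero : ∀ x p {Φ} → (∀ q → length q ≡ suc (length p) → Φ q ≡ + 0) → insSum x Φ p ≡ + 0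
insSum-zero x []      eq = eq _ refl
insSum-zero x (y ∷ p) eq = cong₂ _+_
  (trans (cong (ε (suc (length p)) *_) (eq _ refl)) (ℤₚ.*-zeroʳ (ε (suc (length p)))))
  (insSum-zero x p λ q |q| → eq (y ∷ q) (cong suc |q|))

-- Either `x` goes behind `s`, or `s` stays last and every insertion of `x` in front of it has one
-- more inversion, whence the minus sign.
insSum-snoc : ∀ x Φ p s →
  insSum x Φ (p ++ s ∷ []) ≡ Φ (p ++ s ∷ x ∷ []) - insSum x (λ q → Φ (q ++ s ∷ [])) p
insSum-snoc x Φ [] s = flip (Φ (x ∷ s ∷ [])) (Φ (s ∷ x ∷ []))
  where
  flip : ∀ a b → - + 1 * + 1 * a + b ≡ b - a
  flip = solve-∀
insSum-snoc x Φ (y ∷ p) s = begin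
  ε (suc (length (p ++ s ∷ []))) * Φ (x ∷ y ∷ p ++ s ∷ []) + insSum x (Φ ∘ (y ∷_)) (p ++ s ∷ [])
    ≡⟨ cong₂ (λ j t → ε (suc j) * Φ (x ∷ y ∷ p ++ s ∷ []) + t)
         (trans (Listₚ.length-++ p) (ℕₚ.+-comm (length p) 1)) (insSum-snoc x (Φ ∘ (y ∷_)) p s) ⟩
  - + 1 * ε (suc (length p)) * Φ (x ∷ y ∷ p ++ s ∷ [])
    + (Φ (y ∷ p ++ s ∷ x ∷ []) - insSum x (λ q → Φ (y ∷ q ++ s ∷ [])) p)
    ≡⟨ rearrange (ε (suc (length p))) (Φ (x ∷ y ∷ p ++ s ∷ [])) (Φ (y ∷ p ++ s ∷ x ∷ [])) _ ⟩
  Φ (y ∷ p ++ s ∷ x ∷ []) - insSum x (λ q → Φ (q ++ s ∷ [])) (y ∷ p) ∎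
  where
  rearrange : ∀ a b c d → - + 1 * a * b + (c - d) ≡ c - (a * b + d)
  rearrange = solve-∀

snoc-view : ∀ (y : ℕ) p → Σ (List ℕ) λ q → Σ ℕ λ s → y ∷ p ≡ q ++ s ∷ []
snoc-view y []      = [] , y , refl
snoc-view y (z ∷ p) with snoc-view z p
... | q , s , eq = y ∷ q , s , cong (y ∷_) eq

-- Unless `k` is inserted at the end, some entry below `k` is last, and there `Ψ` vanishes.
insSum-last : ∀ k Ψ p → All (_< k) p → (∀ q s → length q ≡ length p → s < k → Ψ (q ++ s ∷ []) ≡ + 0) →
              insSum k Ψ p ≡ Ψ (p ++ k ∷ [])
insSum-last k Ψ []      _           vanish = refl
insSum-last k Ψ (y ∷ p) (y<k ∷ p<k) vanish = trans
  (cong₂ _+_ (trans (cong (ε (suc (length p)) *_) front) (ℤₚ.*-zeroʳ (ε (suc (length p)))))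
    (insSum-last k (Ψ ∘ (y ∷_)) p p<k λ q s |q| → vanish (y ∷ q) s (cong suc |q|)))
  (ℤₚ.+-identityˡ _)
  where
  front : Ψ (k ∷ y ∷ p) ≡ + 0
  front with snoc-view y p
  ... | q , s , eq with subst (All (_< k)) eq (y<k ∷ p<k)
  ...   | all with Allₚ.++⁻ʳ q all
  ...     | s<k ∷ [] = trans (cong (λ r → Ψ (k ∷ r)) eq) (vanish (k ∷ q) s |q| s<k)
    where
    |q| : suc (length q) ≡ suc (length p)
    |q| = sym (trans (cong length eq) (trans (Listₚ.length-++ q) (ℕₚ.+-comm (length q) 1)))

altSum-last : ∀ k Ψ → (∀ q s → length q ≡ k → s < k → Ψ (q ++ s ∷ []) ≡ + 0) →
              altSum (suc k) Ψ ≡ altSum k (λ p → Ψ (p ++ k ∷ []))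
altSum-last k Ψ vanish = trans (altSum-suc k Ψ) (altSum-cong k λ { p (refl , p<k) → insSum-last k Ψ p p<k vanish })

-- The minor with columns `0 , … , k , x` is expanded along its last row, where the hypothesis
-- leaves two entries. Column `x` comes with the minor of columns `0 , … , k`; column `k` comes with
-- columns `0 , … , k − 1 , x` and a minus sign, `x` counting as larger than `k`.
insAltSum-suc : ∀ k x Φ → (∀ q s → length q ≡ suc k → s < k → Φ (q ++ s ∷ []) ≡ + 0) →
  insAltSum (suc k) x Φ ≡ altSum (suc k) (λ p → Φ (p ++ x ∷ [])) - insAltSum k x (λ p → Φ (p ++ k ∷ []))
insAltSum-suc k x Φ vanish = begin
  insAltSum (suc k) x Φ
    ≡⟨ ∑-cong (perms (suc k)) (λ p → expand (sgn p) (insSum x Φ p) (Φ (p ++ x ∷ []))) ⟩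
  ∑ (perms (suc k)) (λ p → sgn p * Φ (p ++ x ∷ []) + sgn p * Ψ p)
    ≡⟨ ∑-+ (perms (suc k)) _ _ ⟩
  altSum (suc k) (λ p → Φ (p ++ x ∷ [])) + altSum (suc k) Ψ
    ≡⟨ cong (_+_ (altSum (suc k) (λ p → Φ (p ++ x ∷ [])))) (begin
      altSum (suc k) Ψ
        ≡⟨ altSum-last k Ψ (λ q s |q| s<k → trans (Ψ-snoc q s) (cong -_
             (insSum-zero x q λ r |r| → vanish r s (trans |r| (cong suc |q|)) s<k))) ⟩
      altSum k (λ p → Ψ (p ++ k ∷ []))
        ≡⟨ ∑-cong (perms k) (λ p → trans (cong (sgn p *_) (Ψ-snoc p k)) (negate (sgn p) _)) ⟩
      ∑ (perms k) (λ p → - + 1 * (sgn p * insSum x (λ q → Φ (q ++ k ∷ [])) p))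
        ≡⟨ ∑-*ˡ (- + 1) (perms k) _ ⟩
      - + 1 * insAltSum k x (λ p → Φ (p ++ k ∷ []))
        ≡⟨ ℤₚ.-1*i≡-i _ ⟩
      - insAltSum k x (λ p → Φ (p ++ k ∷ [])) ∎) ⟩
  altSum (suc k) (λ p → Φ (p ++ x ∷ [])) - insAltSum k x (λ p → Φ (p ++ k ∷ [])) ∎
  where
  -- What is left after splitting off `x` in last position. In all these arrangements the last entry
  -- of `p` remains last, so `altSum-last` applies to it.
  Ψ : List ℕ → ℤ
  Ψ p = insSum x Φ p - Φ (p ++ x ∷ [])
  expand : ∀ a b c → a * b ≡ a * c + a * (b - c)
  expand = solve-∀
  negate : ∀ a b → a * - b ≡ - + 1 * (a * b)
  negate = solve-∀
  cancel : ∀ a b → a - b - a ≡ - b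
  cancel = solve-∀
  Ψ-snoc : ∀ p s → Ψ (p ++ s ∷ []) ≡ - insSum x (λ q → Φ (q ++ s ∷ [])) p
  Ψ-snoc p s = trans
    (cong₂ _-_ (insSum-snoc x Φ p s) (cong Φ (Listₚ.++-assoc p (s ∷ []) (x ∷ []))))
    (cancel (Φ (p ++ s ∷ x ∷ [])) _)

-- The determinant of a hook shape

module Hook (a b : ℕ) (n : List ℕ) (B : ℕ → ℕ)
            (n-B : ∀ k → k ≤ b → n !? k ≡ just (B k)) (B-mono : ∀ k → k < b → B k ≤ B (suc k)) where

  α : List ℕ
  α = hook (suc a) b

  -- One less than the part of the hook in row `k`, as run lengths are counted beyond their first
  -- letter.
  lastPart : ℕ → ℕ
  lastPart zero    = a
  lastPart (suc k) = 0

  -- The reverse of a word w₁ > ⋯ > w_{a+1} < x₁ < ⋯ < x_{k-1} < y_0 > ⋯ > y_d with x_i ≤ B i and y_0 ≤ B k;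
  -- for k = 0 a strictly decreasing word of length d + 1.
  Ribbon : ℕ → ℕ → Word → Set
  Ribbon zero    d       v           = Inc (B 0) (suc d) v
  Ribbon (suc k) zero    []          = ⊥
  Ribbon (suc k) zero    (_ ∷ [])    = ⊥
  Ribbon (suc k) zero    (y ∷ x ∷ v) = (InRange (B (suc k)) y × x < y) × Ribbon k (lastPart k) (x ∷ v)
  Ribbon (suc k) (suc d) []          = ⊥
  Ribbon (suc k) (suc d) (_ ∷ [])    = ⊥
  Ribbon (suc k) (suc d) (y ∷ x ∷ v) = (1 ≤ y × y < x) × Ribbon (suc k) d (x ∷ v)

  Ribbon? : ∀ k d v → Dec (Ribbon k d v)
  Ribbon? zero    d       v           = Inc? (B 0) (suc d) v
  Ribbon? (suc k) zero    []          = no λ ()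
  Ribbon? (suc k) zero    (_ ∷ [])    = no λ ()
  Ribbon? (suc k) zero    (y ∷ x ∷ v) =
    (inRange? (B (suc k)) y ×-dec (x <? y)) ×-dec Ribbon? k (lastPart k) (x ∷ v)
  Ribbon? (suc k) (suc d) []          = no λ ()
  Ribbon? (suc k) (suc d) (_ ∷ [])    = no λ ()
  Ribbon? (suc k) (suc d) (y ∷ x ∷ v) = below? y x ×-dec Ribbon? (suc k) d (x ∷ v)

  Ribbon-head : ∀ k d {x v} → Ribbon k d (x ∷ v) → InRange (B k) x
  Ribbon-head zero    d       inc                              = Inc-head d inc
  Ribbon-head (suc k) zero    {v = _ ∷ _} ((x∈ , _) , _)        = x∈
  Ribbon-head (suc k) (suc d) {v = _ ∷ _} ((1≤x , x<y) , rib) =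
    1≤x , ℕₚ.≤-trans (ℕₚ.<⇒≤ x<y) (proj₂ (Ribbon-head (suc k) d rib))

  Ribbon?-[] : ∀ k d → 𝟙 (Ribbon? k d []) ≡ + 0
  Ribbon?-[] zero    zero    = refl
  Ribbon?-[] zero    (suc d) = refl
  Ribbon?-[] (suc k) zero    = refl
  Ribbon?-[] (suc k) (suc d) = refl

  Ribbon?-[_] : ∀ y k d → 𝟙 (Ribbon? k (suc d) (y ∷ [])) ≡ + 0
  Ribbon?-[ y ] zero    d = refl
  Ribbon?-[ y ] (suc k) d = refl

  Ribbon?-∷∷ : ∀ k d y x v →
    𝟙 (Ribbon? k (suc d) (y ∷ x ∷ v)) ≡ 𝟙 (below? y x) * 𝟙 (Ribbon? k d (x ∷ v))
  Ribbon?-∷∷ zero    d y x v = 𝟙-× (below? y x) (Ribbon? zero d (x ∷ v))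
  Ribbon?-∷∷ (suc k) d y x v = 𝟙-× (below? y x) (Ribbon? (suc k) d (x ∷ v))

  -- Gluing a decreasing run of length d + 1 to the end of a ribbon makes either an ascent or a descent.
  Ribbon-glue : ∀ k d v → k < b → Unique v →
    𝟙 (Inc? (B (suc k)) (suc d) (take (suc d) v)) * 𝟙 (Ribbon? k (lastPart k) (drop (suc d) v))
      ≡ 𝟙 (Ribbon? (suc k) d v) + 𝟙 (Ribbon? k (suc (d ℕ.+ lastPart k)) v)
  Ribbon-glue k zero [] k<b u = sym (trans (ℤₚ.+-identityˡ _) (Ribbon?-[] k _))
  Ribbon-glue k zero (y ∷ []) k<b u = trans
    (trans (cong (𝟙 (inRange? (B (suc k)) y) *_) (Ribbon?-[] k _)) (ℤₚ.*-zeroʳ (𝟙 (inRange? (B (suc k)) y))))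
    (sym (trans (ℤₚ.+-identityˡ _) (Ribbon?-[ y ] k _)))
  Ribbon-glue k zero (y ∷ x ∷ v) k<b ((y≢x ∷ _) ∷ _) = begin
    𝟙 y∈? * 𝟙 rib?
      ≡⟨ cases rib? (ℕₚ.<-cmp x y) ⟩
    𝟙 (y∈? ×-dec (x <? y)) * 𝟙 rib? + 𝟙 (below? y x) * 𝟙 rib?
      ≡⟨ cong₂ _+_ (sym (𝟙-× (y∈? ×-dec (x <? y)) rib?)) (sym (Ribbon?-∷∷ k (lastPart k) y x v)) ⟩
    𝟙 (Ribbon? (suc k) zero (y ∷ x ∷ v)) + 𝟙 (Ribbon? k (suc (lastPart k)) (y ∷ x ∷ v)) ∎
    where
    y∈?  = inRange? (B (suc k)) y
    rib? = Ribbon? k (lastPart k) (x ∷ v)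
    cases : (r : Dec (Ribbon k (lastPart k) (x ∷ v))) → _ →
            𝟙 y∈? * 𝟙 r ≡ 𝟙 (y∈? ×-dec (x <? y)) * 𝟙 r + 𝟙 (below? y x) * 𝟙 r
    cases (no _) _ = annihilate (𝟙 y∈?) (𝟙 (y∈? ×-dec (x <? y))) (𝟙 (below? y x))
      where
      annihilate : ∀ a b c → a * + 0 ≡ b * + 0 + c * + 0
      annihilate = solve-∀
    -- Neither an ascent nor a descent: here the distinctness of the letters enters.
    cases (yes rib) (tri≈ _ x≡y _) = contradiction (sym x≡y) y≢x
    cases (yes rib) (tri< x<y _ y≮x) = trans
      (cong (_* + 1) (𝟙-cong y∈? (y∈? ×-dec (x <? y)) (_, x<y) proj₁))
      (sym (trans (cong (λ z → 𝟙 (y∈? ×-dec (x <? y)) * + 1 + z * + 1) (𝟙-no (below? y x) (y≮x ∘ proj₂)))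
                  (ℤₚ.+-identityʳ _)))
    -- In a descent `y < x ≤ B k ≤ B (suc k)`, so the bound on `y` is automatic. This is where the
    -- weak increase of `n` enters.
    cases (yes rib) (tri> x≮y _ y<x) = trans
      (cong (_* + 1) (𝟙-cong y∈? (below? y x) (λ (1≤y , _) → 1≤y , y<x)
        (λ (1≤y , _) → 1≤y , ℕₚ.≤-trans (ℕₚ.<⇒≤ y<x)
          (ℕₚ.≤-trans (proj₂ (Ribbon-head k (lastPart k) rib)) (B-mono k k<b)))))
      (sym (trans (cong (λ z → z * + 1 + 𝟙 (below? y x) * + 1) (𝟙-no (y∈? ×-dec (x <? y)) (x≮y ∘ proj₂)))
                  (ℤₚ.+-identityˡ _)))
  Ribbon-glue k (suc d) [] k<b u = sym (trans (ℤₚ.+-identityˡ _) (Ribbon?-[] k _))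
  Ribbon-glue k (suc d) (y ∷ []) k<b u = sym (trans (ℤₚ.+-identityˡ _) (Ribbon?-[ y ] k _))
  Ribbon-glue k (suc d) (y ∷ x ∷ v) k<b (_ ∷ u) = begin
    𝟙 (below? y x ×-dec inc?) * 𝟙 rib?
      ≡⟨ cong (_* 𝟙 rib?) (𝟙-× (below? y x) inc?) ⟩
    𝟙 (below? y x) * 𝟙 inc? * 𝟙 rib?
      ≡⟨ ℤₚ.*-assoc (𝟙 (below? y x)) (𝟙 inc?) (𝟙 rib?) ⟩
    𝟙 (below? y x) * (𝟙 inc? * 𝟙 rib?)
      ≡⟨ cong (𝟙 (below? y x) *_) (Ribbon-glue k d (x ∷ v) k<b u) ⟩
    𝟙 (below? y x) * (𝟙 (Ribbon? (suc k) d (x ∷ v)) + 𝟙 (Ribbon? k (suc (d ℕ.+ lastPart k)) (x ∷ v)))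
      ≡⟨ ℤₚ.*-distribˡ-+ (𝟙 (below? y x)) (𝟙 (Ribbon? (suc k) d (x ∷ v))) _ ⟩
    𝟙 (below? y x) * 𝟙 (Ribbon? (suc k) d (x ∷ v))
      + 𝟙 (below? y x) * 𝟙 (Ribbon? k (suc (d ℕ.+ lastPart k)) (x ∷ v))
      ≡⟨ cong₂ _+_ (sym (Ribbon?-∷∷ (suc k) d y x v))
                   (sym (Ribbon?-∷∷ k (suc (d ℕ.+ lastPart k)) y x v)) ⟩
    𝟙 (Ribbon? (suc k) (suc d) (y ∷ x ∷ v)) + 𝟙 (Ribbon? k (suc (suc d ℕ.+ lastPart k)) (y ∷ x ∷ v)) ∎
    where
    inc? = Inc? (B (suc k)) (suc d) (x ∷ take d v)
    rib? = Ribbon? k (lastPart k) (drop (suc d) (x ∷ v))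

  Φ : Word → List ℕ → ℤ
  Φ v p = coeffʳ (Jterm 0 α p n) v

  α-suc : ∀ k → k < b → α !? suc k ≡ just 1
  α-suc = go b
    where
    go : ∀ b k → k < b → replicate b 1 !? k ≡ just 1
    go (suc b) zero    _         = refl
    go (suc b) (suc k) (s≤s k<b) = go b k k<b

  -- Row `suc k` has part 1, so column `x` has degree `x − k`: negative for `x < k`, 0 for `x = k`,
  -- and `suc d` for `x = suc k + d`. The next three lemmas are these cases; the determinant is thus
  -- Hessenberg with entries 1 directly left of the diagonal.
  Jterm-row : ∀ k p x → k < b → length p ≡ suc k →
    Jterm 0 α (p ++ x ∷ []) n ≡ Jterm 0 α p n · eZ (+ suc x - + suc k) (B (suc k))
  Jterm-row k p x k<b |p| = trans
    (Jterm-snoc 0 α p x n (trans (cong (_!?_ α) |p|) (α-suc k k<b)) (trans (cong (_!?_ n) |p|) (n-B (suc k) k<b)))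
    (cong (λ j → Jterm 0 α p n · eZ (+ suc x - + j) (B (suc k))) |p|)

  Φ-vanish : ∀ v k p s → k < b → length p ≡ suc k → s < k → Φ v (p ++ s ∷ []) ≡ + 0
  Φ-vanish v k p s k<b |p| s<k = cong (λ q → coeffʳ q v) (trans (Jterm-row k p s k<b |p|)
    (trans (cong (Jterm 0 α p n ·_) (eZ-negative (suc s) (suc k) (B (suc k)) (s≤s s<k)))
           (·-zeroʳ (Jterm 0 α p n))))

  Φ-diagonal : ∀ v k p → k < b → length p ≡ suc k → Φ v (p ++ k ∷ []) ≡ Φ v p
  Φ-diagonal v k p k<b |p| = cong (λ q → coeffʳ q v) (trans (Jterm-row k p k k<b |p|)
    (trans (cong (Jterm 0 α p n ·_) (trans (cong (λ j → eZ (+ suc j - + suc k) (B (suc k))) (sym (ℕₚ.+-identityʳ k)))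
                                           (eZ-∸ (suc k) 0 (B (suc k)))))
           (·-identityʳ (Jterm 0 α p n))))

  Φ-snoc : ∀ v k d p → k < b → length p ≡ suc k →
    Φ v (p ++ suc k ℕ.+ d ∷ []) ≡ Φ (drop (suc d) v) p * 𝟙 (Inc? (B (suc k)) (suc d) (take (suc d) v))
  Φ-snoc v k d p k<b |p| = trans
    (cong (λ q → coeffʳ q v) (trans (Jterm-row k p (suc k ℕ.+ d) k<b |p|)
      (cong (Jterm 0 α p n ·_) (trans (cong (λ j → eZ (+ j - + suc k) (B (suc k))) (sym (ℕₚ.+-suc (suc k) d)))
                                      (eZ-∸ (suc k) (suc d) (B (suc k)))))))
    (trans (coeffʳ-· (suc d) (Jterm 0 α p n) (e (suc d) (B (suc k))) v (e-homogeneous (suc d) (B (suc k))))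
           (cong (Φ (drop (suc d) v) p *_) (coeffʳ-e (suc d) (B (suc k)) (take (suc d) v))))

  -- The shift `d` of the last column stays general because the subtracted smaller minor has shift
  -- `suc d`. That minor is exactly the descent term of `Ribbon-glue`, and the ascent term remains.
  insAltSum-Φ : ∀ k d v → k ≤ b → Unique v → insAltSum k (k ℕ.+ d) (Φ v) ≡ 𝟙 (Ribbon? k (d ℕ.+ lastPart k) v)
  insAltSum-Φ zero d v k≤b u = begin
    + 1 * Φ v (d ∷ []) + + 0
      ≡⟨ trans (ℤₚ.+-identityʳ _) (ℤₚ.*-identityˡ _) ⟩
    Φ v (d ∷ [])
      ≡⟨ cong (λ p → coeffʳ p v) (trans (Jterm-snoc 0 α [] d n refl (n-B 0 z≤n)) (·-identityˡ _)) ⟩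
    coeffʳ (eZ (+ (suc a ℕ.+ d) - + 0) (B 0)) v
      ≡⟨ cong (λ p → coeffʳ p v) (eZ-∸ 0 (suc a ℕ.+ d) (B 0)) ⟩
    coeffʳ (e (suc (a ℕ.+ d)) (B 0)) v
      ≡⟨ coeffʳ-e (suc (a ℕ.+ d)) (B 0) v ⟩
    𝟙 (Inc? (B 0) (suc (a ℕ.+ d)) v)
      ≡⟨ cong (λ j → 𝟙 (Inc? (B 0) (suc j) v)) (ℕₚ.+-comm a d) ⟩
    𝟙 (Inc? (B 0) (suc (d ℕ.+ a)) v) ∎
  insAltSum-Φ (suc k) d v k<b u = begin
    insAltSum (suc k) (suc k ℕ.+ d) (Φ v)
      ≡⟨ insAltSum-suc k (suc k ℕ.+ d) (Φ v) (λ p s |p| s<k → Φ-vanish v k p s k<b |p| s<k) ⟩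
    altSum (suc k) (λ p → Φ v (p ++ suc k ℕ.+ d ∷ [])) - insAltSum k (suc k ℕ.+ d) (λ p → Φ v (p ++ k ∷ []))
      ≡⟨ cong₂ _-_ product shorter ⟩
    R₁ + R₂ - R₂
      ≡⟨ cancel R₁ R₂ ⟩
    R₁
      ≡⟨ cong (λ j → 𝟙 (Ribbon? (suc k) j v)) (ℕₚ.+-identityʳ d) ⟨
    𝟙 (Ribbon? (suc k) (d ℕ.+ 0) v) ∎
    where
    R₁ = 𝟙 (Ribbon? (suc k) d v)
    R₂ = 𝟙 (Ribbon? k (suc (d ℕ.+ lastPart k)) v)
    inc = 𝟙 (Inc? (B (suc k)) (suc d) (take (suc d) v))
    cancel : ∀ a b → a + b - b ≡ a
    cancel = solve-∀
    rotate : ∀ a b c → a * (b * c) ≡ c * (a * b)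
    rotate = solve-∀
    shorter : insAltSum k (suc k ℕ.+ d) (λ p → Φ v (p ++ k ∷ [])) ≡ R₂
    shorter = trans
      (∑-cong∈ (perms k) λ p p∈ → cong (sgn p *_) (insSum-cong (suc k ℕ.+ d) p λ q |q| →
        Φ-diagonal v k q k<b (trans |q| (cong suc (proj₁ (All.lookup (perms-bounded k) p∈))))))
      -- The column `suc k + d` is read as `k + suc d`: in the smaller minor it lies one place
      -- further to the right of the diagonal.
      (trans (cong (λ x → insAltSum k x (Φ v)) (sym (ℕₚ.+-suc k d)))
             (insAltSum-Φ k (suc d) v (ℕₚ.<⇒≤ k<b) u))
    product : altSum (suc k) (λ p → Φ v (p ++ suc k ℕ.+ d ∷ [])) ≡ R₁ + R₂
    product = begin
      altSum (suc k) (λ p → Φ v (p ++ suc k ℕ.+ d ∷ []))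
        ≡⟨ altSum-cong (suc k) (λ p (|p| , _) → Φ-snoc v k d p k<b |p|) ⟩
      altSum (suc k) (λ p → Φ (drop (suc d) v) p * inc)
        ≡⟨ ∑-cong (perms (suc k)) (λ p → rotate (sgn p) (Φ (drop (suc d) v) p) inc) ⟩
      ∑ (perms (suc k)) (λ p → inc * (sgn p * Φ (drop (suc d) v) p))
        ≡⟨ ∑-*ˡ inc (perms (suc k)) _ ⟩
      inc * altSum (suc k) (Φ (drop (suc d) v))
        ≡⟨ cong (inc *_) (trans (altSum-suc k (Φ (drop (suc d) v)))
             (trans (cong (λ x → insAltSum k x (Φ (drop (suc d) v))) (sym (ℕₚ.+-identityʳ k)))
                    (insAltSum-Φ k 0 (drop (suc d) v) (ℕₚ.<⇒≤ k<b) (Uniqueₚ.drop⁺ (suc d) u)))) ⟩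
      inc * 𝟙 (Ribbon? k (lastPart k) (drop (suc d) v))
        ≡⟨ Ribbon-glue k d v k<b u ⟩
      R₁ + R₂ ∎

  HookWord : Word → Set
  HookWord = Ribbon b (lastPart b)

  HookWord? : ∀ v → Dec (HookWord v)
  HookWord? = Ribbon? b (lastPart b)

  coeffʳ-J : ∀ v → Unique v → coeffʳ (J α n) v ≡ 𝟙 (HookWord? v)
  coeffʳ-J v u = begin
    coeff (J α n) (reverse v)
      ≡⟨ coeff-J α n (reverse v) ⟩
    altSum (suc (length (replicate b 1))) (Φ v)
      ≡⟨ cong (λ k → altSum (suc k) (Φ v)) (Listₚ.length-replicate b) ⟩
    altSum (suc b) (Φ v)
      ≡⟨ altSum-suc b (Φ v) ⟩
    insAltSum b b (Φ v)
      ≡⟨ cong (λ x → insAltSum b x (Φ v)) (ℕₚ.+-identityʳ b) ⟨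
    insAltSum b (b ℕ.+ 0) (Φ v)
      ≡⟨ insAltSum-Φ b 0 v ℕₚ.≤-refl u ⟩
    𝟙 (HookWord? v) ∎

-- Sums of reading words over an enumeration

unique-↭ : {xs ys : Word} → xs ↭ ys → Unique xs → Unique ys
unique-↭ p = Permₛ.Unique-resp-↭ (setoid ℕ) (↭⇒↭ₛ p)

unique-reverse : ∀ {v} → Unique v → Unique (reverse v)
unique-reverse {v} = unique-↭ (↭-sym (↭-reverse v))

-- At a fixed word `w` at most one tableau contributes, since the list has no duplicates and at most
-- one tableau satisfying `P` reads to `w`. The coefficient is therefore 0 or 1.
coeff-enumeration : {A : Set} {P : A → Set} {Q : Set} (f : A → Word) (w : Word) (Q? : Dec Q) →
  (Q → Σ A λ T → P T × f T ≡ w) → (∀ T → P T → f T ≡ w → Q) →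
  (∀ T T′ → P T → P T′ → f T ≡ w → f T′ ≡ w → T ≡ T′) →
  (ts : List A) → Enumerates P ts → coeff (sumWords (map f ts)) w ≡ 𝟙 Q?
coeff-enumeration f w Q? exists sound injective ts (ts! , ts-P) =
  trans (coeff-sumWords (map f ts) w) (trans (∑-map f ts _) (count Q?))
  where
  count : (d : Dec _) → ∑ ts (λ T → δ (f T) w) ≡ 𝟙 d
  count (no ¬q) = ∑-zero ts λ T T∈ →
    𝟙-no (f T ≟ᵂ w) λ fT≡w → ¬q (sound T (Equivalence.to (ts-P T) T∈) fT≡w)
  count (yes q) with exists q
  ... | T₀ , PT₀ , fT₀≡w = trans
    (∑-unique ts! (Equivalence.from (ts-P T₀) PT₀) λ T T∈ T≢T₀ → 𝟙-no (f T ≟ᵂ w) λ fT≡w →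
      T≢T₀ (injective T T₀ (Equivalence.to (ts-P T) T∈) PT₀ fT≡w fT₀≡w))
    (𝟙-yes (f T₀ ≟ᵂ w) fT₀≡w)

-- Hook tableaux: shape, entries and column reading

++-split : ∀ (u u′ : Word) {v v′} → length u ≡ length u′ → u ++ v ≡ u′ ++ v′ → u ≡ u′ × v ≡ v′
++-split []      []        _   eq = refl , eq
++-split (x ∷ u) (x′ ∷ u′) |u| eq with ++-split u u′ (ℕₚ.suc-injective |u|) (Listₚ.∷-injectiveʳ eq)
... | u≡ , v≡ = cong₂ _∷_ (Listₚ.∷-injectiveˡ eq) u≡ , v≡

-- The one-box rows below the first row of a hook, or below the first two rows of a two-column
-- shape.
singletons : List ℕ → Tableau
singletons = map [_]

singletons-shape : ∀ rows a → map length rows ≡ replicate a 1 →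
                   Σ (List ℕ) λ ys → rows ≡ singletons ys × length ys ≡ a
singletons-shape []               zero    eq = [] , refl , refl
singletons-shape (([])     ∷ rows) (suc a) ()
singletons-shape ((y ∷ []) ∷ rows) (suc a) eq with singletons-shape rows a (Listₚ.∷-injectiveʳ eq)
... | ys , refl , |ys| = y ∷ ys , refl , cong suc |ys|
singletons-shape ((_ ∷ _ ∷ _) ∷ rows) (suc a) eq with Listₚ.∷-injectiveˡ eq
... | ()

shape-singletons : ∀ ys → map length (singletons ys) ≡ replicate (length ys) 1
shape-singletons []       = refl
shape-singletons (y ∷ ys) = cong (1 ∷_) (shape-singletons ys)

at-singletons-0 : ∀ ys r → at (singletons ys) r 0 ≡ ys !? r
at-singletons-0 []       r       = refl
at-singletons-0 (y ∷ ys) zero    = refl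
at-singletons-0 (y ∷ ys) (suc r) = at-singletons-0 ys r

at-singletons-suc : ∀ ys r c → at (singletons ys) r (suc c) ≡ nothing
at-singletons-suc []       r       c = refl
at-singletons-suc (y ∷ ys) zero    c = refl
at-singletons-suc (y ∷ ys) (suc r) c = at-singletons-suc ys r c

concat-singletons : ∀ ys → concat (singletons ys) ≡ ys
concat-singletons []       = refl
concat-singletons (y ∷ ys) = cong (y ∷_) (concat-singletons ys)

column-singletons-0 : ∀ ys → column 0 (singletons ys) ≡ ys
column-singletons-0 []       = refl
column-singletons-0 (y ∷ ys) = cong (y ∷_) (column-singletons-0 ys)

column-singletons-suc : ∀ c ys → column (suc c) (singletons ys) ≡ []
column-singletons-suc c []       = refl
column-singletons-suc c (y ∷ ys) = column-singletons-suc c ys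

width-singletons : ∀ ys → width (singletons ys) ≤ 1
width-singletons []       = z≤n
width-singletons (y ∷ ys) = ℕₚ.⊔-lub ℕₚ.≤-refl (width-singletons ys)

concat-applyUpTo : ∀ (xs : List ℕ) {f : ℕ → List ℕ} → (∀ c x → xs !? c ≡ just x → f c ≡ x ∷ []) →
                   concat (applyUpTo f (length xs)) ≡ xs
concat-applyUpTo []       eq = refl
concat-applyUpTo (x ∷ xs) eq = cong₂ _++_ (eq 0 x refl) (concat-applyUpTo xs (λ c → eq (suc c)))

Column : (m a : ℕ) → List ℕ → Set
Column m a ys = length ys ≡ a × (∀ r x y → ys !? r ≡ just x → ys !? suc r ≡ just y → x < y) ×
                (∀ r x → ys !? r ≡ just x → InRange m x)

-- A column is read from bottom to top as a decreasing word, so from top to bottom it is the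
-- reversed word that `Inc` describes.
Column⇒Inc : ∀ {m} a ys → Column m (suc a) ys → Inc m (suc a) ys
Column⇒Inc zero    (y ∷ [])     (_ , _ , bound)        = bound 0 y refl
Column⇒Inc (suc a) (y ∷ x ∷ ys) (|ys| , strict , bound) =
  (proj₁ (bound 0 y refl) , strict 0 y x refl refl) ,
  Column⇒Inc a (x ∷ ys) (ℕₚ.suc-injective |ys| , strict ∘ suc , bound ∘ suc)

Inc⇒Column : ∀ {m} a ys → Inc m (suc a) ys → Column m (suc a) ys
Inc⇒Column zero (y ∷ []) y∈ = refl ,
  (λ { zero    _ _ _ () ; (suc r) _ _ () }) ,
  (λ { zero _ refl → y∈ ; (suc r) _ () })
Inc⇒Column (suc a) (y ∷ x ∷ ys) inc@((_ , y<x) , inc′) with Inc⇒Column a (x ∷ ys) inc′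
... | |ys| , strict , bound = cong suc |ys| ,
  (λ { zero _ _ refl refl → y<x ; (suc r) → strict r }) ,
  (λ { zero _ refl → Inc-head (suc a) {v = x ∷ ys} inc ; (suc r) → bound r })

Inc-All : ∀ {m} d v → Inc m d v → All (InRange m) v
Inc-All zero          []          _   = []
Inc-All (suc zero)    (y ∷ [])    y∈  = y∈ ∷ []
Inc-All (suc (suc d)) (y ∷ x ∷ v) inc = Inc-head (suc d) {v = x ∷ v} inc ∷ Inc-All (suc d) (x ∷ v) (proj₂ inc)

InRange-mono : ∀ {m N x} → m ≤ N → InRange m x → InRange N x
InRange-mono m≤N (1≤x , x≤m) = 1≤x , ℕₚ.≤-trans x≤m m≤N

-- The default 0 beyond the end of `n` makes `bound≤` hold at every index.
bound : List ℕ → ℕ → ℕ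
bound n k = fromMaybe 0 (n !? k)

!?-bound : ∀ n k → k < length n → n !? k ≡ just (bound n k)
!?-bound (m ∷ n) zero    _         = refl
!?-bound (m ∷ n) (suc k) (s≤s k<l) = !?-bound n k k<l

bound-mono : ∀ n → Linked _≤_ n → ∀ k → suc k < length n → bound n k ≤ bound n (suc k)
bound-mono (m ∷ [])     _          k       (s≤s ())
bound-mono (m ∷ m′ ∷ n) (m≤m′ ∷ _) zero    _         = m≤m′
bound-mono (m ∷ m′ ∷ n) (_ ∷ mono) (suc k) (s≤s k<l) = bound-mono (m′ ∷ n) mono k k<l

bound≤ : ∀ {N} n → All (_≤ N) n → ∀ k → bound n k ≤ N
bound≤ []      []         k       = z≤n
bound≤ (m ∷ n) (m≤N ∷ _)  zero    = m≤N
bound≤ (m ∷ n) (_ ∷ n≤N)  (suc k) = bound≤ n n≤N k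

!?⇒< : ∀ {A : Set} (xs : List A) c {x} → xs !? c ≡ just x → c < length xs
!?⇒< (x ∷ xs) zero    _  = s≤s z≤n
!?⇒< (x ∷ xs) (suc c) eq = s≤s (!?⇒< xs c eq)

!?⇒∈ : ∀ (xs : List ℕ) c {x} → xs !? c ≡ just x → x ∈ xs
!?⇒∈ (x ∷ xs) zero    refl = here refl
!?⇒∈ (x ∷ xs) (suc c) eq   = there (!?⇒∈ xs c eq)

hookTableau : ℕ → List ℕ → List ℕ → Tableau
hookTableau t xs ys = (t ∷ xs) ∷ singletons ys

hook-shape : ∀ T a b → map length T ≡ suc b ∷ replicate a 1 →
  Σ ℕ λ t → Σ (List ℕ) λ xs → Σ (List ℕ) λ ys → T ≡ hookTableau t xs ys × length xs ≡ b × length ys ≡ a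
hook-shape ([] ∷ rows) a b eq with Listₚ.∷-injectiveˡ eq
... | ()
hook-shape ((t ∷ xs) ∷ rows) a b eq with singletons-shape rows a (Listₚ.∷-injectiveʳ eq)
... | ys , refl , |ys| = t , xs , ys , refl , ℕₚ.suc-injective (Listₚ.∷-injectiveˡ eq) , |ys|

-- Every column after the first has a single box, so these columns spell the rest of the first row.
creading-hook : ∀ t xs ys → creading (hookTableau t xs ys) ≡ reverse (t ∷ ys) ++ xs
creading-hook t xs ys = begin
  concat (map (λ c → reverse (column c T)) (upTo (width T)))
    ≡⟨ cong (λ k → concat (map (λ c → reverse (column c T)) (upTo k)))
         (ℕₚ.m≥n⇒m⊔n≡m (ℕₚ.≤-trans (width-singletons ys) (s≤s z≤n))) ⟩
  reverse (t ∷ column 0 (singletons ys)) ++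
    concat (map (λ c → reverse (column c T)) (applyUpTo suc (length xs)))
    ≡⟨ cong₂ (λ c₀ cs → reverse (t ∷ c₀) ++ concat cs) (column-singletons-0 ys)
         (Listₚ.map-applyUpTo suc (λ c → reverse (column c T)) (length xs)) ⟩
  reverse (t ∷ ys) ++ concat (applyUpTo (λ c → reverse (column (suc c) T)) (length xs))
    ≡⟨ cong (reverse (t ∷ ys) ++_) (concat-applyUpTo xs later) ⟩
  reverse (t ∷ ys) ++ xs ∎
  where
  T = hookTableau t xs ys
  later : ∀ c x → xs !? c ≡ just x → reverse (column (suc c) T) ≡ x ∷ []
  later c x eq rewrite eq | column-singletons-suc c ys = refl

filter-ones : ∀ b j → filter (λ x → suc (suc j) ≤? x) (replicate b 1) ≡ []
filter-ones zero    j = refl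
filter-ones (suc b) j = filter-ones b j

length-filter-positive : ∀ b → length (filter (λ x → 1 ≤? x) (replicate b 1)) ≡ b
length-filter-positive zero    = refl
length-filter-positive (suc b) = cong suc (length-filter-positive b)

applyUpTo-const : ∀ k (f : ℕ → ℕ) {x} → (∀ j → j < k → f j ≡ x) → applyUpTo f k ≡ replicate k x
applyUpTo-const zero    f eq = refl
applyUpTo-const (suc k) f eq =
  cong₂ _∷_ (eq 0 (s≤s z≤n)) (applyUpTo-const k (f ∘ suc) λ j j<k → eq (suc j) (s≤s j<k))

-- Arm and leg are exchanged: the first row of a tableau has one box for each factor of `J`, and the
-- bounds `n` go column by column.
conj-hook : ∀ a b → conj (hook (suc a) b) ≡ hook (suc b) a
conj-hook a b = cong₂ _∷_ (cong suc (length-filter-positive b)) (trans (Listₚ.map-applyUpTo suc _ a)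
  (applyUpTo-const a _ λ j j<a → cong length (trans
    (Listₚ.filter-accept (λ x → suc (suc j) ≤? x) (s≤s j<a)) (cong (suc a ∷_) (filter-ones b j)))))

-- Hook words are the column readings of hook tableaux

module HookTableaux (a b : ℕ) (n : List ℕ) (mono : Linked _≤_ n) (|n| : length n ≡ suc b) where

  B : ℕ → ℕ
  B = bound n

  n-B : ∀ k → k ≤ b → n !? k ≡ just (B k)
  n-B k k≤b = !?-bound n k (subst (suc k ≤_) (sym |n|) (s≤s k≤b))

  open Hook a b n B n-B (λ k k<b → bound-mono n mono k (subst (suc (suc k) ≤_) (sym |n|) (s≤s k<b))) public

  -- Here `x₀` is the entry of the first row in column `k`, whence the bound `B (suc k)` for its
  -- right neighbour.
  RowFrom : ℕ → ℕ → List ℕ → Set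
  RowFrom k x₀ []       = ⊤
  RowFrom k x₀ (x ∷ xs) = (InRange (B (suc k)) x × x₀ < x) × RowFrom (suc k) x xs

  -- In the reversed word each further entry of the row is put in front, as a new run of length 1,
  -- so the row extends the ribbon by one order per entry.
  ribbon-append : ∀ k j x₀ xs v → length xs ℕ.+ k ≡ j → RowFrom k x₀ xs →
    Ribbon k (lastPart k) (x₀ ∷ v) → Ribbon j (lastPart j) (xs ʳ++ (x₀ ∷ v))
  ribbon-append k j x₀ []       v refl _            rib = rib
  ribbon-append k j x₀ (x ∷ xs) v refl (x∈ , row) rib =
    ribbon-append (suc k) j x xs (x₀ ∷ v) (ℕₚ.+-suc (length xs) k) row (x∈ , rib)

  -- Undoes `ribbon-append`: since `lastPart (suc k)` is 0, letters pass one by one to the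
  -- accumulator `xs₀` until order 0, where the decreasing run is left as the column.
  ribbon-split : ∀ k x₀ v xs₀ → Ribbon k (lastPart k) (x₀ ∷ v) → RowFrom k x₀ xs₀ →
    Σ ℕ λ t → Σ (List ℕ) λ xs → Σ (List ℕ) λ ys →
      xs ʳ++ (t ∷ ys) ≡ xs₀ ʳ++ (x₀ ∷ v) × length xs ≡ k ℕ.+ length xs₀ ×
      RowFrom 0 t xs × Inc (B 0) (suc a) (t ∷ ys)
  ribbon-split zero    x₀ v       xs₀ rib        row = x₀ , xs₀ , v , refl , refl , row , rib
  ribbon-split (suc k) x₀ (x ∷ v) xs₀ (x∈ , rib) row with ribbon-split k x v (x₀ ∷ xs₀) rib (x∈ , row)
  ... | t , xs , ys , eq , |xs| , ok = t , xs , ys , eq , trans |xs| (ℕₚ.+-suc k (length xs₀)) , ok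

  Hooked : ℕ → List ℕ → List ℕ → Set
  Hooked t xs ys = length xs ≡ b × RowFrom 0 t xs × Inc (B 0) (suc a) (t ∷ ys)

  word : ℕ → List ℕ → List ℕ → Word
  word t xs ys = reverse (t ∷ ys) ++ xs

  reverse-word : ∀ t xs ys → reverse (word t xs ys) ≡ xs ʳ++ (t ∷ ys)
  reverse-word t xs ys = trans (Listₚ.reverse-++ (reverse (t ∷ ys)) xs)
    (trans (cong (reverse xs ++_) (Listₚ.reverse-involutive (t ∷ ys))) (sym (Listₚ.ʳ++-defn xs)))

  hooked⇒hookWord : ∀ t xs ys → Hooked t xs ys → HookWord (reverse (word t xs ys))
  hooked⇒hookWord t xs ys (refl , row , inc) = subst HookWord (sym (reverse-word t xs ys))
    (ribbon-append 0 b t xs ys (ℕₚ.+-identityʳ b) row inc)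

  hookWord⇒hooked : ∀ w → HookWord (reverse w) →
    Σ ℕ λ t → Σ (List ℕ) λ xs → Σ (List ℕ) λ ys → word t xs ys ≡ w × Hooked t xs ys
  hookWord⇒hooked w h with reverse w in eq
  ... | [] = contradiction (trans (sym (Ribbon?-[] b (lastPart b))) (𝟙-yes (Ribbon? b (lastPart b) []) h)) λ ()
  ... | x₀ ∷ v with ribbon-split b x₀ v [] h tt
  ...   | t , xs , ys , eq′ , |xs| , ok = t , xs , ys ,
    trans (sym (Listₚ.reverse-involutive (word t xs ys)))
      (trans (cong reverse (trans (reverse-word t xs ys) (trans eq′ (sym eq)))) (Listₚ.reverse-involutive w)) ,
    trans |xs| (ℕₚ.+-identityʳ b) , ok

  -- Rows of `SYT` increase weakly; the absence of repeated entries makes them strict.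
  row⁺ : ∀ k x₀ xs ys → Unique ((x₀ ∷ xs) ++ ys) →
    (∀ c x y → (x₀ ∷ xs) !? c ≡ just x → xs !? c ≡ just y → x ≤ y) →
    (∀ c x → xs !? c ≡ just x → InRange (B (suc k ℕ.+ c)) x) → RowFrom k x₀ xs
  row⁺ k x₀ []       ys u weak bd = tt
  row⁺ k x₀ (x ∷ xs) ys ((x₀≢x ∷ _) ∷ u) weak bd =
    (subst (λ j → InRange (B j) x) (ℕₚ.+-identityʳ (suc k)) (bd 0 x refl) ,
     ℕₚ.≤∧≢⇒< (weak 0 x₀ x refl refl) x₀≢x) ,
    row⁺ (suc k) x xs ys u (weak ∘ suc)
      λ c y eq → subst (λ j → InRange (B j) y) (ℕₚ.+-suc (suc k) c) (bd (suc c) y eq)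

  row⁻ : ∀ k x₀ xs → RowFrom k x₀ xs →
    (∀ c x y → (x₀ ∷ xs) !? c ≡ just x → xs !? c ≡ just y → x < y) ×
    (∀ c x → xs !? c ≡ just x → InRange (B (suc k ℕ.+ c)) x)
  row⁻ k x₀ []       _ = (λ { zero _ _ _ () ; (suc c) _ _ () }) , λ _ _ ()
  row⁻ k x₀ (x ∷ xs) ((x∈ , x₀<x) , row) with row⁻ (suc k) x xs row
  ... | strict , bd =
    (λ { zero _ _ refl refl → x₀<x ; (suc c) → strict c }) ,
    λ { zero    _ refl → subst (λ j → InRange (B j) x) (sym (ℕₚ.+-identityʳ (suc k))) x∈
      ; (suc c) y eq   → subst (λ j → InRange (B j) y) (sym (ℕₚ.+-suc (suc k) c)) (bd c y eq) }

  Hook-SYT : Tableau → Set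
  Hook-SYT = SYT (hook (suc b) a) n

  within : ∀ {c x} → (Σ ℕ λ m → (n !? c ≡ just m) × (1 ≤ x × x ≤ m)) → InRange (B c) x
  within {c} {x} (m , eq , 1≤x , x≤m) = 1≤x , subst (x ≤_) (sym (cong (fromMaybe 0) eq)) x≤m

  SYT⇒hooked : ∀ t xs ys → length xs ≡ b → length ys ≡ a → Hook-SYT (hookTableau t xs ys) → Hooked t xs ys
  SYT⇒hooked t xs ys |xs| |ys| T = |xs| ,
    row⁺ 0 t xs ys (subst (λ z → Unique ((t ∷ xs) ++ z)) (concat-singletons ys) T.noRepeat)
      (T.rowsWeak 0) (λ c x eq → within (T.colBound 0 (suc c) x eq)) ,
    Column⇒Inc a (t ∷ ys) (cong suc |ys| ,
      (λ { zero    x y eq eq′ → T.colsStr 0 0 x y eq (trans (at-singletons-0 ys 0) eq′)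
         ; (suc r) x y eq eq′ → T.colsStr (suc r) 0 x y (trans (at-singletons-0 ys r) eq)
                                                       (trans (at-singletons-0 ys (suc r)) eq′) }) ,
      λ { zero    x eq → within (T.colBound 0 0 x eq)
        ; (suc r) x eq → within (T.colBound (suc r) 0 x (trans (at-singletons-0 ys r) eq)) })
    where module T = SYT T

  -- `Hooked` does not forbid a common entry of arm and leg; the distinct letters of the word do.
  hooked⇒SYT : ∀ t xs ys → Unique (word t xs ys) → Hooked t xs ys → Hook-SYT (hookTableau t xs ys)
  hooked⇒SYT t xs ys u (refl , row , inc)
    with row⁻ 0 t xs row | Inc⇒Column a (t ∷ ys) inc
  ... | strict , bd | refl , increasing , bd′ = record
    { shape    = cong (suc b ∷_) (shape-singletons ys)
    ; rowsWeak = λ { zero    c x y eq eq′ → ℕₚ.<⇒≤ (strict c x y eq eq′)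
                   ; (suc r) c x y eq eq′ → contradiction (trans (sym eq′) (at-singletons-suc ys r c)) λ () }
    ; colsStr  = λ { zero    zero x y eq eq′ → increasing 0 x y eq (trans (sym (at-singletons-0 ys 0)) eq′)
                   ; (suc r) zero x y eq eq′ → increasing (suc r) x y (trans (sym (at-singletons-0 ys r)) eq)
                                                 (trans (sym (at-singletons-0 ys (suc r))) eq′)
                   ; r (suc c) x y eq eq′ → contradiction (trans (sym eq′) (at-singletons-suc ys r c)) λ () }
    ; noRepeat = subst (λ z → Unique ((t ∷ xs) ++ z)) (sym (concat-singletons ys)) (unique-↭ rearrange u)
    ; colBound = λ { zero    zero    x eq → B 0 , n-B 0 z≤n , bd′ 0 x eq
                   ; zero    (suc c) x eq → B (suc c) , n-B (suc c) (!?⇒< xs c eq) , bd c x eq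
                   ; (suc r) zero    x eq → B 0 , n-B 0 z≤n ,
                                              bd′ (suc r) x (trans (sym (at-singletons-0 ys r)) eq)
                   ; (suc r) (suc c) x eq → contradiction (trans (sym eq) (at-singletons-suc ys r c)) λ () }
    }
    where
    rearrange : word t xs ys ↭ t ∷ xs ++ ys
    rearrange = ↭-trans (++⁺ʳ xs (↭-reverse (t ∷ ys))) (_↭_.prep t (++-comm ys xs))

  coeff-hookTableaux : ∀ (ts : List Tableau) → Enumerates Hook-SYT ts → ∀ w → Unique w →
    coeff (sumWords (map creading ts)) w ≡ 𝟙 (HookWord? (reverse w))
  coeff-hookTableaux ts enum w u = coeff-enumeration creading w (HookWord? (reverse w)) exists sound injective ts enum
    where
    exists : HookWord (reverse w) → Σ Tableau λ T → Hook-SYT T × creading T ≡ w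
    exists h with hookWord⇒hooked w h
    ... | t , xs , ys , eq , ok = hookTableau t xs ys ,
      hooked⇒SYT t xs ys (subst Unique (sym eq) u) ok , trans (creading-hook t xs ys) eq
    sound : ∀ T → Hook-SYT T → creading T ≡ w → HookWord (reverse w)
    sound T syt refl with hook-shape T a b (SYT.shape syt)
    ... | t , xs , ys , refl , |xs| , |ys| = subst (HookWord ∘ reverse) (sym (creading-hook t xs ys))
      (hooked⇒hookWord t xs ys (SYT⇒hooked t xs ys |xs| |ys| syt))
    injective : ∀ T T′ → Hook-SYT T → Hook-SYT T′ → creading T ≡ w → creading T′ ≡ w → T ≡ T′
    injective T T′ syt syt′ eq eq′ with hook-shape T a b (SYT.shape syt) | hook-shape T′ a b (SYT.shape syt′)
    ... | t , xs , ys , refl , |xs| , |ys| | t′ , xs′ , ys′ , refl , |xs′| , |ys′|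
      -- The shape gives both columns length `suc a`, so the word determines where the column ends.
      with ++-split (reverse (t ∷ ys)) (reverse (t′ ∷ ys′))
             (trans (Listₚ.length-reverse (t ∷ ys)) (trans (cong suc (trans |ys| (sym |ys′|)))
                    (sym (Listₚ.length-reverse (t′ ∷ ys′)))))
             (trans (sym (creading-hook t xs ys)) (trans eq (trans (sym eq′) (creading-hook t′ xs′ ys′))))
    ...   | tys≡ , refl with Listₚ.reverse-injective {x = t ∷ ys} {y = t′ ∷ ys′} tys≡
    ...     | refl = refl

  ribbon-All : ∀ {N} → All (_≤ N) n → ∀ k d v → Ribbon k d v → All (InRange N) v
  ribbon-All n≤N zero d v inc = All.map (InRange-mono (bound≤ n n≤N 0)) (Inc-All (suc d) v inc)
  ribbon-All n≤N (suc k) zero (y ∷ x ∷ v) ((y∈ , _) , rib) =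
    InRange-mono (bound≤ n n≤N (suc k)) y∈ ∷ ribbon-All n≤N k (lastPart k) (x ∷ v) rib
  ribbon-All n≤N (suc k) (suc d) (y ∷ x ∷ v) rib@(_ , rib′) =
    InRange-mono (bound≤ n n≤N (suc k)) (Ribbon-head (suc k) (suc d) {v = x ∷ v} rib) ∷ ribbon-All n≤N (suc k) d (x ∷ v) rib′

  creading-supported : ∀ {N} → All (_≤ N) n → (ts : List Tableau) → Enumerates Hook-SYT ts →
                       Supported N (sumWords (map creading ts))
  creading-supported n≤N ts (_ , ts-P) = Allₚ.map⁺ (Allₚ.map⁺ (All.tabulate λ {T} T∈ →
    inRange T (Equivalence.to (ts-P T) T∈)))
    where
    inRange : ∀ T → Hook-SYT T → All (InRange _) (creading T)
    inRange T syt with hook-shape T a b (SYT.shape syt)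
    ... | t , xs , ys , refl , |xs| , |ys| = subst (All _) (sym (creading-hook t xs ys))
      (All-resp-↭ (↭-reverse (word t xs ys)) (ribbon-All n≤N b (lastPart b) _
        (hooked⇒hookWord t xs ys (SYT⇒hooked t xs ys |xs| |ys| syt))))

  coeff-J-hook : ∀ w → Unique w → coeff (J (hook (suc a) b) n) w ≡ 𝟙 (HookWord? (reverse w))
  coeff-J-hook w u = trans (cong (coeff (J (hook (suc a) b) n)) (sym (Listₚ.reverse-involutive w)))
    (coeffʳ-J (reverse w) (unique-reverse u))

hook-cong : ∀ N n → Linked _≤_ n → All (_≤ N) n → ∀ a b → length n ≡ suc b → (ts : List Tableau) →
  Enumerates (SYT (hook (suc b) a) n) ts → Cong N (J (hook (suc a) b) n) (sumWords (map creading ts))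
hook-cong N n mono n≤N a b |n| ts enum = cong-on-unique
  -- At words with distinct letters the two sides agree exactly, so repeated words account for the
  -- whole difference.
  (J-supported (hook (suc a) b) n≤N) (creading-supported n≤N ts enum) []
  λ w u → trans (ℤₚ.+-identityʳ _) (trans (coeff-J-hook w u) (sym (coeff-hookTableaux ts enum w u)))
  where open HookTableaux a b n mono |n|

hook-positive : ∀ N n → Linked _≤_ n → All (_≤ N) n → ∀ a b → length n ≡ suc b →
  PositiveSum N (J (hook (suc a) b) n)
hook-positive N n mono n≤N a b |n| = positive-on-unique
  (J-supported (hook (suc a) b) n≤N) [] (HookWord? ∘ reverse)
  λ w u → trans (ℤₚ.+-identityʳ _) (coeff-J-hook w u)
  where open HookTableaux a b n mono |n|

-- The identity on the last four letters for shape (a,2)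

Chain : ℕ → ℕ → ℕ → ℕ → Set
Chain m x y z = (1 ≤ x × x < y) × (y < z × z ≤ m)

Chain? : ∀ m x y z → Dec (Chain m x y z)
Chain? m x y z = below? x y ×-dec ((y <? z) ×-dec (z ≤? m))

-- A third distinct letter falls below, between or above `x < y`. This turns products of indicators
-- into sums of chains, the form in which the generators contribute.
chain-insert : ∀ m x y z → z ≢ x → z ≢ y →
  𝟙 (below? x y ×-dec inRange? m y) * 𝟙 (inRange? m z) ≡
  𝟙 (Chain? m z x y) + 𝟙 (Chain? m x z y) + 𝟙 (Chain? m x y z)
chain-insert m x y z z≢x z≢y with below? x y ×-dec inRange? m y
... | no ¬xy = sym (cong₂ _+_ (cong₂ _+_
    (𝟙-no (Chain? m z x y) λ ((1≤z , z<x) , x<y , y≤m) → refute (ℕₚ.≤-trans 1≤z (ℕₚ.<⇒≤ z<x)) x<y y≤m)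
    (𝟙-no (Chain? m x z y) λ ((1≤x , x<z) , z<y , y≤m) → refute 1≤x (ℕₚ.<-trans x<z z<y) y≤m))
    (𝟙-no (Chain? m x y z) λ ((1≤x , x<y) , y<z , z≤m) → refute 1≤x x<y (ℕₚ.≤-trans (ℕₚ.<⇒≤ y<z) z≤m)))
  where
  refute : 1 ≤ x → x < y → y ≤ m → ⊥
  refute 1≤x x<y y≤m = ¬xy ((1≤x , x<y) , ℕₚ.≤-trans 1≤x (ℕₚ.<⇒≤ x<y) , y≤m)
... | yes ((1≤x , x<y) , _ , y≤m) = trans (ℤₚ.*-identityˡ _) (cases (ℕₚ.<-cmp z x) (ℕₚ.<-cmp z y))
  where
  zxy? = Chain? m z x y
  xzy? = Chain? m x z y
  xyz? = Chain? m x y z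
  cases : _ → _ → 𝟙 (inRange? m z) ≡ 𝟙 zxy? + 𝟙 xzy? + 𝟙 xyz?
  cases (tri≈ _ z≡x _) _ = contradiction z≡x z≢x
  cases _ (tri≈ _ z≡y _) = contradiction z≡y z≢y
  cases (tri< z<x _ x≮z) _ = trans
    (𝟙-cong (inRange? m z) zxy? (λ (1≤z , _) → (1≤z , z<x) , x<y , y≤m)
      (λ ((1≤z , _) , _) → 1≤z , ℕₚ.<⇒≤ (ℕₚ.<-≤-trans (ℕₚ.<-trans z<x x<y) y≤m)))
    (sym (trans (cong₂ (λ s t → 𝟙 zxy? + s + t) (𝟙-no xzy? λ ((_ , x<z) , _) → x≮z x<z)
                  (𝟙-no xyz? λ (_ , y<z , _) → x≮z (ℕₚ.<-trans x<y y<z)))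
                (trans (ℤₚ.+-identityʳ _) (ℤₚ.+-identityʳ _))))
  cases (tri> z≮x _ x<z) (tri< z<y _ y≮z) = trans
    (𝟙-cong (inRange? m z) xzy? (λ _ → (1≤x , x<z) , z<y , y≤m)
      (λ _ → ℕₚ.≤-trans 1≤x (ℕₚ.<⇒≤ x<z) , ℕₚ.<⇒≤ (ℕₚ.<-≤-trans z<y y≤m)))
    (sym (trans (cong₂ (λ s t → s + 𝟙 xzy? + t) (𝟙-no zxy? λ ((_ , z<x) , _) → z≮x z<x)
                  (𝟙-no xyz? λ (_ , y<z , _) → y≮z y<z))
                (trans (ℤₚ.+-identityʳ _) (ℤₚ.+-identityˡ _))))
  cases (tri> z≮x _ x<z) (tri> z≮y _ y<z) = trans
    (𝟙-cong (inRange? m z) xyz? (λ (_ , z≤m) → (1≤x , x<y) , y<z , z≤m)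
      (λ (_ , _ , z≤m) → ℕₚ.≤-trans 1≤x (ℕₚ.<⇒≤ x<z) , z≤m))
    (sym (trans (cong₂ (λ s t → s + t + 𝟙 xyz?) (𝟙-no zxy? λ ((_ , z<x) , _) → z≮x z<x)
                  (𝟙-no xzy? λ (_ , z<y , _) → z≮y z<y))
                (ℤₚ.+-identityˡ _)))

-- `genPoly` requires the inequalities to be proved first. Here the same list is formed for any
-- triple, so that coefficients can be summed before the order of the letters is known.
krPoly : ℕ × ℕ × ℕ → Poly
krPoly (a , b , c) =
  (+ 1 , b ∷ a ∷ c ∷ []) ∷ (- + 1 , b ∷ c ∷ a ∷ []) ∷
  (- + 1 , a ∷ c ∷ b ∷ []) ∷ (+ 1 , c ∷ a ∷ b ∷ []) ∷ []

krPoly-homogeneous : ∀ t → Homogeneous 3 (krPoly t)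
krPoly-homogeneous t = refl ∷ refl ∷ refl ∷ refl ∷ []

coeff-krPoly : ∀ a b c w → coeff (krPoly (a , b , c)) w ≡
  δ (b ∷ a ∷ c ∷ []) w - δ (b ∷ c ∷ a ∷ []) w - δ (a ∷ c ∷ b ∷ []) w + δ (c ∷ a ∷ b ∷ []) w
coeff-krPoly a b c w = trans (coeff-∑ (krPoly (a , b , c)) w)
  (signs (δ (b ∷ a ∷ c ∷ []) w) (δ (b ∷ c ∷ a ∷ []) w) (δ (a ∷ c ∷ b ∷ []) w) (δ (c ∷ a ∷ b ∷ []) w))
  where
  signs : ∀ p q r s → + 1 * p + (- + 1 * q + (- + 1 * r + (+ 1 * s + + 0))) ≡ p - q - r + s
  signs = solve-∀

-- Applied to the reverse of `u`, so that the head is the last letter of `u`.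
Above : ℕ → Word → Set
Above b []      = ⊥
Above b (z ∷ _) = b < z

Above? : ∀ b v → Dec (Above b v)
Above? b []      = no λ ()
Above? b (z ∷ _) = b <? z

-- x₄ x₃ x₂ x₁ is T₂₁ T₁₁ T₂₂ T₁₂ in TopFour₁ (column reading) and T₂₁ T₂₂ T₁₁ T₁₂ in TopFour₂ (row reading).
TopFour₁ : ℕ → ℕ → ℕ → ℕ → ℕ → Set
TopFour₁ m x₁ x₂ x₃ x₄ = (1 ≤ x₃ × x₃ < x₄) × (x₄ < x₁ × (x₁ < x₂ × x₂ ≤ m))

TopFour₂ : ℕ → ℕ → ℕ → ℕ → ℕ → Set
TopFour₂ m x₁ x₂ x₃ x₄ = (1 ≤ x₂ × x₂ < x₁) × (x₁ < x₄ × (x₄ < x₃ × x₃ ≤ m))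

topFour₁? : ∀ m x₁ x₂ x₃ x₄ → Dec (TopFour₁ m x₁ x₂ x₃ x₄)
topFour₁? m x₁ x₂ x₃ x₄ = below? x₃ x₄ ×-dec ((x₄ <? x₁) ×-dec ((x₁ <? x₂) ×-dec (x₂ ≤? m)))

topFour₂? : ∀ m x₁ x₂ x₃ x₄ → Dec (TopFour₂ m x₁ x₂ x₃ x₄)
topFour₂? m x₁ x₂ x₃ x₄ = below? x₂ x₁ ×-dec ((x₁ <? x₄) ×-dec ((x₄ <? x₃) ×-dec (x₃ ≤? m)))

krWeight : ℕ → ℕ → ℕ → ℕ → ℕ → ℤ
krWeight m x₄ a b c = 𝟙 (Chain? m a b c ×-dec (b <? x₄))

-- The letters x₃ x₂ x₁ end the word and are preceded by x₄. Inserting x₃ into x₁ < x₂, resp. x₁ into x₂ < x₃,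
-- expands both products of elementary functions into chains.
four-letters : ∀ m x₁ x₂ x₃ x₄ → x₁ ≢ x₂ → x₁ ≢ x₃ → x₁ ≢ x₄ → x₂ ≢ x₃ → x₃ ≢ x₄ → x₄ ≤ m →
  𝟙 (below? x₃ x₄) * 𝟙 (below? x₁ x₂ ×-dec inRange? m x₂)
    - 𝟙 (below? x₂ x₃) * 𝟙 (below? x₃ x₄) * 𝟙 (inRange? m x₁)
    + (krWeight m x₄ x₂ x₃ x₁ - krWeight m x₄ x₁ x₃ x₂ - krWeight m x₄ x₃ x₁ x₂ + krWeight m x₄ x₂ x₁ x₃)
  ≡ 𝟙 (topFour₁? m x₁ x₂ x₃ x₄) + 𝟙 (topFour₂? m x₁ x₂ x₃ x₄)
four-letters m x₁ x₂ x₃ x₄ x₁≢x₂ x₁≢x₃ x₁≢x₄ x₂≢x₃ x₃≢x₄ x₄≤m = cases (ℕₚ.<-cmp x₃ x₄)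
  where
  bx₃x₄ = below? x₃ x₄
  x₁x₂ = below? x₁ x₂ ×-dec inRange? m x₂
  bx₂x₃ = below? x₂ x₃
  T₁ = topFour₁? m x₁ x₂ x₃ x₄
  T₂ = topFour₂? m x₁ x₂ x₃ x₄
  K = krWeight m x₄
  c = Chain? m
  cases : _ → 𝟙 bx₃x₄ * 𝟙 x₁x₂ - 𝟙 bx₂x₃ * 𝟙 bx₃x₄ * 𝟙 (inRange? m x₁)
                + (K x₂ x₃ x₁ - K x₁ x₃ x₂ - K x₃ x₁ x₂ + K x₂ x₁ x₃) ≡ 𝟙 T₁ + 𝟙 T₂
  cases (tri≈ _ x₃≡x₄ _) = contradiction x₃≡x₄ x₃≢x₄
  -- The determinant contributes nothing. A middle letter below `x₄` forces `x₃`, which lies above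
  -- `x₄`, to be the largest of the three, so just the word z x y remains.
  cases (tri> x₃≮x₄ _ x₄<x₃) = trans
    (cong₂ _+_
      (cong₂ (λ p q → p * 𝟙 x₁x₂ - 𝟙 bx₂x₃ * q * 𝟙 (inRange? m x₁))
        (𝟙-no bx₃x₄ (x₃≮x₄ ∘ proj₂)) (𝟙-no bx₃x₄ (x₃≮x₄ ∘ proj₂)))
      (cong₂ _+_ (cong₂ _-_ (cong₂ _-_
        (𝟙-no (c x₂ x₃ x₁ ×-dec (x₃ <? x₄)) (x₃≮x₄ ∘ proj₂))
        (𝟙-no (c x₁ x₃ x₂ ×-dec (x₃ <? x₄)) (x₃≮x₄ ∘ proj₂)))
        (𝟙-no (c x₃ x₁ x₂ ×-dec (x₁ <? x₄)) λ (((_ , x₃<x₁) , _) , x₁<x₄) → x₃≮x₄ (ℕₚ.<-trans x₃<x₁ x₁<x₄)))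
        (𝟙-cong (c x₂ x₁ x₃ ×-dec (x₁ <? x₄)) T₂
          (λ ((bel , _ , x₃≤m) , x₁<x₄) → bel , x₁<x₄ , x₄<x₃ , x₃≤m)
          (λ (bel , x₁<x₄ , _ , x₃≤m) → (bel , ℕₚ.<-trans x₁<x₄ x₄<x₃ , x₃≤m) , x₁<x₄))))
    (trans (annihilate (𝟙 x₁x₂) (𝟙 bx₂x₃) (𝟙 (inRange? m x₁)) (𝟙 T₂))
      (cong (_+ 𝟙 T₂) (sym (𝟙-no T₁ (x₃≮x₄ ∘ proj₂ ∘ proj₁)))))
    where
    annihilate : ∀ a b d t → + 0 * a - b * + 0 * d + (+ 0 - + 0 - + 0 + t) ≡ + 0 + t
    annihilate = solve-∀
  -- From `x₃ < x₄ ≤ m` the upper bound on `x₃` is automatic. The middle letter is below `x₄` in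
  -- every chain but `x₃ < x₁ < x₂`; the other chains cancel, and this one survives when `x₁`
  -- exceeds `x₄`.
  cases (tri< x₃<x₄ _ x₄≮x₃) = begin
    𝟙 bx₃x₄ * 𝟙 x₁x₂ - 𝟙 bx₂x₃ * 𝟙 bx₃x₄ * 𝟙 (inRange? m x₁)
      + (K x₂ x₃ x₁ - K x₁ x₃ x₂ - K x₃ x₁ x₂ + K x₂ x₁ x₃)
      ≡⟨ cong₂ _+_ (cong₂ _-_ insert₃ insert₁)
           (cong₂ (λ p q → p - K x₃ x₁ x₂ + q)
             (cong₂ _-_ (forget x₂ x₁) (forget x₁ x₂))
             (𝟙-cong (c x₂ x₁ x₃ ×-dec (x₁ <? x₄)) (c x₂ x₁ x₃) proj₁
               λ ch@(_ , x₁<x₃ , _) → ch , ℕₚ.<-trans x₁<x₃ x₃<x₄)) ⟩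
    𝟙 (c x₃ x₁ x₂) + 𝟙 (c x₁ x₃ x₂) + 𝟙 (c x₁ x₂ x₃) - (𝟙 (c x₁ x₂ x₃) + 𝟙 (c x₂ x₁ x₃) + 𝟙 (c x₂ x₃ x₁))
      + (𝟙 (c x₂ x₃ x₁) - 𝟙 (c x₁ x₃ x₂) - K x₃ x₁ x₂ + 𝟙 (c x₂ x₁ x₃))
      ≡⟨ telescope (𝟙 (c x₃ x₁ x₂)) (𝟙 (c x₁ x₃ x₂)) (𝟙 (c x₁ x₂ x₃)) (𝟙 (c x₂ x₁ x₃)) (𝟙 (c x₂ x₃ x₁))
                   (K x₃ x₁ x₂) ⟩
    𝟙 (c x₃ x₁ x₂) - K x₃ x₁ x₂
      ≡⟨ compare (ℕₚ.<-cmp x₁ x₄) ⟩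
    𝟙 T₁
      ≡⟨ ℤₚ.+-identityʳ _ ⟨
    𝟙 T₁ + + 0
      ≡⟨ cong (_+_ (𝟙 T₁)) (𝟙-no T₂ λ (_ , _ , x₄<x₃ , _) → x₄≮x₃ x₄<x₃) ⟨
    𝟙 T₁ + 𝟙 T₂ ∎
    where
    x₃≤m = ℕₚ.≤-trans (ℕₚ.<⇒≤ x₃<x₄) x₄≤m
    telescope : ∀ p q r s t k → p + q + r - (r + s + t) + (t - q - k + s) ≡ p - k
    telescope = solve-∀
    insert₃ : 𝟙 bx₃x₄ * 𝟙 x₁x₂ ≡ 𝟙 (c x₃ x₁ x₂) + 𝟙 (c x₁ x₃ x₂) + 𝟙 (c x₁ x₂ x₃)
    insert₃ = trans (ℤₚ.*-comm (𝟙 bx₃x₄) (𝟙 x₁x₂)) (trans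
      (cong (𝟙 x₁x₂ *_) (𝟙-cong bx₃x₄ (inRange? m x₃) (λ (1≤x₃ , _) → 1≤x₃ , x₃≤m) (λ (1≤x₃ , _) → 1≤x₃ , x₃<x₄)))
      (chain-insert m x₁ x₂ x₃ (x₁≢x₃ ∘ sym) (x₂≢x₃ ∘ sym)))
    insert₁ : 𝟙 bx₂x₃ * 𝟙 bx₃x₄ * 𝟙 (inRange? m x₁) ≡ 𝟙 (c x₁ x₂ x₃) + 𝟙 (c x₂ x₁ x₃) + 𝟙 (c x₂ x₃ x₁)
    insert₁ = trans
      (cong (_* 𝟙 (inRange? m x₁)) (trans (sym (𝟙-× bx₂x₃ bx₃x₄))
        (𝟙-cong (bx₂x₃ ×-dec bx₃x₄) (bx₂x₃ ×-dec inRange? m x₃)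
          (λ (bel , 1≤x₃ , _) → bel , 1≤x₃ , x₃≤m) (λ (bel , 1≤x₃ , _) → bel , 1≤x₃ , x₃<x₄))))
      (chain-insert m x₂ x₃ x₁ x₁≢x₂ x₁≢x₃)
    forget : ∀ x y → 𝟙 (c x x₃ y ×-dec (x₃ <? x₄)) ≡ 𝟙 (c x x₃ y)
    forget x y = 𝟙-cong (c x x₃ y ×-dec (x₃ <? x₄)) (c x x₃ y) proj₁ (_, x₃<x₄)
    compare : _ → 𝟙 (c x₃ x₁ x₂) - K x₃ x₁ x₂ ≡ 𝟙 T₁
    compare (tri≈ _ x₁≡x₄ _) = contradiction x₁≡x₄ x₁≢x₄
    compare (tri< x₁<x₄ _ x₄≮x₁) = trans
      (cong (λ z → 𝟙 (c x₃ x₁ x₂) - z) (𝟙-cong (c x₃ x₁ x₂ ×-dec (x₁ <? x₄)) (c x₃ x₁ x₂) proj₁ (_, x₁<x₄)))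
      (trans (ℤₚ.+-inverseʳ (𝟙 (c x₃ x₁ x₂))) (sym (𝟙-no T₁ λ (_ , x₄<x₁ , _) → x₄≮x₁ x₄<x₁)))
    compare (tri> x₁≮x₄ _ x₄<x₁) = trans
      (cong (λ z → 𝟙 (c x₃ x₁ x₂) - z) (𝟙-no (c x₃ x₁ x₂ ×-dec (x₁ <? x₄)) (x₁≮x₄ ∘ proj₂)))
      (trans (ℤₚ.+-identityʳ _) (𝟙-cong (c x₃ x₁ x₂) T₁
        (λ ((1≤x₃ , _) , x₁<x₂ , x₂≤m) → (1≤x₃ , x₃<x₄) , x₄<x₁ , x₁<x₂ , x₂≤m)
        (λ ((1≤x₃ , _) , _ , x₁<x₂ , x₂≤m) → (1≤x₃ , ℕₚ.<-trans x₃<x₄ x₄<x₁) , x₁<x₂ , x₂≤m)))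

-- Two-column tableaux and their two readings

twoTableau : ℕ → ℕ → ℕ → ℕ → List ℕ → Tableau
twoTableau t p z q ys = (t ∷ p ∷ []) ∷ (z ∷ q ∷ []) ∷ singletons ys

two-shape : ∀ T s → map length T ≡ 2 ∷ 2 ∷ replicate s 1 →
  Σ ℕ λ t → Σ ℕ λ p → Σ ℕ λ z → Σ ℕ λ q → Σ (List ℕ) λ ys → T ≡ twoTableau t p z q ys × length ys ≡ s
two-shape ((t ∷ p ∷ []) ∷ (z ∷ q ∷ []) ∷ rows) s eq
  with singletons-shape rows s (Listₚ.∷-injectiveʳ (Listₚ.∷-injectiveʳ eq))
... | ys , refl , |ys| = t , p , z , q , ys , refl , |ys|
two-shape (row ∷ [])                          s eq with Listₚ.∷-injectiveʳ eq
... | ()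
two-shape ([] ∷ _ ∷ _)                        s eq with Listₚ.∷-injectiveˡ eq
... | ()
two-shape ((_ ∷ []) ∷ _ ∷ _)                  s eq with Listₚ.∷-injectiveˡ eq
... | ()
two-shape ((_ ∷ _ ∷ _ ∷ _) ∷ _ ∷ _)           s eq with Listₚ.∷-injectiveˡ eq
... | ()
two-shape ((_ ∷ _ ∷ []) ∷ [] ∷ _)             s eq with Listₚ.∷-injectiveˡ (Listₚ.∷-injectiveʳ eq)
... | ()
two-shape ((_ ∷ _ ∷ []) ∷ (_ ∷ []) ∷ _)       s eq with Listₚ.∷-injectiveˡ (Listₚ.∷-injectiveʳ eq)
... | ()
two-shape ((_ ∷ _ ∷ []) ∷ (_ ∷ _ ∷ _ ∷ _) ∷ _) s eq with Listₚ.∷-injectiveˡ (Listₚ.∷-injectiveʳ eq)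
... | ()

creading-two : ∀ t p z q ys → creading (twoTableau t p z q ys) ≡ reverse (p ∷ q ∷ t ∷ z ∷ ys)
creading-two t p z q ys = begin
  concat (map (λ c → reverse (column c T)) (upTo (width T)))
    ≡⟨ cong (λ k → concat (map (λ c → reverse (column c T)) (upTo k)))
         (trans (cong (2 ℕ.⊔_) (ℕₚ.m≥n⇒m⊔n≡m (ℕₚ.≤-trans (width-singletons ys) (s≤s z≤n)))) refl) ⟩
  reverse (t ∷ z ∷ column 0 (singletons ys)) ++ reverse (p ∷ q ∷ column 1 (singletons ys)) ++ []
    ≡⟨ cong₂ (λ c₀ c₁ → reverse (t ∷ z ∷ c₀) ++ reverse (p ∷ q ∷ c₁) ++ [])
         (column-singletons-0 ys) (column-singletons-suc 0 ys) ⟩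
  reverse (t ∷ z ∷ ys) ++ reverse (p ∷ q ∷ [])
    ≡⟨ Listₚ.reverse-++ (p ∷ q ∷ []) (t ∷ z ∷ ys) ⟨
  reverse (p ∷ q ∷ t ∷ z ∷ ys) ∎
  where T = twoTableau t p z q ys

-- The two readings differ by the exchange of `t` and `q`: below the second row both go up the
-- single boxes.
reading-two : ∀ t p z q ys → reading (twoTableau t p z q ys) ≡ reverse (p ∷ t ∷ q ∷ z ∷ ys)
reading-two t p z q ys = begin
  concat (reverse (twoTableau t p z q ys))
    ≡⟨ cong concat (Listₚ.reverse-++ ((t ∷ p ∷ []) ∷ (z ∷ q ∷ []) ∷ []) (singletons ys)) ⟩
  concat (reverse (singletons ys) ++ (z ∷ q ∷ []) ∷ (t ∷ p ∷ []) ∷ [])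
    ≡⟨ Listₚ.concat-++ (reverse (singletons ys)) ((z ∷ q ∷ []) ∷ (t ∷ p ∷ []) ∷ []) ⟨
  concat (reverse (singletons ys)) ++ z ∷ q ∷ t ∷ p ∷ []
    ≡⟨ cong (_++ z ∷ q ∷ t ∷ p ∷ []) (trans (cong concat (sym (Listₚ.reverse-map [_] ys)))
                                            (concat-singletons (reverse ys))) ⟩
  reverse ys ++ z ∷ q ∷ t ∷ p ∷ []
    ≡⟨ Listₚ.reverse-++ (p ∷ t ∷ q ∷ z ∷ []) ys ⟨
  reverse (p ∷ t ∷ q ∷ z ∷ ys) ∎

conj-two : ∀ s → conj (suc (suc s) ∷ 2 ∷ []) ≡ 2 ∷ 2 ∷ replicate s 1
conj-two s = cong (λ l → 2 ∷ 2 ∷ l) (trans (Listₚ.map-applyUpTo (suc ∘ suc) _ s)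
  (applyUpTo-const s _ λ j j<s → cong length
    (Listₚ.filter-accept (λ x → suc (suc (suc j)) ≤? x) {xs = 2 ∷ []} (s≤s (s≤s j<s)))))

-- `frakJ` conjugates its argument, so starting from the conjugate of `(a , 2)` it returns to `J` of
-- `(a , 2)` itself.
conj-conj-two : ∀ s → conj (2 ∷ 2 ∷ replicate s 1) ≡ suc (suc s) ∷ 2 ∷ []
conj-conj-two s = cong₂ (λ j k → suc (suc j) ∷ suc (suc k) ∷ []) (length-filter-positive s) (cong length (filter-ones s 0))

-- The determinant of shape (a,2), with a = s + 2

module TwoColumns (N s n₁ n₂ : ℕ) (n₁≤n₂ : n₁ ≤ n₂) (n₂≤N : n₂ ≤ N) where

  n : List ℕ
  n = n₁ ∷ n₂ ∷ []

  n≤N : All (_≤ N) n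
  n≤N = ℕₚ.≤-trans n₁≤n₂ n₂≤N ∷ n₂≤N ∷ []

  -- An `IdealTerm` wants a proof that `u` lies in the alphabet. It is decided along with the order
  -- conditions and is true for every word of `e (suc s) n₁`.
  KRCond : Word → ℕ × ℕ × ℕ → Set
  KRCond u (a , b , c) = Chain n₂ a b c × (Above b (reverse u) × All (InRange N) u)

  KRCond? : ∀ u t → Dec (KRCond u t)
  KRCond? u (a , b , c) = Chain? n₂ a b c ×-dec (Above? b (reverse u) ×-dec All.all? (inRange? N) u)

  krTerm : ℤ × Word → ℕ × ℕ × ℕ → List (IdealTerm N)
  krTerm (k , u) t@(a , b , c) with KRCond? u t
  ... | no _ = []
  ... | yes (((1≤a , a<b) , b<c , c≤n₂) , _ , u∈) =
    -- Negative because the congruence subtracts the ideal sum, whereas these corrections are to be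
    -- added to `J`.
    iterm (- k) u u∈ (kr a b c 1≤a a<b b<c (ℕₚ.≤-trans c≤n₂ n₂≤N)) [] [] ∷ []

  -- `upTo (suc n₂)` contains n₂ and also 0; triples with the letter 0 or in the wrong order are
  -- rejected by `Chain?`.
  triples : List (ℕ × ℕ × ℕ)
  triples = cartesianProduct (upTo (suc n₂)) (cartesianProduct (upTo (suc n₂)) (upTo (suc n₂)))

  triples! : Unique triples
  triples! = Uniqueₚ.cartesianProduct⁺ up! (Uniqueₚ.cartesianProduct⁺ up! up!)
    where up! = Uniqueₚ.upTo⁺ (suc n₂)

  krTerms : List (IdealTerm N)
  krTerms = concatMap (λ ku → concatMap (krTerm ku) triples) (e (suc s) n₁)

  coeff-krTerm : ∀ ku t v → ∑ (krTerm ku t) (λ τ → coeff (termPoly τ) (reverse v)) ≡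
    proj₁ ku * δ (proj₂ ku) (reverse (drop 3 v)) *
    (- + 1 * (𝟙 (KRCond? (proj₂ ku) t) * coeffʳ (krPoly t) (take 3 v)))
  coeff-krTerm (k , u) t@(a , b , c) v with KRCond? u t
  ... | no _ = sym (ℤₚ.*-zeroʳ (k * δ u (reverse (drop 3 v))))
  ... | yes (((1≤a , a<b) , b<c , c≤n₂) , _ , u∈) = begin
    coeff (termPoly (iterm (- k) u u∈ (kr a b c 1≤a a<b b<c (ℕₚ.≤-trans c≤n₂ n₂≤N)) [] [])) (reverse v) + + 0
      ≡⟨ ℤₚ.+-identityʳ _ ⟩
    coeff (termPoly (iterm (- k) u u∈ (kr a b c 1≤a a<b b<c (ℕₚ.≤-trans c≤n₂ n₂≤N)) [] [])) (reverse v)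
      ≡⟨ coeff-iterm (- k) u u∈ (kr a b c 1≤a a<b b<c (ℕₚ.≤-trans c≤n₂ n₂≤N)) [] [] (reverse v) ⟩
    - k * coeffʳ (((+ 1 , u) ∷ []) · (krPoly t · oneP)) v
      ≡⟨ cong (λ p → - k * coeffʳ (((+ 1 , u) ∷ []) · p) v) (·-identityʳ (krPoly t)) ⟩
    - k * coeffʳ (((+ 1 , u) ∷ []) · krPoly t) v
      ≡⟨ cong (- k *_) (coeffʳ-· 3 ((+ 1 , u) ∷ []) (krPoly t) v (krPoly-homogeneous t)) ⟩
    - k * (coeffʳ ((+ 1 , u) ∷ []) (drop 3 v) * coeffʳ (krPoly t) (take 3 v))
      ≡⟨ cong (λ z → - k * (z * coeffʳ (krPoly t) (take 3 v))) (coeff-single (+ 1) u (reverse (drop 3 v))) ⟩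
    - k * (+ 1 * δ u (reverse (drop 3 v)) * coeffʳ (krPoly t) (take 3 v))
      ≡⟨ rearrange k (δ u (reverse (drop 3 v))) (coeffʳ (krPoly t) (take 3 v)) ⟩
    k * δ u (reverse (drop 3 v)) * (- + 1 * (+ 1 * coeffʳ (krPoly t) (take 3 v))) ∎
    where
    rearrange : ∀ k x y → - k * (+ 1 * x * y) ≡ k * x * (- + 1 * (+ 1 * y))
    rearrange = solve-∀

  krSum : Word → Word → ℤ
  krSum u v = ∑ triples (λ t → 𝟙 (KRCond? u t) * coeffʳ (krPoly t) (take 3 v))

  -- A generator takes exactly the last three letters, so `u` must be the rest of the word. The
  -- delta replaces `u` by this fixed word inside `krSum`, and what remains of the outer sum is a
  -- coefficient of `e (suc s) n₁`.
  coeff-krTerms : ∀ v → coeff (idealSum krTerms) (reverse v) ≡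
    𝟙 (Inc? n₁ (suc s) (drop 3 v)) * (- + 1 * krSum (reverse (drop 3 v)) v)
  coeff-krTerms v = begin
    coeff (idealSum krTerms) (reverse v)
      ≡⟨ coeff-concatMap termPoly krTerms (reverse v) ⟩
    ∑ krTerms (λ τ → coeff (termPoly τ) (reverse v))
      ≡⟨ ∑-concatMap _ (e (suc s) n₁) _ ⟩
    ∑ (e (suc s) n₁) (λ ku → ∑ (concatMap (krTerm ku) triples) (λ τ → coeff (termPoly τ) (reverse v)))
      ≡⟨ ∑-cong (e (suc s) n₁) (λ ku → trans (∑-concatMap (krTerm ku) triples _)
           (∑-cong triples (λ t → coeff-krTerm ku t v))) ⟩
    ∑ (e (suc s) n₁) (λ ku → ∑ triples (λ t → proj₁ ku * δ (proj₂ ku) u₀ *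
      (- + 1 * (𝟙 (KRCond? (proj₂ ku) t) * coeffʳ (krPoly t) (take 3 v)))))
      ≡⟨ ∑-cong (e (suc s) n₁) (λ ku → trans (∑-*ˡ (proj₁ ku * δ (proj₂ ku) u₀) triples _)
           (cong (proj₁ ku * δ (proj₂ ku) u₀ *_) (∑-*ˡ (- + 1) triples
             (λ t → 𝟙 (KRCond? (proj₂ ku) t) * coeffʳ (krPoly t) (take 3 v))))) ⟩
    ∑ (e (suc s) n₁) (λ ku → proj₁ ku * δ (proj₂ ku) u₀ * (- + 1 * krSum (proj₂ ku) v))
      ≡⟨ ∑-cong (e (suc s) n₁) (λ ku → localise (proj₁ ku) (proj₂ ku)) ⟩
    ∑ (e (suc s) n₁) (λ ku → (- + 1 * krSum u₀ v) * (proj₁ ku * δ (proj₂ ku) u₀))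
      ≡⟨ ∑-*ˡ (- + 1 * krSum u₀ v) (e (suc s) n₁) _ ⟩
    (- + 1 * krSum u₀ v) * ∑ (e (suc s) n₁) (λ ku → proj₁ ku * δ (proj₂ ku) u₀)
      ≡⟨ cong ((- + 1 * krSum u₀ v) *_) (trans (sym (coeff-∑ (e (suc s) n₁) u₀)) (coeffʳ-e (suc s) n₁ (drop 3 v))) ⟩
    (- + 1 * krSum u₀ v) * 𝟙 (Inc? n₁ (suc s) (drop 3 v))
      ≡⟨ ℤₚ.*-comm (- + 1 * krSum u₀ v) _ ⟩
    𝟙 (Inc? n₁ (suc s) (drop 3 v)) * (- + 1 * krSum u₀ v) ∎
    where
    u₀ = reverse (drop 3 v)
    localise : ∀ k u → k * δ u u₀ * (- + 1 * krSum u v) ≡ (- + 1 * krSum u₀ v) * (k * δ u u₀)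
    localise k u with u ≟ᵂ u₀
    ... | yes refl = ℤₚ.*-comm (k * + 1) _
    ... | no _     = trans (cong (_* (- + 1 * krSum u v)) (ℤₚ.*-zeroʳ k))
      (sym (trans (cong ((- + 1 * krSum u₀ v) *_) (ℤₚ.*-zeroʳ k)) (ℤₚ.*-zeroʳ (- + 1 * krSum u₀ v))))

  -- `f` writes the letters of a triple in a fixed order, so three given letters come from one
  -- triple `t₀`. If `t₀` meets the condition it is in the list; if not, both sides are 0.
  triple-sum : ∀ u (f : ℕ × ℕ × ℕ → Word) t₀ → (∀ t → f t ≡ f t₀ → t ≡ t₀) →
    ∑ triples (λ t → 𝟙 (KRCond? u t) * δ (f t) (f t₀)) ≡ 𝟙 (KRCond? u t₀)
  triple-sum u f t₀@(a , b , c) injective with KRCond? u t₀ in eq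
  ... | yes (((1≤a , a<b) , b<c , c≤n₂) , _) = trans
    (∑-unique triples! t₀∈ λ t _ t≢t₀ → trans
      (cong (𝟙 (KRCond? u t) *_) (𝟙-no (f t ≟ᵂ f t₀) (t≢t₀ ∘ injective t))) (ℤₚ.*-zeroʳ (𝟙 (KRCond? u t))))
    (cong₂ _*_ (cong 𝟙 eq) (δ-refl (f t₀)))
    where
    b≤n₂ = ℕₚ.≤-trans (ℕₚ.<⇒≤ b<c) c≤n₂
    a≤n₂ = ℕₚ.≤-trans (ℕₚ.<⇒≤ a<b) b≤n₂
    t₀∈ : t₀ ∈ triples
    t₀∈ = ∈-cartesianProduct⁺ (∈-upTo⁺ (s≤s a≤n₂))
            (∈-cartesianProduct⁺ (∈-upTo⁺ (s≤s b≤n₂)) (∈-upTo⁺ (s≤s c≤n₂)))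
  ... | no ¬cond = ∑-zero triples λ t _ → zero-at t
    where
    zero-at : ∀ t → 𝟙 (KRCond? u t) * δ (f t) (f t₀) ≡ + 0
    zero-at t with f t ≟ᵂ f t₀
    ... | no _ = ℤₚ.*-zeroʳ (𝟙 (KRCond? u t))
    ... | yes ft≡ with injective t ft≡
    ...   | refl = trans (ℤₚ.*-identityʳ _) (cong 𝟙 eq)

  -- Matching x₃ x₂ x₁ with b a c, b c a, a c b and c a b in turn determines the four triples.
  krSum-letters : ∀ u x₁ x₂ x₃ v → krSum u (x₁ ∷ x₂ ∷ x₃ ∷ v) ≡
    𝟙 (KRCond? u (x₂ , x₃ , x₁)) - 𝟙 (KRCond? u (x₁ , x₃ , x₂))
      - 𝟙 (KRCond? u (x₃ , x₁ , x₂)) + 𝟙 (KRCond? u (x₂ , x₁ , x₃))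
  krSum-letters u x₁ x₂ x₃ v = begin
    krSum u (x₁ ∷ x₂ ∷ x₃ ∷ v)
      ≡⟨ ∑-cong triples (λ t@(a , b , c) → trans (cong (𝟙 (KRCond? u t) *_) (coeff-krPoly a b c w))
           (expand (𝟙 (KRCond? u t)) (δ (bac t) w) (δ (bca t) w) (δ (acb t) w) (δ (cab t) w))) ⟩
    ∑ triples (λ t → g bac t + (- + 1 * g bca t + (- + 1 * g acb t + g cab t)))
      ≡⟨ trans (∑-+ triples (g bac) (λ t → - + 1 * g bca t + (- + 1 * g acb t + g cab t))) (cong (_+_ (∑ triples (g bac)))
           (trans (∑-+ triples (λ t → - + 1 * g bca t) (λ t → - + 1 * g acb t + g cab t)) (cong₂ _+_ (∑-*ˡ (- + 1) triples (g bca))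
             (trans (∑-+ triples (λ t → - + 1 * g acb t) (g cab))
               (cong (_+ ∑ triples (g cab)) (∑-*ˡ (- + 1) triples (g acb))))))) ⟩
    ∑ triples (g bac) + (- + 1 * ∑ triples (g bca) + (- + 1 * ∑ triples (g acb) + ∑ triples (g cab)))
      ≡⟨ cong₂ _+_ (triple-sum u bac (x₂ , x₃ , x₁) λ { _ refl → refl })
           (cong₂ _+_ (cong (- + 1 *_) (triple-sum u bca (x₁ , x₃ , x₂) λ { _ refl → refl }))
             (cong₂ _+_ (cong (- + 1 *_) (triple-sum u acb (x₃ , x₁ , x₂) λ { _ refl → refl }))
               (triple-sum u cab (x₂ , x₁ , x₃) λ { _ refl → refl }))) ⟩
    𝟙 (KRCond? u (x₂ , x₃ , x₁)) + (- + 1 * 𝟙 (KRCond? u (x₁ , x₃ , x₂))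
      + (- + 1 * 𝟙 (KRCond? u (x₃ , x₁ , x₂)) + 𝟙 (KRCond? u (x₂ , x₁ , x₃))))
      ≡⟨ collect (𝟙 (KRCond? u (x₂ , x₃ , x₁))) (𝟙 (KRCond? u (x₁ , x₃ , x₂)))
                 (𝟙 (KRCond? u (x₃ , x₁ , x₂))) (𝟙 (KRCond? u (x₂ , x₁ , x₃))) ⟩
    𝟙 (KRCond? u (x₂ , x₃ , x₁)) - 𝟙 (KRCond? u (x₁ , x₃ , x₂))
      - 𝟙 (KRCond? u (x₃ , x₁ , x₂)) + 𝟙 (KRCond? u (x₂ , x₁ , x₃)) ∎
    where
    w = x₃ ∷ x₂ ∷ x₁ ∷ []
    bac bca acb cab : ℕ × ℕ × ℕ → Word
    bac (a , b , c) = b ∷ a ∷ c ∷ []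
    bca (a , b , c) = b ∷ c ∷ a ∷ []
    acb (a , b , c) = a ∷ c ∷ b ∷ []
    cab (a , b , c) = c ∷ a ∷ b ∷ []
    g : (ℕ × ℕ × ℕ → Word) → ℕ × ℕ × ℕ → ℤ
    g f t = 𝟙 (KRCond? u t) * δ (f t) w
    expand : ∀ k p q r s → k * (p - q - r + s) ≡ k * p + (- + 1 * (k * q) + (- + 1 * (k * r) + k * s))
    expand = solve-∀
    collect : ∀ p q r s → p + (- + 1 * q + (- + 1 * r + s)) ≡ p - q - r + s
    collect = solve-∀

  α : List ℕ
  α = suc (suc s) ∷ 2 ∷ []

  TwoWord₁ : Word → Set
  TwoWord₁ (x₁ ∷ x₂ ∷ x₃ ∷ x₄ ∷ r) = TopFour₁ n₂ x₁ x₂ x₃ x₄ × Inc n₁ (suc s) (x₄ ∷ r)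
  TwoWord₁ _                       = ⊥

  TwoWord₂ : Word → Set
  TwoWord₂ (x₁ ∷ x₂ ∷ x₃ ∷ x₄ ∷ r) = TopFour₂ n₂ x₁ x₂ x₃ x₄ × Inc n₁ (suc s) (x₄ ∷ r)
  TwoWord₂ _                       = ⊥

  twoWord₁? : ∀ v → Dec (TwoWord₁ v)
  twoWord₁? (x₁ ∷ x₂ ∷ x₃ ∷ x₄ ∷ r) = topFour₁? n₂ x₁ x₂ x₃ x₄ ×-dec Inc? n₁ (suc s) (x₄ ∷ r)
  twoWord₁? []                      = no λ ()
  twoWord₁? (_ ∷ [])                = no λ ()
  twoWord₁? (_ ∷ _ ∷ [])            = no λ ()
  twoWord₁? (_ ∷ _ ∷ _ ∷ [])        = no λ ()

  twoWord₂? : ∀ v → Dec (TwoWord₂ v)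
  twoWord₂? (x₁ ∷ x₂ ∷ x₃ ∷ x₄ ∷ r) = topFour₂? n₂ x₁ x₂ x₃ x₄ ×-dec Inc? n₁ (suc s) (x₄ ∷ r)
  twoWord₂? []                      = no λ ()
  twoWord₂? (_ ∷ [])                = no λ ()
  twoWord₂? (_ ∷ _ ∷ [])            = no λ ()
  twoWord₂? (_ ∷ _ ∷ _ ∷ [])        = no λ ()

  coeffʳ-J : ∀ v → coeffʳ (J α n) v ≡
    𝟙 (Inc? n₁ (suc (suc s)) (drop 2 v)) * 𝟙 (Inc? n₂ 2 (take 2 v))
      - 𝟙 (Inc? n₁ (suc (suc (suc s))) (drop 1 v)) * 𝟙 (Inc? n₂ 1 (take 1 v))
  coeffʳ-J v = begin
    coeff (J α n) (reverse v)
      ≡⟨ coeff-J α n (reverse v) ⟩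
    -- `perms 2` lists the transposition first.
    - + 1 * coeffʳ (Jterm 0 α (1 ∷ 0 ∷ []) n) v + (+ 1 * coeffʳ (Jterm 0 α (0 ∷ 1 ∷ []) n) v + + 0)
      ≡⟨ cong₂ (λ x y → - + 1 * x + (+ 1 * y + + 0)) (product 1 1) (product 0 2) ⟩
    - + 1 * (𝟙 (Inc? n₁ (suc (suc s) ℕ.+ 1) (drop 1 v)) * 𝟙 (Inc? n₂ 1 (take 1 v)))
      + (+ 1 * (𝟙 (Inc? n₁ (suc (suc s) ℕ.+ 0) (drop 2 v)) * 𝟙 (Inc? n₂ 2 (take 2 v))) + + 0)
      ≡⟨ cong₂ (λ j k → - + 1 * (𝟙 (Inc? n₁ j (drop 1 v)) * 𝟙 (Inc? n₂ 1 (take 1 v)))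
                        + (+ 1 * (𝟙 (Inc? n₁ k (drop 2 v)) * 𝟙 (Inc? n₂ 2 (take 2 v))) + + 0))
           (ℕₚ.+-comm (suc (suc s)) 1) (ℕₚ.+-identityʳ (suc (suc s))) ⟩
    - + 1 * (𝟙 (Inc? n₁ (suc (suc (suc s))) (drop 1 v)) * 𝟙 (Inc? n₂ 1 (take 1 v)))
      + (+ 1 * (𝟙 (Inc? n₁ (suc (suc s)) (drop 2 v)) * 𝟙 (Inc? n₂ 2 (take 2 v))) + + 0)
      ≡⟨ collect (𝟙 (Inc? n₁ (suc (suc (suc s))) (drop 1 v)) * 𝟙 (Inc? n₂ 1 (take 1 v)))
                 (𝟙 (Inc? n₁ (suc (suc s)) (drop 2 v)) * 𝟙 (Inc? n₂ 2 (take 2 v))) ⟩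
    𝟙 (Inc? n₁ (suc (suc s)) (drop 2 v)) * 𝟙 (Inc? n₂ 2 (take 2 v))
      - 𝟙 (Inc? n₁ (suc (suc (suc s))) (drop 1 v)) * 𝟙 (Inc? n₂ 1 (take 1 v)) ∎
    where
    collect : ∀ x y → - + 1 * x + (+ 1 * y + + 0) ≡ y - x
    collect = solve-∀
    product : ∀ x d → coeffʳ (eZ ((+ suc (suc s) + + x) - + 0) n₁ · (e d n₂ · oneP)) v ≡
      𝟙 (Inc? n₁ (suc (suc s) ℕ.+ x) (drop d v)) * 𝟙 (Inc? n₂ d (take d v))
    product x d = trans
      (cong (λ p → coeffʳ p v) (cong₂ _·_ (eZ-∸ 0 (suc (suc s) ℕ.+ x) n₁) (·-identityʳ (e d n₂))))
      (trans (coeffʳ-· d (e (suc (suc s) ℕ.+ x) n₁) (e d n₂) v (e-homogeneous d n₂))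
        (cong₂ _*_ (coeffʳ-e (suc (suc s) ℕ.+ x) n₁ (drop d v)) (coeffʳ-e d n₂ (take d v))))

  -- Both products and the corrections contain the factor saying that the word up to x₄ is
  -- decreasing. Taking it out leaves `four-letters`, with `x₄ ≤ n₁ ≤ n₂` supplied by that factor.
  coeffʳ-J-krTerms : ∀ v → Unique v →
    coeffʳ (J α n) v - coeff (idealSum krTerms) (reverse v) ≡ 𝟙 (twoWord₁? v) + 𝟙 (twoWord₂? v)
  coeffʳ-J-krTerms v u = trans (cong₂ _-_ (coeffʳ-J v) (coeff-krTerms v)) (go v u)
    where
    Inc?-[] : 𝟙 (Inc? n₁ (suc s) []) ≡ + 0
    Inc?-[] = 𝟙-no (Inc? n₁ (suc s) []) (λ h → absurd s h)
      where
      absurd : ∀ s → ¬ Inc n₁ (suc s) []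
      absurd zero    ()
      absurd (suc s) ()
    go : ∀ v → Unique v →
      𝟙 (Inc? n₁ (suc (suc s)) (drop 2 v)) * 𝟙 (Inc? n₂ 2 (take 2 v))
        - 𝟙 (Inc? n₁ (suc (suc (suc s))) (drop 1 v)) * 𝟙 (Inc? n₂ 1 (take 1 v))
        - 𝟙 (Inc? n₁ (suc s) (drop 3 v)) * (- + 1 * krSum (reverse (drop 3 v)) v)
      ≡ 𝟙 (twoWord₁? v) + 𝟙 (twoWord₂? v)
    -- Everything here has degree s + 4, so on fewer than four letters all terms are 0.
    go [] _ = cong (λ z → + 0 - + 0 - z * (- + 1 * krSum [] [])) Inc?-[]
    go v@(_ ∷ []) _ = cong (λ z → + 0 - + 0 - z * (- + 1 * krSum [] v)) Inc?-[]
    go v@(_ ∷ _ ∷ []) _ = cong (λ z → + 0 - + 0 - z * (- + 1 * krSum [] v)) Inc?-[]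
    go v@(x ∷ y ∷ z ∷ []) _ = cong₂ (λ k l → + 0 - k * 𝟙 (inRange? n₂ x) - l * (- + 1 * krSum [] v))
      (𝟙-no (Inc? n₁ (suc (suc (suc s))) (y ∷ z ∷ [])) λ (_ , h) → h) Inc?-[]
    go v@(x₁ ∷ x₂ ∷ x₃ ∷ x₄ ∷ r) ((x₁≢x₂ ∷ x₁≢x₃ ∷ x₁≢x₄ ∷ _) ∷ (x₂≢x₃ ∷ _) ∷ (x₃≢x₄ ∷ _) ∷ _) = begin
      𝟙 (below? x₃ x₄ ×-dec inc?) * 𝟙 x₁x₂
        - 𝟙 (below? x₂ x₃ ×-dec (below? x₃ x₄ ×-dec inc?)) * 𝟙 (inRange? n₂ x₁) - 𝟙 inc? * (- + 1 * krSum u₀ v)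
        ≡⟨ cong₂ (λ a b → a * 𝟙 x₁x₂ - b * 𝟙 (inRange? n₂ x₁) - 𝟙 inc? * (- + 1 * krSum u₀ v))
             (𝟙-× (below? x₃ x₄) inc?)
             (trans (𝟙-× (below? x₂ x₃) (below? x₃ x₄ ×-dec inc?))
                    (cong (𝟙 (below? x₂ x₃) *_) (𝟙-× (below? x₃ x₄) inc?))) ⟩
      𝟙 (below? x₃ x₄) * 𝟙 inc? * 𝟙 x₁x₂
        - 𝟙 (below? x₂ x₃) * (𝟙 (below? x₃ x₄) * 𝟙 inc?) * 𝟙 (inRange? n₂ x₁) - 𝟙 inc? * (- + 1 * krSum u₀ v)
        ≡⟨ factor (𝟙 (below? x₃ x₄)) (𝟙 inc?) (𝟙 x₁x₂) (𝟙 (below? x₂ x₃)) (𝟙 (inRange? n₂ x₁)) (krSum u₀ v) ⟩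
      (E + krSum u₀ v) * 𝟙 inc?
        ≡⟨ cases inc? ⟩
      (𝟙 (topFour₁? n₂ x₁ x₂ x₃ x₄) + 𝟙 (topFour₂? n₂ x₁ x₂ x₃ x₄)) * 𝟙 inc?
        ≡⟨ ℤₚ.*-distribʳ-+ (𝟙 inc?) (𝟙 (topFour₁? n₂ x₁ x₂ x₃ x₄)) _ ⟩
      𝟙 (topFour₁? n₂ x₁ x₂ x₃ x₄) * 𝟙 inc? + 𝟙 (topFour₂? n₂ x₁ x₂ x₃ x₄) * 𝟙 inc?
        ≡⟨ cong₂ _+_ (sym (𝟙-× (topFour₁? n₂ x₁ x₂ x₃ x₄) inc?)) (sym (𝟙-× (topFour₂? n₂ x₁ x₂ x₃ x₄) inc?)) ⟩
      𝟙 (twoWord₁? v) + 𝟙 (twoWord₂? v) ∎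
      where
      u₀ = reverse (x₄ ∷ r)
      inc? = Inc? n₁ (suc s) (x₄ ∷ r)
      x₁x₂ = below? x₁ x₂ ×-dec inRange? n₂ x₂
      E = 𝟙 (below? x₃ x₄) * 𝟙 x₁x₂ - 𝟙 (below? x₂ x₃) * 𝟙 (below? x₃ x₄) * 𝟙 (inRange? n₂ x₁)
      factor : ∀ a i b c d k → a * i * b - c * (a * i) * d - i * (- + 1 * k) ≡ (a * b - c * a * d + k) * i
      factor = solve-∀
      cases : (d : Dec (Inc n₁ (suc s) (x₄ ∷ r))) → (E + krSum u₀ v) * 𝟙 d ≡
        (𝟙 (topFour₁? n₂ x₁ x₂ x₃ x₄) + 𝟙 (topFour₂? n₂ x₁ x₂ x₃ x₄)) * 𝟙 d
      cases (no _) = trans (ℤₚ.*-zeroʳ (E + krSum u₀ v))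
        (sym (ℤₚ.*-zeroʳ (𝟙 (topFour₁? n₂ x₁ x₂ x₃ x₄) + 𝟙 (topFour₂? n₂ x₁ x₂ x₃ x₄))))
      cases (yes inc) = cong (_* + 1) (trans (cong (_+_ E) weights)
        (four-letters n₂ x₁ x₂ x₃ x₄ x₁≢x₂ x₁≢x₃ x₁≢x₄ x₂≢x₃ x₃≢x₄ (ℕₚ.≤-trans (proj₂ (Inc-head s inc)) n₁≤n₂)))
        where
        u₀∈ : All (InRange N) u₀
        u₀∈ = All-resp-↭ (↭-sym (↭-reverse (x₄ ∷ r)))
          (All.map (InRange-mono (ℕₚ.≤-trans n₁≤n₂ n₂≤N)) (Inc-All (suc s) (x₄ ∷ r) inc))
        weight : ∀ a b c → 𝟙 (KRCond? u₀ (a , b , c)) ≡ krWeight n₂ x₄ a b c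
        weight a b c = 𝟙-cong (KRCond? u₀ (a , b , c)) (Chain? n₂ a b c ×-dec (b <? x₄))
          (λ (ch , ab , _) → ch , subst (Above b) (Listₚ.reverse-involutive (x₄ ∷ r)) ab)
          (λ (ch , b<x₄) → ch , subst (Above b) (sym (Listₚ.reverse-involutive (x₄ ∷ r))) b<x₄ , u₀∈)
        weights : krSum u₀ v ≡ krWeight n₂ x₄ x₂ x₃ x₁ - krWeight n₂ x₄ x₁ x₃ x₂
          - krWeight n₂ x₄ x₃ x₁ x₂ + krWeight n₂ x₄ x₂ x₁ x₃
        weights = trans (krSum-letters u₀ x₁ x₂ x₃ (x₄ ∷ r))
          (cong₂ _+_ (cong₂ _-_ (cong₂ _-_ (weight x₂ x₃ x₁) (weight x₁ x₃ x₂)) (weight x₃ x₁ x₂)) (weight x₂ x₁ x₃))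

  coeff-J-krTerms : ∀ w → Unique w →
    coeff (J α n) w - coeff (idealSum krTerms) w ≡ 𝟙 (twoWord₁? (reverse w)) + 𝟙 (twoWord₂? (reverse w))
  coeff-J-krTerms w u = subst
    (λ w′ → coeff (J α n) w′ - coeff (idealSum krTerms) w′ ≡ 𝟙 (twoWord₁? (reverse w)) + 𝟙 (twoWord₂? (reverse w)))
    (Listₚ.reverse-involutive w) (coeffʳ-J-krTerms (reverse w) (unique-reverse u))

  Two-SYT : Tableau → Set
  Two-SYT = SYT (2 ∷ 2 ∷ replicate s 1) n

  -- t p in the first row, z q in the second.
  record Fits (t p z q : ℕ) (ys : List ℕ) : Set where
    field
      1≤t : 1 ≤ t
      t<z : t < z
      t<p : t < p
      p<q : p < q
      z<q : z < q
      q≤n₂ : q ≤ n₂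
      inc : Inc n₁ (suc s) (z ∷ ys)

  SYT⇒fits : ∀ t p z q ys → length ys ≡ s → Two-SYT (twoTableau t p z q ys) → Fits t p z q ys
  SYT⇒fits t p z q ys |ys| T with T.noRepeat
    where module T = SYT T
  ... | (t≢p ∷ t≢z ∷ _) ∷ (p≢z ∷ _) ∷ (z≢q ∷ _) ∷ _ = record
    { 1≤t = proj₁ (within₀ (T.colBound 0 0 t refl))
    ; t<z = T.colsStr 0 0 t z refl refl
    ; t<p = ℕₚ.≤∧≢⇒< (T.rowsWeak 0 0 t p refl refl) t≢p
    ; p<q = T.colsStr 0 1 p q refl refl
    ; z<q = ℕₚ.≤∧≢⇒< (T.rowsWeak 1 0 z q refl refl) z≢q
    ; q≤n₂ = proj₂ (within₁ (T.colBound 1 1 q refl))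
    ; inc = Column⇒Inc s (z ∷ ys) (cong suc |ys| ,
        (λ { zero    x y eq eq′ → T.colsStr 1 0 x y eq (trans (at-singletons-0 ys 0) eq′)
           ; (suc r) x y eq eq′ → T.colsStr (suc (suc r)) 0 x y (trans (at-singletons-0 ys r) eq)
                                                               (trans (at-singletons-0 ys (suc r)) eq′) }) ,
        λ { zero    x eq → within₀ (T.colBound 1 0 x eq)
          ; (suc r) x eq → within₀ (T.colBound (suc (suc r)) 0 x (trans (at-singletons-0 ys r) eq)) })
    }
    where
    module T = SYT T
    within₀ : ∀ {x} → (Σ ℕ λ m → (n !? 0 ≡ just m) × (1 ≤ x × x ≤ m)) → InRange n₁ x
    within₀ (_ , refl , x∈) = x∈
    within₁ : ∀ {x} → (Σ ℕ λ m → (n !? 1 ≡ just m) × (1 ≤ x × x ≤ m)) → InRange n₂ x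
    within₁ (_ , refl , x∈) = x∈

  fits⇒SYT : ∀ t p z q ys → Unique (t ∷ p ∷ z ∷ q ∷ ys) → Fits t p z q ys → Two-SYT (twoTableau t p z q ys)
  fits⇒SYT t p z q ys u fits with Inc⇒Column s (z ∷ ys) (Fits.inc fits)
  ... | |zys| , increasing , bd = record
    { shape = cong (λ l → 2 ∷ 2 ∷ l) (trans (shape-singletons ys) (cong (λ k → replicate k 1) (ℕₚ.suc-injective |zys|)))
    ; rowsWeak = λ
        { zero          zero          _ _ refl refl → ℕₚ.<⇒≤ F.t<p
        ; zero          (suc zero)    _ _ _ ()
        ; zero          (suc (suc _)) _ _ _ ()
        ; (suc zero)    zero          _ _ refl refl → ℕₚ.<⇒≤ F.z<q
        ; (suc zero)    (suc zero)    _ _ _ ()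
        ; (suc zero)    (suc (suc _)) _ _ _ ()
        ; (suc (suc r)) c             _ _ _ eq′ → contradiction (trans (sym eq′) (at-singletons-suc ys r c)) λ () }
    ; colsStr = λ
        { zero          zero          _ _ refl refl → F.t<z
        ; zero          (suc zero)    _ _ refl refl → F.p<q
        ; zero          (suc (suc _)) _ _ () _
        ; (suc zero)    zero          x y eq eq′ → increasing 0 x y eq (trans (sym (at-singletons-0 ys 0)) eq′)
        ; (suc (suc r)) zero          x y eq eq′ → increasing (suc r) x y (trans (sym (at-singletons-0 ys r)) eq)
                                                     (trans (sym (at-singletons-0 ys (suc r))) eq′)
        ; (suc r)       (suc c)       _ _ _ eq′ → contradiction (trans (sym eq′) (at-singletons-suc ys r c)) λ () }
    ; noRepeat = subst (λ l → Unique (t ∷ p ∷ z ∷ q ∷ l)) (sym (concat-singletons ys)) u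
    ; colBound = λ
        { zero          zero          _ refl → n₁ , refl , F.1≤t , ℕₚ.≤-trans (ℕₚ.<⇒≤ F.t<z) (proj₂ (bd 0 z refl))
        ; zero          (suc zero)    _ refl → n₂ , refl , ℕₚ.≤-trans F.1≤t (ℕₚ.<⇒≤ F.t<p) ,
                                                 ℕₚ.≤-trans (ℕₚ.<⇒≤ F.p<q) F.q≤n₂
        ; zero          (suc (suc _)) _ ()
        ; (suc zero)    zero          _ refl → n₁ , refl , bd 0 z refl
        ; (suc zero)    (suc zero)    _ refl → n₂ , refl , ℕₚ.≤-trans (proj₁ (bd 0 z refl)) (ℕₚ.<⇒≤ F.z<q) , F.q≤n₂
        ; (suc zero)    (suc (suc _)) _ ()
        ; (suc (suc r)) zero          x eq → n₁ , refl , bd (suc r) x (trans (sym (at-singletons-0 ys r)) eq)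
        ; (suc (suc r)) (suc c)       _ eq → contradiction (trans (sym eq) (at-singletons-suc ys r c)) λ () }
    }
    where module F = Fits fits

  Creading-SYT Reading-SYT : Tableau → Set
  Creading-SYT T = Two-SYT T × T12>T21 T
  Reading-SYT T  = Two-SYT T × T12<T21 T

  -- The tableau inequalities leave open just the order of `p` and `z`: either `t < z < p < q` or
  -- `t < p < z < q`. These are the two orders in `TopFour₁` and `TopFour₂`.
  creading-fits : ∀ {t p z q ys} → Fits t p z q ys → z < p → TwoWord₁ (p ∷ q ∷ t ∷ z ∷ ys)
  creading-fits fits z<p = ((1≤t , t<z) , z<p , p<q , q≤n₂) , inc where open Fits fits

  reading-fits : ∀ {t p z q ys} → Fits t p z q ys → p < z → TwoWord₂ (p ∷ t ∷ q ∷ z ∷ ys)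
  reading-fits fits p<z = ((1≤t , t<p) , p<z , z<q , q≤n₂) , inc where open Fits fits

  creading-word : ∀ T → Creading-SYT T → TwoWord₁ (reverse (creading T))
  creading-word T (syt , _ , _ , top) with two-shape T s (SYT.shape syt)
  -- Once `T` is known to be a `twoTableau`, the two entries compared by `T12>T21` reduce to `p` and
  -- `z`.
  creading-word T (syt , _ , _ , refl , refl , z<p) | t , p , z , q , ys , refl , |ys| =
    subst TwoWord₁ (sym (trans (cong reverse (creading-two t p z q ys)) (Listₚ.reverse-involutive _)))
      (creading-fits (SYT⇒fits t p z q ys |ys| syt) z<p)

  reading-word : ∀ T → Reading-SYT T → TwoWord₂ (reverse (reading T))
  reading-word T (syt , _ , _ , top) with two-shape T s (SYT.shape syt)
  reading-word T (syt , _ , _ , refl , refl , p<z) | t , p , z , q , ys , refl , |ys| =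
    subst TwoWord₂ (sym (trans (cong reverse (reading-two t p z q ys)) (Listₚ.reverse-involutive _)))
      (reading-fits (SYT⇒fits t p z q ys |ys| syt) p<z)

  coeff-creadings : ∀ ts → Enumerates Creading-SYT ts → ∀ w → Unique w →
    coeff (sumWords (map creading ts)) w ≡ 𝟙 (twoWord₁? (reverse w))
  coeff-creadings ts enum w u = coeff-enumeration creading w (twoWord₁? (reverse w)) exists
    (λ { T P refl → creading-word T P }) injective ts enum
    where
    exists : TwoWord₁ (reverse w) → Σ Tableau λ T → Creading-SYT T × creading T ≡ w
    exists h with reverse w in eq | unique-reverse u
    exists (((1≤t , t<z) , z<p , p<q , q≤n₂) , inc) | p ∷ q ∷ t ∷ z ∷ ys | u′ = twoTableau t p z q ys ,
      (fits⇒SYT t p z q ys (unique-↭ rearrange u′) (record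
        { 1≤t = 1≤t ; t<z = t<z ; t<p = ℕₚ.<-trans t<z z<p ; p<q = p<q ; z<q = ℕₚ.<-trans z<p p<q
        ; q≤n₂ = q≤n₂ ; inc = inc }) , p , z , refl , refl , z<p) ,
      trans (creading-two t p z q ys) (trans (cong reverse (sym eq)) (Listₚ.reverse-involutive w))
      where
      rearrange : p ∷ q ∷ t ∷ z ∷ ys ↭ t ∷ p ∷ z ∷ q ∷ ys
      rearrange = ↭-trans (_↭_.prep p (_↭_.swap q t _↭_.refl)) (_↭_.swap p t (_↭_.swap q z _↭_.refl))
    injective : ∀ T T′ → Creading-SYT T → Creading-SYT T′ → creading T ≡ w → creading T′ ≡ w → T ≡ T′
    injective T T′ (syt , _) (syt′ , _) eq eq′ with two-shape T s (SYT.shape syt) | two-shape T′ s (SYT.shape syt′)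
    ... | t , p , z , q , ys , refl , _ | t′ , p′ , z′ , q′ , ys′ , refl , _
      with Listₚ.reverse-injective {x = p ∷ q ∷ t ∷ z ∷ ys} {y = p′ ∷ q′ ∷ t′ ∷ z′ ∷ ys′}
             (trans (sym (creading-two t p z q ys)) (trans eq (trans (sym eq′) (creading-two t′ p′ z′ q′ ys′))))
    ...   | refl = refl

  coeff-readings : ∀ ts → Enumerates Reading-SYT ts → ∀ w → Unique w →
    coeff (sumWords (map reading ts)) w ≡ 𝟙 (twoWord₂? (reverse w))
  coeff-readings ts enum w u = coeff-enumeration reading w (twoWord₂? (reverse w)) exists
    (λ { T P refl → reading-word T P }) injective ts enum
    where
    exists : TwoWord₂ (reverse w) → Σ Tableau λ T → Reading-SYT T × reading T ≡ w
    exists h with reverse w in eq | unique-reverse u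
    exists (((1≤t , t<p) , p<z , z<q , q≤n₂) , inc) | p ∷ t ∷ q ∷ z ∷ ys | u′ = twoTableau t p z q ys ,
      (fits⇒SYT t p z q ys (unique-↭ rearrange u′) (record
        { 1≤t = 1≤t ; t<z = ℕₚ.<-trans t<p p<z ; t<p = t<p ; p<q = ℕₚ.<-trans p<z z<q ; z<q = z<q
        ; q≤n₂ = q≤n₂ ; inc = inc }) , p , z , refl , refl , p<z) ,
      trans (reading-two t p z q ys) (trans (cong reverse (sym eq)) (Listₚ.reverse-involutive w))
      where
      rearrange : p ∷ t ∷ q ∷ z ∷ ys ↭ t ∷ p ∷ z ∷ q ∷ ys
      rearrange = _↭_.swap p t (_↭_.swap q z _↭_.refl)
    injective : ∀ T T′ → Reading-SYT T → Reading-SYT T′ → reading T ≡ w → reading T′ ≡ w → T ≡ T′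
    injective T T′ (syt , _) (syt′ , _) eq eq′ with two-shape T s (SYT.shape syt) | two-shape T′ s (SYT.shape syt′)
    ... | t , p , z , q , ys , refl , _ | t′ , p′ , z′ , q′ , ys′ , refl , _
      with Listₚ.reverse-injective {x = p ∷ t ∷ q ∷ z ∷ ys} {y = p′ ∷ t′ ∷ q′ ∷ z′ ∷ ys′}
             (trans (sym (reading-two t p z q ys)) (trans eq (trans (sym eq′) (reading-two t′ p′ z′ q′ ys′))))
    ...   | refl = refl

  Inc-All-N : ∀ {z ys} → Inc n₁ (suc s) (z ∷ ys) → All (InRange N) (z ∷ ys)
  Inc-All-N inc = All.map (InRange-mono (ℕₚ.≤-trans n₁≤n₂ n₂≤N)) (Inc-All (suc s) _ inc)

  twoWord₁-All : ∀ v → TwoWord₁ v → All (InRange N) v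
  twoWord₁-All (p ∷ q ∷ t ∷ z ∷ ys) (((1≤t , t<z) , z<p , p<q , q≤n₂) , inc) with Inc-All-N inc
  ... | z∈@(1≤z , z≤N) ∷ ys∈ =
    (1≤p , ℕₚ.≤-trans (ℕₚ.<⇒≤ p<q) q≤N) ∷ (ℕₚ.≤-trans 1≤p (ℕₚ.<⇒≤ p<q) , q≤N) ∷
    (1≤t , ℕₚ.≤-trans (ℕₚ.<⇒≤ t<z) z≤N) ∷ z∈ ∷ ys∈
    where
    q≤N = ℕₚ.≤-trans q≤n₂ n₂≤N
    1≤p = ℕₚ.≤-trans 1≤z (ℕₚ.<⇒≤ z<p)

  twoWord₂-All : ∀ v → TwoWord₂ v → All (InRange N) v
  twoWord₂-All (p ∷ t ∷ q ∷ z ∷ ys) (((1≤t , t<p) , p<z , z<q , q≤n₂) , inc) with Inc-All-N inc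
  ... | z∈@(1≤z , z≤N) ∷ ys∈ =
    (ℕₚ.≤-trans 1≤t (ℕₚ.<⇒≤ t<p) , p≤N) ∷ (1≤t , ℕₚ.≤-trans (ℕₚ.<⇒≤ t<p) p≤N) ∷
    (ℕₚ.≤-trans 1≤z (ℕₚ.<⇒≤ z<q) , ℕₚ.≤-trans q≤n₂ n₂≤N) ∷ z∈ ∷ ys∈
    where p≤N = ℕₚ.≤-trans (ℕₚ.<⇒≤ p<z) z≤N

  words-supported : ∀ {P : Tableau → Set} {Q : Word → Set} (f : Tableau → Word) →
    (∀ T → P T → Q (reverse (f T))) → (∀ v → Q v → All (InRange N) v) →
    ∀ ts → Enumerates P ts → Supported N (sumWords (map f ts))
  words-supported f P⇒Q Q⇒All ts (_ , ts-P) = Allₚ.map⁺ (Allₚ.map⁺ (All.tabulate λ {T} T∈ →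
    All-resp-↭ (↭-reverse (f T)) (Q⇒All _ (P⇒Q T (Equivalence.to (ts-P T) T∈)))))

  two-cong : ∀ ts₁ ts₂ → Enumerates Creading-SYT ts₁ → Enumerates Reading-SYT ts₂ →
    Cong N (J α n) (sumWords (map creading ts₁ ++ map reading ts₂))
  two-cong ts₁ ts₂ enum₁ enum₂ = subst (Cong N (J α n)) (sym (Listₚ.map-++ _ (map creading ts₁) (map reading ts₂)))
    (cong-on-unique (J-supported α n≤N)
      (Allₚ.++⁺ (words-supported creading creading-word twoWord₁-All ts₁ enum₁)
                (words-supported reading reading-word twoWord₂-All ts₂ enum₂))
      krTerms
      λ w u → trans (coeff-J-krTerms w u) (sym (trans
        (coeff-++ (sumWords (map creading ts₁)) (sumWords (map reading ts₂)) w)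
        (cong₂ _+_ (coeff-creadings ts₁ enum₁ w u) (coeff-readings ts₂ enum₂ w u)))))

  -- The two families order x₁ and x₄ oppositely, so they are disjoint and the sum of their
  -- indicators is again an indicator.
  two-positive : PositiveSum N (J α n)
  two-positive = positive-on-unique (J-supported α n≤N) krTerms
    (λ w → twoWord₁? (reverse w) ⊎-dec twoWord₂? (reverse w))
    λ w u → trans (coeff-J-krTerms w u) (sym
      (𝟙-⊎ (twoWord₁? (reverse w)) (twoWord₂? (reverse w)) (disjoint (reverse w))))
    where
    disjoint : ∀ v → TwoWord₁ v → ¬ TwoWord₂ v
    disjoint (x₁ ∷ x₂ ∷ x₃ ∷ x₄ ∷ r) ((_ , x₄<x₁ , _) , _) ((_ , x₁<x₄ , _) , _) = ℕₚ.<-asym x₄<x₁ x₁<x₄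

-- Constant bounds and the theorem

Linked-replicate : ∀ (k m : ℕ) → Linked _≤_ (replicate k m)
Linked-replicate zero          m = []
Linked-replicate (suc zero)    m = [-]
Linked-replicate (suc (suc k)) m = ℕₚ.≤-refl ∷ Linked-replicate (suc k) m

-- The conjugate of a hook is a hook, so this is `hook-positive` with arm and leg exchanged and all
-- bounds equal to `N`.
frakJ-hook-positive : ∀ N a b → PositiveSum N (frakJ N (hook (suc a) b))
frakJ-hook-positive N a b = subst (λ μ → PositiveSum N (J μ (replicate (length μ) N))) (sym (conj-hook a b))
  (hook-positive N (replicate l N) (Linked-replicate l N) (Allₚ.replicate⁺ l ℕₚ.≤-refl) b a
    (trans (Listₚ.length-replicate l) (cong suc (Listₚ.length-replicate a))))
  where l = length (hook (suc b) a)

frakJ-two-positive : ∀ N s → PositiveSum N (frakJ N (conj (suc (suc s) ∷ 2 ∷ [])))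
frakJ-two-positive N s = subst (λ μ → PositiveSum N (J μ (replicate (length μ) N)))
  (sym (trans (cong conj (conj-two s)) (conj-conj-two s))) two-positive
  where open TwoColumns N s N N ℕₚ.≤-refl ℕₚ.≤-refl

theorem4p6 : ((N : ℕ) (n : List ℕ) → Linked _≤_ n → All (_≤ N) n →
    ((a b : ℕ) → 1 ≤ a → length n ≡ suc b →
    (ts : List Tableau) → Enumerates (SYT (conj (hook a b)) n) ts →
    Cong N (J (hook a b) n) (sumWords (map creading ts)))
    ×
    ((a : ℕ) → 2 ≤ a → length n ≡ 2 →
    (ts₁ ts₂ : List Tableau) →
    Enumerates (λ T → SYT (conj (a ∷ 2 ∷ [])) n T × T12>T21 T) ts₁ →
    Enumerates (λ T → SYT (conj (a ∷ 2 ∷ [])) n T × T12<T21 T) ts₂ →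
    Cong N (J (a ∷ 2 ∷ []) n) (sumWords (map creading ts₁ ++ map reading ts₂))))
    ×
    ((N : ℕ) →
    ((a b : ℕ) → 1 ≤ a → PositiveSum N (frakJ N (hook a b)))
    ×
    ((a : ℕ) → 2 ≤ a → PositiveSum N (frakJ N (conj (a ∷ 2 ∷ [])))))
theorem4p6 = (λ N n mono n≤N → hookCase N n mono n≤N , twoCase N n mono n≤N) ,
             (λ N → (λ { (suc a) b _ → frakJ-hook-positive N a b }) ,
                    (λ { (suc (suc s)) _ → frakJ-two-positive N s ; (suc zero) (s≤s ()) }))
  where
  hookCase : ∀ N n → Linked _≤_ n → All (_≤ N) n → ∀ a b → 1 ≤ a → length n ≡ suc b → ∀ ts →
    Enumerates (SYT (conj (hook a b)) n) ts → Cong N (J (hook a b) n) (sumWords (map creading ts))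
  hookCase N n mono n≤N (suc a) b _ |n| ts enum = hook-cong N n mono n≤N a b |n| ts
    (subst (λ μ → Enumerates (SYT μ n) ts) (conj-hook a b) enum)

  twoCase : ∀ N n → Linked _≤_ n → All (_≤ N) n → ∀ a → 2 ≤ a → length n ≡ 2 → ∀ ts₁ ts₂ →
    Enumerates (λ T → SYT (conj (a ∷ 2 ∷ [])) n T × T12>T21 T) ts₁ →
    Enumerates (λ T → SYT (conj (a ∷ 2 ∷ [])) n T × T12<T21 T) ts₂ →
    Cong N (J (a ∷ 2 ∷ []) n) (sumWords (map creading ts₁ ++ map reading ts₂))
  twoCase N (n₁ ∷ n₂ ∷ []) (n₁≤n₂ ∷ _) (_ ∷ n₂≤N ∷ []) (suc (suc s)) _ refl ts₁ ts₂ enum₁ enum₂ =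
    TwoColumns.two-cong N s n₁ n₂ n₁≤n₂ n₂≤N ts₁ ts₂
      (subst (λ μ → Enumerates (λ T → SYT μ (n₁ ∷ n₂ ∷ []) T × T12>T21 T) ts₁) (conj-two s) enum₁)
      (subst (λ μ → Enumerates (λ T → SYT μ (n₁ ∷ n₂ ∷ []) T × T12<T21 T) ts₂) (conj-two s) enum₂)
  twoCase N n mono n≤N (suc zero) (s≤s ()) |n| ts₁ ts₂ enum₁ enum₂
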